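{- Let $r\geq s\geq 2$ be integers, let $n>r^{8}$ be an integer, and let $G$ be a graph of order $n$ with $k_{s}(G)\geq k_{s}(T_{r}(n))$. Then \[ \mathrm{js}_{r+1}(G)>\frac{n^{r-1}}{(4r)^{r+6}} \] unless $G$ is isomorphic to $T_{r}(n)$.
   Context: All graphs are finite and simple. For a graph $G$, $k_{t}(G)$ denotes the number of $t$-cliques (complete subgraphs on $t$ vertices) of $G$. $T_{r}(n)$ denotes the $r$-partite Turán graph of order $n$, i.e. the complete $r$-partite graph on $n$ vertices whose $r$ vertex classes have sizes differing by at most one. An $r$-joint of size $t$ in $G$ is a collection of $t$ distinct $r$-cliques of $G$ all containing a common edge (two cliques of the joint may share up to $r-1$ vertices). $\mathrm{js}_{r}(G)$ denotes the maximum size of an $r$-joint in $G$, i.e. the maximum over all edges $e$ of $G$ of the number of $r$-cliques of $G$ containing $e$. -}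

module Defs where

open import Data.Bool using (Bool; true; false; _∧_; if_then_else_)
open import Data.Nat using (ℕ; zero; suc; _+_; _*_; _⊔_; _≟_; NonZero)
open import Data.Nat.DivMod using (_%_)
open import Data.Fin using (Fin; toℕ)
open import Data.Fin.Subset using (Subset; _∈_; ∣_∣)
open import Data.Vec using (Vec; []; _∷_)
open import Data.List using (List; []; _∷_; map; _++_; filter; length; foldr; allFin; concatMap)
open import Data.List.Relation.Unary.All using (All)
open import Relation.Nullary using (Dec; ¬_)
open import Relation.Nullary.Decidable using (⌊_⌋)
open import Relation.Binary.PropositionalEquality using (_≡_)
open import Function.Bundles using (_↔_; Inverse)

record Graph (n : ℕ) : Set where
  field
    adj   : Fin n → Fin n → Bool
    adj-sym : ∀ u v → adj u v ≡ adj v u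
    adj-irrefl : ∀ u → adj u u ≡ false
open Graph public

_≅_ : {n : ℕ} → Graph n → Graph n → Set
_≅_ {n} G H = Σ' (Fin n ↔ Fin n) (λ f → ∀ u v → adj G u v ≡ adj H (Inverse.to f u) (Inverse.to f v))
  where
  open import Data.Product using () renaming (Σ to Σ')

allSubsets : (n : ℕ) → List (Subset n)
allSubsets zero = [] ∷ []
allSubsets (suc n) = map (true ∷_) (allSubsets n) ++ map (false ∷_) (allSubsets n)

mem : {n : ℕ} → Subset n → Fin n → Bool
mem (b ∷ _) Fin.zero = b
mem (_ ∷ p) (Fin.suc i) = mem p i

allV : {n : ℕ} → (Fin n → Bool) → Bool
allV {n} P = foldr _∧_ true (map P (allFin n))

isClique : {n : ℕ} → Graph n → Subset n → Bool
isClique {n} G S =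
  allV (λ u → allV (λ v →
    if mem S u ∧ mem S v ∧ not' ⌊ toℕ u ≟ toℕ v ⌋ then adj G u v else true))
  where
  not' : Bool → Bool
  not' true = false
  not' false = true

tCliques : {n : ℕ} → ℕ → Graph n → List (Subset n)
tCliques {n} t G = filter (λ S → (⌊ ∣ S ∣ ≟ t ⌋ ∧ isClique G S) Data.Bool.≟ true) (allSubsets n)
  where import Data.Bool

k : {n : ℕ} → ℕ → Graph n → ℕ
k t G = length (tCliques t G)

cliquesThrough : {n : ℕ} → ℕ → Graph n → Fin n → Fin n → ℕ
cliquesThrough t G u v =
  length (filter (λ S → (mem S u ∧ mem S v) Data.Bool.≟ true) (tCliques t G))
  where import Data.Bool

-- js_t(G): maximum over edges uv of G of the number of t-cliques containing uv
-- (0 if G has no edges).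
js : {n : ℕ} → ℕ → Graph n → ℕ
js {n} t G =
  foldr _⊔_ 0 (concatMap (λ u → map (λ v →
    if adj G u v then cliquesThrough t G u v else 0) (allFin n)) (allFin n))

-- The r-partite Turán graph T_r(n): vertex i lies in class (i mod r);
-- two vertices are adjacent iff their classes differ. Class sizes differ by at most one.
turán : (r n : ℕ) → .{{NonZero r}} → Graph n
turán r n = record
  { adj = λ u v → not' ⌊ toℕ u % r ≟ toℕ v % r ⌋
  ; adj-sym = λ u v → symP u v
  ; adj-irrefl = λ u → irr u }
  where
  open import Relation.Nullary using (yes; no)
  open import Relation.Binary.PropositionalEquality using (refl; sym)
  not' : Bool → Bool
  not' true = false
  not' false = true
  symP : ∀ u v → not' ⌊ toℕ u % r ≟ toℕ v % r ⌋ ≡ not' ⌊ toℕ v % r ≟ toℕ u % r ⌋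
  symP u v with toℕ u % r ≟ toℕ v % r | toℕ v % r ≟ toℕ u % r
  ... | yes _ | yes _ = refl
  ... | no _ | no _ = refl
  ... | yes p | no q = Data.Empty.⊥-elim (q (sym p)) where import Data.Empty
  ... | no p | yes q = Data.Empty.⊥-elim (p (sym q)) where import Data.Empty
  irr : ∀ u → not' ⌊ toℕ u % r ≟ toℕ u % r ⌋ ≡ false
  irr u with toℕ u % r ≟ toℕ u % r
  ... | yes _ = refl
  ... | no q = Data.Empty.⊥-elim (q refl) where import Data.Empty

{-# OPTIONS --safe #-}

-- Suppose that every edge lies in at most n^(r-1) / (4r)^(r+6) of the (r+1)-cliques, and let
-- c t U be the number of ordered t-cliques in a vertex set U. By the Moon–Moser inequality
-- the s-cliques of any large set are then almost as few as in an r-partite graph, and the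
-- (s-1)-cliques in a neighbourhood almost as few as in an (r-1)-partite graph. Hence among m
-- vertices one of degree below about (1 - 1/r - 1/r⁴)m lies in fewer s-cliques than the last
-- vertex of T_r(m). Deleting such vertices one by one increases the surplus of s-cliques over
-- the Turán graph, which becomes impossible before n/2 vertices are deleted, so the process
-- stops at a set of large minimum degree. If this set contains no (r+1)-clique, then by
-- Zykov's theorem the surplus is zero, so nothing was deleted and G is T_r(n) by the equality
-- case. Otherwise, by averaging over the edges of an (r+1)-clique, one of them has noticeably
-- more than (1 - 2/r)m common neighbours, and greedy extension yields too many (r+1)-cliques
-- containing it.
module Submission where

open import Defs
open import Data.Bool using (Bool; true; false; _∧_; not; if_then_else_; _≟_)
open import Data.Bool.Properties using (∧-comm; ∧-assoc; ∧-zeroʳ; ∧-identityʳ; ¬-not; not-involutive)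
open import Data.Empty using (⊥)
open import Data.Fin using (Fin; zero; suc; toℕ; fromℕ<; punchIn)
open import Data.Fin.Permutation as Perm using (Permutation; _⟨$⟩ʳ_; _⟨$⟩ˡ_; insert; insert-punchIn)
open import Data.Fin.Properties using (toℕ<n; toℕ-injective; toℕ-fromℕ<; suc-injective; any?; all?)
  renaming (_≟_ to _≟F_)
open import Data.Fin.Subset using (Subset; ∣_∣)
open import Data.List using (List; []; _∷_; map; _++_; filter; length; foldr; allFin)
open import Data.List.Membership.Propositional using (lose) renaming (_∈_ to _∈ᴸ_)
open import Data.List.Membership.Propositional.Properties using (∈-map⁺; ∈-allFin; ∈-concatMap⁺)
open import Data.List.Properties using (filter-++; length-++)
open import Data.List.Relation.Unary.Any using (here; there)
open import Data.Nat using (ℕ; zero; suc; 2+; pred; _+_; _*_; _^_; _∸_; _≤_; _<_; _⊔_; _!; z≤n; s≤s; s≤s⁻¹; NonZero; >-nonZero)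
  renaming (_≟_ to _≟ℕ_)
open import Data.Nat.DivMod using (_/_; _%_; m≡m%n+[m/n]*n; m%n<n; [m+kn]%n≡m%n; m<n⇒m%n≡m)
open import Data.Nat.Properties
  hiding (_≟_)
  renaming (suc-injective to suc-injectiveℕ)
open import Data.Nat.Tactic.RingSolver using (solve-∀)
open import Data.Product using (Σ; ∃; _×_; _,_; proj₁; proj₂)
open import Data.Sum using (_⊎_; inj₁; inj₂)
open import Data.Vec using (_∷_; [])
open import Function using (_∘_)
open import Relation.Binary.Definitions using (DecidableEquality)
open import Relation.Binary.PropositionalEquality
open import Relation.Nullary using (¬_; Dec; yes; no; contradiction)
open import Relation.Nullary.Decidable using (⌊_⌋; _×-dec_; ¬?; decidable-stable)

open import Algebra.Properties.Semiring.Sum +-*-semiring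
  using (sum; sum-cong-≗; ∑-distrib-+; ∑-comm; *-distribˡ-sum; sum-remove)

-- All estimates stay in the natural numbers: ordered cliques need no binomial coefficients, and
-- bounds of the form q|U| - tE enter through the recursion they satisfy, not through subtraction.
--
-- The obstacle is to find one scale that serves every estimate. Choose Z with r^5 Z between n/6 and
-- n/4, and let a = 3r^4 Z. Deletion stops at ra vertices, at least n/2, and at least r^5 Z vertices
-- lie above that mark. As n > r^8, also Z >= r - 1, so Z absorbs the rounding of Turán class sizes.
--
-- A vertex is deleted if its degree is at least X = (3r - 5)Z below that of the last vertex of
-- T_r(m). This X covers r - 1 losses of 3Z in the neighbourhood, less the 2Z by which the last
-- factor may stay positive. It is still small against m/r^3, so an edge of a surviving (r+1)-clique
-- keeps enough common neighbours.
--
-- Each deletion gains sXκ ordered s-cliques, where κ counts ordered (s-2)-cliques in the common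
-- neighbourhood of an edge of T_r(ra). At size ra the approximate Zykov theorem has relative error
-- at most 2sr/(18r^6), and the accumulated gain exceeds that by a factor of at least r/(r-1).

variable
  n : ℕ

-- Vertex sets as Boolean predicates, and sums over them

Sub : ℕ → Set
Sub n = Fin n → Bool

infix 4 _∈_ _⊆_ _≐_
infixl 7 _∩_
infixl 6 _-_

_∈_ : Fin n → Sub n → Set
v ∈ U = U v ≡ true

_⊆_ _≐_ : Sub n → Sub n → Set
U ⊆ W = ∀ v → v ∈ U → v ∈ W
U ≐ W = ∀ v → U v ≡ W v

_∩_ : Sub n → Sub n → Sub n
(U ∩ W) v = U v ∧ W v

_-_ : Sub n → Fin n → Sub n
(U - v) x = U x ∧ not ⌊ x ≟F v ⌋

full : Sub n
full _ = true

⟦_⟧ : Bool → ℕ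
⟦ true ⟧ = 1
⟦ false ⟧ = 0

∑∈ : Sub n → (Fin n → ℕ) → ℕ
∑∈ U f = sum (λ v → ⟦ U v ⟧ * f v)

# : Sub n → ℕ
# U = ∑∈ U (λ _ → 1)

∧-true : ∀ {a b} → a ≡ true → b ≡ true → a ∧ b ≡ true
∧-true refl refl = refl

∧-trueˡ : ∀ {a b} → a ∧ b ≡ true → a ≡ true
∧-trueˡ {true} _ = refl

∧-trueʳ : ∀ {a b} → a ∧ b ≡ true → b ≡ true
∧-trueʳ {true} e = e

true≢false : ∀ {b} → b ≡ true → b ≡ false → ⊥
true≢false refl ()

bool-ext : ∀ {a b} → (a ≡ true → b ≡ true) → (b ≡ true → a ≡ true) → a ≡ b
bool-ext {true} {true} _ _ = refl
bool-ext {true} {false} f _ = sym (f refl)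
bool-ext {false} {true} _ g = g refl
bool-ext {false} {false} _ _ = refl

⟦∧⟧ : ∀ a b x → ⟦ a ∧ b ⟧ * x ≡ ⟦ a ⟧ * (⟦ b ⟧ * x)
⟦∧⟧ true b x = sym (*-identityˡ (⟦ b ⟧ * x))
⟦∧⟧ false b x = refl

sum-mono : (f g : Fin n → ℕ) → (∀ v → f v ≤ g v) → sum f ≤ sum g
sum-mono {zero} f g h = z≤n
sum-mono {suc n} f g h = +-mono-≤ (h zero) (sum-mono (f ∘ suc) (g ∘ suc) (h ∘ suc))

∑∈-cong : {U W : Sub n} {f g : Fin n → ℕ} → U ≐ W → (∀ v → v ∈ W → f v ≡ g v) →
  ∑∈ U f ≡ ∑∈ W g
∑∈-cong {U = U} {W} {f} {g} e h = sum-cong-≗ pt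
  where
  pt : ∀ v → ⟦ U v ⟧ * f v ≡ ⟦ W v ⟧ * g v
  pt v rewrite e v with W v in eq
  ... | true = cong (_+ 0) (h v eq)
  ... | false = refl

∑∈-mono : {U W : Sub n} {f g : Fin n → ℕ} → U ⊆ W → (∀ v → v ∈ U → f v ≤ g v) →
  ∑∈ U f ≤ ∑∈ W g
∑∈-mono {U = U} {W} {f} {g} e h = sum-mono _ _ pt
  where
  pt : ∀ v → ⟦ U v ⟧ * f v ≤ ⟦ W v ⟧ * g v
  pt v with U v in eq
  ... | false = z≤n
  ... | true rewrite e v eq = +-monoˡ-≤ 0 (h v eq)

∑∈-+ : (U : Sub n) (f g : Fin n → ℕ) → ∑∈ U (λ v → f v + g v) ≡ ∑∈ U f + ∑∈ U g
∑∈-+ U f g = trans (sum-cong-≗ λ v → *-distribˡ-+ ⟦ U v ⟧ (f v) (g v)) (∑-distrib-+ (λ v → ⟦ U v ⟧ * f v) (λ v → ⟦ U v ⟧ * g v))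

x*yz≡y*xz : ∀ x y z → x * (y * z) ≡ y * (x * z)
x*yz≡y*xz = solve-∀

∑∈-*ˡ : (U : Sub n) (k : ℕ) (f : Fin n → ℕ) → ∑∈ U (λ v → k * f v) ≡ k * ∑∈ U f
∑∈-*ˡ U k f = trans (sum-cong-≗ λ v → x*yz≡y*xz ⟦ U v ⟧ k (f v)) (sym (*-distribˡ-sum k (λ v → ⟦ U v ⟧ * f v)))

∑∈-const : (U : Sub n) (k : ℕ) → ∑∈ U (λ _ → k) ≡ # U * k
∑∈-const U k = begin
  ∑∈ U (λ _ → k)      ≡⟨ ∑∈-cong {U = U} (λ _ → refl) (λ _ _ → sym (*-identityʳ k)) ⟩
  ∑∈ U (λ _ → k * 1)  ≡⟨ ∑∈-*ˡ U k (λ _ → 1) ⟩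
  k * # U             ≡⟨ *-comm k _ ⟩
  # U * k             ∎
  where open ≡-Reasoning

∑∈-∩ : (U P : Sub n) (f : Fin n → ℕ) → ∑∈ (U ∩ P) f ≡ ∑∈ U (λ v → ⟦ P v ⟧ * f v)
∑∈-∩ U P f = sum-cong-≗ λ v → ⟦∧⟧ (U v) (P v) (f v)

∑∈-split : (U P : Sub n) (f : Fin n → ℕ) → ∑∈ U f ≡ ∑∈ (U ∩ P) f + ∑∈ (U ∩ (not ∘ P)) f
∑∈-split U P f = begin
  ∑∈ U f                                          ≡⟨ ∑∈-cong {U = U} (λ _ → refl) (λ v _ → pt (P v) (f v)) ⟩
  ∑∈ U (λ v → ⟦ P v ⟧ * f v + ⟦ not (P v) ⟧ * f v) ≡⟨ ∑∈-+ U _ _ ⟩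
  ∑∈ U (λ v → ⟦ P v ⟧ * f v) + ∑∈ U (λ v → ⟦ not (P v) ⟧ * f v)
    ≡⟨ cong₂ _+_ (∑∈-∩ U P f) (∑∈-∩ U (not ∘ P) f) ⟨
  ∑∈ (U ∩ P) f + ∑∈ (U ∩ (not ∘ P)) f ∎
  where
  open ≡-Reasoning
  pt : ∀ b x → x ≡ ⟦ b ⟧ * x + ⟦ not b ⟧ * x
  pt true = solve-∀
  pt false = solve-∀

-- The hypothesis says that both iterated ranges describe the same set of pairs. This is the tool
-- for double counts whose inner range depends on the outer variable.
∑∈-swap : ∀ {m} (U : Sub m) (U′ : Sub n) (P : Fin m → Sub n) (P′ : Fin n → Sub m) (f : Fin m → Fin n → ℕ) →
  (∀ u v → U u ∧ P u v ≡ U′ v ∧ P′ v u) →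
  ∑∈ U (λ u → ∑∈ (P u) (f u)) ≡ ∑∈ U′ (λ v → ∑∈ (P′ v) (λ u → f u v))
∑∈-swap U U′ P P′ f h = begin
  ∑∈ U (λ u → ∑∈ (P u) (f u))
    ≡⟨ sum-cong-≗ (λ u → *-distribˡ-sum ⟦ U u ⟧ (λ v → ⟦ P u v ⟧ * f u v)) ⟩
  sum (λ u → sum (λ v → ⟦ U u ⟧ * (⟦ P u v ⟧ * f u v)))
    ≡⟨ sum-cong-≗ (λ u → sum-cong-≗ (λ v → pt u v)) ⟩
  sum (λ u → sum (λ v → ⟦ U′ v ⟧ * (⟦ P′ v u ⟧ * f u v)))
    ≡⟨ ∑-comm (λ u v → ⟦ U′ v ⟧ * (⟦ P′ v u ⟧ * f u v)) ⟩
  sum (λ v → sum (λ u → ⟦ U′ v ⟧ * (⟦ P′ v u ⟧ * f u v)))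
    ≡⟨ sum-cong-≗ (λ v → *-distribˡ-sum ⟦ U′ v ⟧ (λ u → ⟦ P′ v u ⟧ * f u v)) ⟨
  ∑∈ U′ (λ v → ∑∈ (P′ v) (λ u → f u v)) ∎
  where
  open ≡-Reasoning
  pt : ∀ u v → ⟦ U u ⟧ * (⟦ P u v ⟧ * f u v) ≡ ⟦ U′ v ⟧ * (⟦ P′ v u ⟧ * f u v)
  pt u v = trans (sym (⟦∧⟧ (U u) (P u v) _))
    (trans (cong (λ b → ⟦ b ⟧ * f u v) (h u v)) (⟦∧⟧ (U′ v) (P′ v u) _))

≟-refl : (v : Fin n) → ⌊ v ≟F v ⌋ ≡ true
≟-refl v with v ≟F v
... | yes _ = refl
... | no q = contradiction refl q

∈-remove : (U : Sub n) {v x : Fin n} → x ∈ U → x ≢ v → x ∈ U - v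
∈-remove U {v} {x} x∈ ne with x ≟F v
... | yes p = contradiction p ne
... | no _ = trans (∧-identityʳ (U x)) x∈

remove-⊆ : (U : Sub n) (v : Fin n) → U - v ⊆ U
remove-⊆ U v x = ∧-trueˡ

∈-remove-≢ : (U : Sub n) {v x : Fin n} → x ∈ U - v → x ≢ v
∈-remove-≢ U {v} x∈ refl = true≢false (∧-trueʳ {U v} x∈) (cong not (≟-refl v))

∉-remove : (U : Sub n) (v : Fin n) → U v ≡ false → U ≐ U - v
∉-remove U v v∉ x with x ≟F v
... | yes refl = trans v∉ (sym (∧-zeroʳ (U x)))
... | no _ = sym (∧-identityʳ (U x))

sum-at : (v : Fin n) (f : Fin n → ℕ) → sum (λ x → ⟦ ⌊ x ≟F v ⌋ ⟧ * f x) ≡ f v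
sum-at v f = trans (sum-cong-≗ pt) (lemma v f)
  where
  -- An equality test that recurses with the index turns the sum at `suc v` definitionally into the
  -- sum at `v`.
  eqb : ∀ {m} → Fin m → Fin m → Bool
  eqb zero zero = true
  eqb zero (suc _) = false
  eqb (suc _) zero = false
  eqb (suc x) (suc y) = eqb x y
  eqb-refl : ∀ {m} (x : Fin m) → eqb x x ≡ true
  eqb-refl zero = refl
  eqb-refl (suc x) = eqb-refl x
  eqb-≢ : ∀ {m} (x y : Fin m) → x ≢ y → eqb x y ≡ false
  eqb-≢ zero zero ne = contradiction refl ne
  eqb-≢ zero (suc y) ne = refl
  eqb-≢ (suc x) zero ne = refl
  eqb-≢ (suc x) (suc y) ne = eqb-≢ x y (ne ∘ cong suc)
  pt : ∀ x → ⟦ ⌊ x ≟F v ⌋ ⟧ * f x ≡ ⟦ eqb x v ⟧ * f x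
  pt x with x ≟F v
  ... | yes refl rewrite eqb-refl x = refl
  ... | no ne rewrite eqb-≢ x v ne = refl
  none : ∀ {m} (g : Fin m → ℕ) → sum (λ x → 0 * g x) ≡ 0
  none {zero} g = refl
  none {suc m} g = none (g ∘ suc)
  lemma : ∀ {m} (v : Fin m) (g : Fin m → ℕ) → sum (λ x → ⟦ eqb x v ⟧ * g x) ≡ g v
  lemma {suc m} zero g = trans (cong₂ _+_ (+-identityʳ (g zero)) (none (g ∘ suc))) (+-identityʳ (g zero))
  lemma {suc m} (suc v) g = lemma v (g ∘ suc)

∑∈-remove : (U : Sub n) (v : Fin n) (f : Fin n → ℕ) → v ∈ U → ∑∈ U f ≡ ∑∈ (U - v) f + f v
∑∈-remove U v f v∈ = begin
  ∑∈ U f ≡⟨ ∑∈-split U (λ x → ⌊ x ≟F v ⌋) f ⟩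
  ∑∈ (U ∩ (λ x → ⌊ x ≟F v ⌋)) f + ∑∈ (U - v) f ≡⟨ +-comm _ (∑∈ (U - v) f) ⟩
  ∑∈ (U - v) f + ∑∈ (U ∩ (λ x → ⌊ x ≟F v ⌋)) f ≡⟨ cong (∑∈ (U - v) f +_) (trans (sum-cong-≗ pt) (sum-at v f)) ⟩
  ∑∈ (U - v) f + f v ∎
  where
  open ≡-Reasoning
  pt : ∀ x → ⟦ U x ∧ ⌊ x ≟F v ⌋ ⟧ * f x ≡ ⟦ ⌊ x ≟F v ⌋ ⟧ * f x
  pt x with x ≟F v
  ... | yes refl rewrite v∈ = refl
  ... | no _ rewrite ∧-zeroʳ (U x) = refl

#-remove : (U : Sub n) (v : Fin n) → v ∈ U → # U ≡ suc (# (U - v))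
#-remove U v v∈ = trans (∑∈-remove U v _ v∈) (+-comm (# (U - v)) 1)

#-mono : {U W : Sub n} → U ⊆ W → # U ≤ # W
#-mono {U = U} h = ∑∈-mono {U = U} h (λ _ _ → ≤-refl)

#-cong : {U W : Sub n} → U ≐ W → # U ≡ # W
#-cong {U = U} h = ∑∈-cong {U = U} h (λ _ _ → refl)

#-full : # (full {n}) ≡ n
#-full {zero} = refl
#-full {suc n} = cong suc (#-full {n})

∑∈-positive : (U : Sub n) (f : Fin n → ℕ) → 0 < ∑∈ U f → ∃ λ v → v ∈ U × 0 < f v
∑∈-positive {suc n} U f p with U zero in eq | f zero in eqf
... | true | suc k = zero , eq , subst (0 <_) (sym eqf) (s≤s z≤n)
... | false | _ = let v , v∈ , h = ∑∈-positive (U ∘ suc) (f ∘ suc) p in suc v , v∈ , h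
... | true | zero = let v , v∈ , h = ∑∈-positive (U ∘ suc) (f ∘ suc) p in suc v , v∈ , h

∈⇒#-positive : (U : Sub n) {v : Fin n} → v ∈ U → 0 < # U
∈⇒#-positive U {v} v∈ = subst (0 <_) (sym (#-remove U v v∈)) (s≤s z≤n)

∑∈≤#* : (U : Sub n) (f : Fin n → ℕ) (b : ℕ) → (∀ v → v ∈ U → f v ≤ b) → ∑∈ U f ≤ # U * b
∑∈≤#* U f b h = ≤-trans (∑∈-mono {U = U} (λ _ p → p) h) (≤-reflexive (∑∈-const U b))

#*≤∑∈ : (U : Sub n) (f : Fin n → ℕ) (b : ℕ) → (∀ v → v ∈ U → b ≤ f v) → # U * b ≤ ∑∈ U f
#*≤∑∈ U f b h = ≤-trans (≤-reflexive (sym (∑∈-const U b))) (∑∈-mono {U = U} (λ _ p → p) h)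

#≡0⇒∉ : (U : Sub n) → # U ≡ 0 → ∀ v → U v ≡ false
#≡0⇒∉ U e v with U v in eq
... | false = refl
... | true = contradiction (∈⇒#-positive U eq) (subst (λ k → ¬ 0 < k) (sym e) (λ ()))

∩-swap : (U P Q : Sub n) → U ∩ P ∩ Q ≐ U ∩ Q ∩ P
∩-swap U P Q x = trans (∧-assoc (U x) (P x) (Q x))
  (trans (cong (U x ∧_) (∧-comm (P x) (Q x))) (sym (∧-assoc (U x) (Q x) (P x))))

remove-∩ : (U : Sub n) (v : Fin n) (P : Sub n) → (U ∩ P) - v ≐ (U - v) ∩ P
remove-∩ U v P = ∩-swap U P (λ x → not ⌊ x ≟F v ⌋)

#-split : (U W : Sub n) → # U ≡ # (U ∩ W) + # (U ∩ (not ∘ W))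
#-split U W = ∑∈-split U W (λ _ → 1)

⊆⇒∩≐ : {W U : Sub n} → W ⊆ U → U ∩ W ≐ W
⊆⇒∩≐ {W = W} {U} h x with W x in eq
... | true rewrite h x eq = refl
... | false = ∧-zeroʳ (U x)

-- Ordered cliques and the Moon–Moser inequality

Π : ℕ → (ℕ → ℕ) → ℕ
Π zero f = 1
Π (suc m) f = Π m f * f m

Π-mono : ∀ m {f g} → (∀ i → i < m → f i ≤ g i) → Π m f ≤ Π m g
Π-mono zero h = ≤-refl
Π-mono (suc m) h = *-mono-≤ (Π-mono m λ i i<m → h i (m<n⇒m<1+n i<m)) (h m ≤-refl)

Π-cons : ∀ m f → Π (suc m) f ≡ f 0 * Π m (f ∘ suc)
Π-cons zero f = trans (*-identityˡ (f 0)) (sym (*-identityʳ (f 0)))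
Π-cons (suc m) f = trans (cong (_* f (suc m)) (Π-cons m f)) (*-assoc (f 0) _ _)

Π-positive : ∀ m {f} → (∀ i → i < m → 0 < f i) → 0 < Π m f
Π-positive zero h = s≤s z≤n
Π-positive (suc m) h = *-mono-≤ (Π-positive m λ i i<m → h i (m<n⇒m<1+n i<m)) (h m ≤-refl)

2xy≤x²+y² : ∀ x y → 2 * (x * y) ≤ x * x + y * y
2xy≤x²+y² x y with ≤-total x y
... | inj₁ le with d , refl ← m≤n⇒∃[o]m+o≡n le =
  ≤-trans (m≤m+n _ (d * d)) (≤-reflexive (eq x d))
  where
  eq : ∀ x d → 2 * (x * (x + d)) + d * d ≡ x * x + (x + d) * (x + d)
  eq = solve-∀
... | inj₂ le with d , refl ← m≤n⇒∃[o]m+o≡n le =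
  ≤-trans (m≤m+n _ (d * d)) (≤-reflexive (eq y d))
  where
  eq : ∀ y d → 2 * ((y + d) * y) + d * d ≡ (y + d) * (y + d) + y * y
  eq = solve-∀

module _ {n} (G : Graph n) where

  N : Fin n → Sub n
  N = adj G

  c : ℕ → Sub n → ℕ
  c zero U = 1
  c (suc t) U = ∑∈ U (λ v → c t (U ∩ N v))

  ∩-mono : ∀ {U W : Sub n} v → U ⊆ W → U ∩ N v ⊆ W ∩ N v
  ∩-mono {U} v h x p = ∧-true (h x (∧-trueˡ p)) (∧-trueʳ {U x} p)

  c-mono : ∀ t {U W} → U ⊆ W → c t U ≤ c t W
  c-mono zero h = ≤-refl
  c-mono (suc t) {U} h = ∑∈-mono {U = U} h (λ v _ → c-mono t (∩-mono v h))

  c-cong : ∀ t {U W} → U ≐ W → c t U ≡ c t W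
  c-cong t h = ≤-antisym (c-mono t λ v p → trans (sym (h v)) p) (c-mono t λ v p → trans (h v) p)

  -- `v` can stand at any of the `suc t` positions of an ordered clique. Either it comes first, or
  -- it lies in the neighbourhood of the first vertex, where the induction hypothesis extracts it;
  -- `rest` is the second case.
  c-remove : ∀ t U v → v ∈ U → c (suc t) U ≡ c (suc t) (U - v) + suc t * c t (U ∩ N v)
  c-remove t U v v∈ = begin
    c (suc t) U                                    ≡⟨ ∑∈-remove U v F v∈ ⟩
    ∑∈ (U - v) F + F v                             ≡⟨ cong (_+ F v) (rest t) ⟩
    c (suc t) (U - v) + t * c t (U ∩ N v) + F v    ≡⟨ lin (c (suc t) (U - v)) t (F v) ⟩
    c (suc t) (U - v) + suc t * c t (U ∩ N v)      ∎
    where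
    open ≡-Reasoning
    F : Fin n → ℕ
    F u = c t (U ∩ N u)
    lin : ∀ a t b → a + t * b + b ≡ a + suc t * b
    lin = solve-∀
    rest : ∀ t → ∑∈ (U - v) (λ u → c t (U ∩ N u)) ≡ c (suc t) (U - v) + t * c t (U ∩ N v)
    rest zero = sym (+-identityʳ _)
    rest (suc t) = begin
      ∑∈ (U - v) (λ u → c (suc t) (U ∩ N u))
        ≡⟨ ∑∈-cong {U = U - v} (λ _ → refl) (λ u u∈ → step u u∈ (adj G u v) refl) ⟩
      ∑∈ (U - v) (λ u → c (suc t) ((U - v) ∩ N u) + suc t * (⟦ adj G v u ⟧ * h u))
        ≡⟨ ∑∈-+ (U - v) (λ u → c (suc t) ((U - v) ∩ N u)) (λ u → suc t * (⟦ adj G v u ⟧ * h u)) ⟩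
      c (suc (suc t)) (U - v) + ∑∈ (U - v) (λ u → suc t * (⟦ adj G v u ⟧ * h u))
        ≡⟨ cong (c (suc (suc t)) (U - v) +_) (begin
          ∑∈ (U - v) (λ u → suc t * (⟦ adj G v u ⟧ * h u))
            ≡⟨ ∑∈-*ˡ (U - v) (suc t) (λ u → ⟦ adj G v u ⟧ * h u) ⟩
          suc t * ∑∈ (U - v) (λ u → ⟦ adj G v u ⟧ * h u)
            ≡⟨ cong (suc t *_) (∑∈-∩ (U - v) (N v) h) ⟨
          suc t * ∑∈ ((U - v) ∩ N v) h
            ≡⟨ cong (suc t *_) (∑∈-cong {U = (U - v) ∩ N v} avoid (λ _ _ → refl)) ⟩
          suc t * c (suc t) (U ∩ N v) ∎) ⟩
      c (suc (suc t)) (U - v) + suc t * c (suc t) (U ∩ N v) ∎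
      where
      h : Fin n → ℕ
      h u = c t (U ∩ N v ∩ N u)
      avoid : (U - v) ∩ N v ≐ U ∩ N v
      avoid x = trans (sym (remove-∩ U v (N v) x))
        (sym (∉-remove (U ∩ N v) v (trans (cong (U v ∧_) (adj-irrefl G v)) (∧-zeroʳ (U v))) x))
      step : ∀ u → u ∈ U - v → ∀ b → adj G u v ≡ b →
        c (suc t) (U ∩ N u) ≡ c (suc t) ((U - v) ∩ N u) + suc t * (⟦ adj G v u ⟧ * h u)
      step u u∈ true e = begin
        c (suc t) (U ∩ N u)
          ≡⟨ c-remove t (U ∩ N u) v (∧-true v∈ e) ⟩
        c (suc t) ((U ∩ N u) - v) + suc t * c t (U ∩ N u ∩ N v)
          ≡⟨ cong₂ (λ a b → a + suc t * b) (c-cong (suc t) (remove-∩ U v (N u)))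
              (trans (c-cong t (∩-swap U (N u) (N v))) (sym (*-identityˡ (h u)))) ⟩
        c (suc t) ((U - v) ∩ N u) + suc t * (1 * h u)
          ≡⟨ cong (λ b → c (suc t) ((U - v) ∩ N u) + suc t * (⟦ b ⟧ * h u)) (trans (sym e) (adj-sym G u v)) ⟩
        c (suc t) ((U - v) ∩ N u) + suc t * (⟦ adj G v u ⟧ * h u) ∎
      step u u∈ false e = begin
        c (suc t) (U ∩ N u)
          ≡⟨ c-cong (suc t) (λ x → trans (∉-remove (U ∩ N u) v (trans (cong (U v ∧_) e) (∧-zeroʳ (U v))) x) (remove-∩ U v (N u) x)) ⟩
        c (suc t) ((U - v) ∩ N u)
          ≡⟨ +-identityʳ _ ⟨
        c (suc t) ((U - v) ∩ N u) + 0
          ≡⟨ cong (c (suc t) ((U - v) ∩ N u) +_) (*-zeroʳ (suc t)) ⟨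
        c (suc t) ((U - v) ∩ N u) + suc t * (0 * h u)
          ≡⟨ cong (λ b → c (suc t) ((U - v) ∩ N u) + suc t * (⟦ b ⟧ * h u)) (trans (sym e) (adj-sym G u v)) ⟩
        c (suc t) ((U - v) ∩ N u) + suc t * (⟦ adj G v u ⟧ * h u) ∎

  -- Σ d(T)² over the ordered j-cliques T of U, d(T) being the number of common neighbours.
  P : ℕ → Sub n → ℕ
  P j U = ∑∈ U (λ u → ∑∈ U (λ v → c j (U ∩ N u ∩ N v)))

  -- Adjacency is symmetric, so the first clique vertex `w` can be moved outside the sums over `u`
  -- and `v`. This opens sums of squares to induction on the clique.
  P-suc : ∀ j U → P (suc j) U ≡ ∑∈ U (λ w → P j (U ∩ N w))
  P-suc j U = begin
    ∑∈ U (λ u → ∑∈ U (λ v → ∑∈ (U ∩ N u ∩ N v) (λ w → c j (U ∩ N u ∩ N v ∩ N w))))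
      ≡⟨ ∑∈-cong {U = U} (λ _ → refl) (λ u _ → ∑∈-swap U (U ∩ N u) (λ v → U ∩ N u ∩ N v) (λ w → U ∩ N w) (λ v w → c j (U ∩ N u ∩ N v ∩ N w)) (inner u)) ⟩
    ∑∈ U (λ u → ∑∈ (U ∩ N u) (λ w → ∑∈ (U ∩ N w) (λ v → c j (U ∩ N u ∩ N v ∩ N w))))
      ≡⟨ ∑∈-swap U U (λ u → U ∩ N u) (λ w → U ∩ N w) (λ u w → ∑∈ (U ∩ N w) (λ v → c j (U ∩ N u ∩ N v ∩ N w))) outer ⟩
    ∑∈ U (λ w → ∑∈ (U ∩ N w) (λ u → ∑∈ (U ∩ N w) (λ v → c j (U ∩ N u ∩ N v ∩ N w))))
      ≡⟨ ∑∈-cong {U = U} (λ _ → refl) (λ w _ → ∑∈-cong {U = U ∩ N w} (λ _ → refl) (λ u _ →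
           ∑∈-cong {U = U ∩ N w} (λ _ → refl) (λ v _ → c-cong j (perm u v w)))) ⟩
    ∑∈ U (λ w → P j (U ∩ N w)) ∎
    where
    open ≡-Reasoning
    b₁ : ∀ a x y z → a ∧ ((x ∧ y) ∧ z) ≡ (x ∧ y) ∧ (a ∧ z)
    b₁ true x y z = refl
    b₁ false x y z = sym (∧-zeroʳ (x ∧ y))
    inner : ∀ u v w → U v ∧ ((U w ∧ adj G u w) ∧ adj G v w) ≡ (U w ∧ adj G u w) ∧ (U v ∧ adj G w v)
    inner u v w rewrite adj-sym G w v = b₁ (U v) (U w) (adj G u w) (adj G v w)
    b₂ : ∀ a x y → a ∧ (x ∧ y) ≡ x ∧ (a ∧ y)
    b₂ true x y = refl
    b₂ false x y = sym (∧-zeroʳ x)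
    outer : ∀ u w → U u ∧ (U w ∧ adj G u w) ≡ U w ∧ (U u ∧ adj G w u)
    outer u w rewrite adj-sym G w u = b₂ (U u) (U w) (adj G u w)
    perm : ∀ u v w → U ∩ N u ∩ N v ∩ N w ≐ U ∩ N w ∩ N u ∩ N v
    perm u v w x = trans (∩-swap (U ∩ N u) (N v) (N w) x)
      (cong (_∧ N v x) (∩-swap U (N u) (N w) x))

  -- The vertices `u` inside `W` contribute exactly `c (suc i) W`; each vertex outside contributes
  -- at most `c i W`.
  ∑c∩≤ : ∀ i {U W} → W ⊆ U →
    ∑∈ U (λ u → c i (W ∩ N u)) + # W * c i W ≤ # U * c i W + c (suc i) W
  ∑c∩≤ i {U} {W} h = begin
    ∑∈ U F + # W * c i W
      ≡⟨ cong (_+ # W * c i W) (trans (∑∈-split U W F) (cong (_+ R) (∑∈-cong {U = U ∩ W} (⊆⇒∩≐ h) (λ _ _ → refl)))) ⟩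
    c (suc i) W + R + # W * c i W
      ≤⟨ +-monoˡ-≤ (# W * c i W) (+-monoʳ-≤ (c (suc i) W)
           (∑∈≤#* (U ∩ (not ∘ W)) F (c i W) (λ v _ → c-mono i λ x → ∧-trueˡ))) ⟩
    c (suc i) W + # (U ∩ (not ∘ W)) * c i W + # W * c i W
      ≡⟨ lin (c (suc i) W) (# (U ∩ (not ∘ W))) (# W) (c i W) ⟩
    (# W + # (U ∩ (not ∘ W))) * c i W + c (suc i) W
      ≡⟨ cong (λ m → m * c i W + c (suc i) W) (trans (#-split U W) (cong (_+ # (U ∩ (not ∘ W))) (#-cong (⊆⇒∩≐ h)))) ⟨
    # U * c i W + c (suc i) W ∎
    where
    open ≤-Reasoning
    F : Fin n → ℕ
    F u = c i (W ∩ N u)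
    R = ∑∈ (U ∩ (not ∘ W)) F
    lin : ∀ a x y b → a + x * b + y * b ≡ (y + x) * b + a
    lin = solve-∀

  -- Inclusion–exclusion |A| + |B| ≤ |U| + |A ∩ B| for the common neighbourhoods of
  -- one vertex and of the remaining vertices of a clique, summed over all cliques.
  sP≤ : ∀ j U → suc j * P j U ≤ # U * c (suc j) U + j * c (suc (suc j)) U
  sP≤ zero U = ≤-reflexive (begin-equality
    P 0 U + 0            ≡⟨ +-identityʳ _ ⟩
    P 0 U                ≡⟨ ∑∈-const U (# U) ⟩
    # U * # U            ≡⟨ +-identityʳ _ ⟨
    # U * # U + 0        ∎)
    where open ≤-Reasoning
  sP≤ (suc j) U = begin
    suc (suc j) * P (suc j) U
      ≡⟨⟩
    P (suc j) U + suc j * P (suc j) U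
      ≡⟨ cong (λ p → P (suc j) U + suc j * p) (P-suc j U) ⟩
    P (suc j) U + suc j * ∑∈ U (λ w → P j (U ∩ N w))
      ≡⟨ cong (P (suc j) U +_) (∑∈-*ˡ U (suc j) (λ w → P j (U ∩ N w))) ⟨
    P (suc j) U + ∑∈ U (λ w → suc j * P j (U ∩ N w))
      ≤⟨ +-monoʳ-≤ (P (suc j) U) (∑∈-mono {U = U} (λ _ p → p) (λ w _ → sP≤ j (U ∩ N w))) ⟩
    P (suc j) U + ∑∈ U (λ w → # (U ∩ N w) * c (suc j) (U ∩ N w) + j * c (suc (suc j)) (U ∩ N w))
      ≡⟨ cong (P (suc j) U +_) (trans (∑∈-+ U (λ w → # (U ∩ N w) * c (suc j) (U ∩ N w)) (λ w → j * c (suc (suc j)) (U ∩ N w)))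
           (cong (A +_) (∑∈-*ˡ U j (λ w → c (suc (suc j)) (U ∩ N w))))) ⟩
    P (suc j) U + (A + j * c (suc (suc (suc j))) U)
      ≡⟨ +-assoc (P (suc j) U) A _ ⟨
    P (suc j) U + A + j * c (suc (suc (suc j))) U
      ≤⟨ +-monoˡ-≤ (j * c (suc (suc (suc j))) U) main ⟩
    # U * c (suc (suc j)) U + c (suc (suc (suc j))) U + j * c (suc (suc (suc j))) U
      ≡⟨ +-assoc (# U * c (suc (suc j)) U) _ _ ⟩
    # U * c (suc (suc j)) U + suc j * c (suc (suc (suc j))) U ∎
    where
    open ≤-Reasoning
    A = ∑∈ U (λ w → # (U ∩ N w) * c (suc j) (U ∩ N w))
    main : P (suc j) U + A ≤ # U * c (suc (suc j)) U + c (suc (suc (suc j))) U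
    main = begin
      P (suc j) U + A
        ≡⟨ ∑∈-+ U (λ w → ∑∈ U (λ v → c (suc j) (U ∩ N w ∩ N v))) (λ w → # (U ∩ N w) * c (suc j) (U ∩ N w)) ⟨
      ∑∈ U (λ w → ∑∈ U (λ v → c (suc j) (U ∩ N w ∩ N v)) + # (U ∩ N w) * c (suc j) (U ∩ N w))
        ≤⟨ ∑∈-mono {U = U} (λ _ p → p) (λ w _ → ∑c∩≤ (suc j) {U} {U ∩ N w} (λ x → ∧-trueˡ)) ⟩
      ∑∈ U (λ w → # U * c (suc j) (U ∩ N w) + c (suc (suc j)) (U ∩ N w))
        ≡⟨ ∑∈-+ U (λ w → # U * c (suc j) (U ∩ N w)) (λ w → c (suc (suc j)) (U ∩ N w)) ⟩
      ∑∈ U (λ w → # U * c (suc j) (U ∩ N w)) + c (suc (suc (suc j))) U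
        ≡⟨ cong (_+ c (suc (suc (suc j))) U) (∑∈-*ˡ U (# U) (λ w → c (suc j) (U ∩ N w))) ⟩
      # U * c (suc (suc j)) U + c (suc (suc (suc j))) U ∎

  -- Σ (q d(T) − L)² ≥ 0.
  2qLc≤ : ∀ q L j U → 2 * (q * L) * c (suc j) U ≤ q * q * P j U + L * L * c j U
  2qLc≤ q L zero U = begin
    2 * (q * L) * # U                  ≡⟨ e₁ q L (# U) ⟩
    2 * (q * # U * L)                  ≤⟨ 2xy≤x²+y² (q * # U) L ⟩
    q * # U * (q * # U) + L * L        ≡⟨ e₂ q L (# U) ⟩
    q * q * (# U * # U) + L * L * 1    ≡⟨ cong (λ p → q * q * p + L * L * 1) (∑∈-const U (# U)) ⟨
    q * q * P 0 U + L * L * 1          ∎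
    where
    open ≤-Reasoning
    e₁ : ∀ q L h → 2 * (q * L) * h ≡ 2 * (q * h * L)
    e₁ = solve-∀
    e₂ : ∀ q L h → q * h * (q * h) + L * L ≡ q * q * (h * h) + L * L * 1
    e₂ = solve-∀
  2qLc≤ q L (suc j) U = begin
    2 * (q * L) * c (suc (suc j)) U
      ≡⟨ ∑∈-*ˡ U (2 * (q * L)) (λ w → c (suc j) (U ∩ N w)) ⟨
    ∑∈ U (λ w → 2 * (q * L) * c (suc j) (U ∩ N w))
      ≤⟨ ∑∈-mono {U = U} (λ _ p → p) (λ w _ → 2qLc≤ q L j (U ∩ N w)) ⟩
    ∑∈ U (λ w → q * q * P j (U ∩ N w) + L * L * c j (U ∩ N w))
      ≡⟨ ∑∈-+ U (λ w → q * q * P j (U ∩ N w)) (λ w → L * L * c j (U ∩ N w)) ⟩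
    ∑∈ U (λ w → q * q * P j (U ∩ N w)) + ∑∈ U (λ w → L * L * c j (U ∩ N w))
      ≡⟨ cong₂ _+_ (trans (∑∈-*ˡ U (q * q) (λ w → P j (U ∩ N w))) (cong (q * q *_) (sym (P-suc j U))))
           (∑∈-*ˡ U (L * L) (λ w → c j (U ∩ N w))) ⟩
    q * q * P (suc j) U + L * L * c (suc j) U ∎
    where open ≤-Reasoning

  -- `L` and `L′` bound from below, in units of 1/`q`, the average number of extensions of a clique.
  -- Cauchy-Schwarz, linearised at `L` so that no quotient occurs, bounds the sum of squares from
  -- below by `L` times the sum; `sP≤` bounds it from above by the next clique count.
  moon-moser : ∀ {q L L′ H} j U .{{_ : NonZero q}} → q * # U ≤ H →
    suc (suc j) * L ≡ H + suc j * L′ →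
    L * c (suc j) U ≤ q * c (suc (suc j)) U →
    L′ * c (suc (suc j)) U ≤ q * c (suc (suc (suc j))) U
  moon-moser {q} {L} {L′} {H} j U q#≤H rec hyp = *-cancelˡ-≤ (suc j) (+-cancelˡ-≤ (H * c₁) _ _ (begin
    H * c₁ + suc j * (L′ * c₁)    ≡⟨ e₃ H (suc j) L′ c₁ ⟩
    (H + suc j * L′) * c₁         ≡⟨ cong (_* c₁) rec ⟨
    suc (suc j) * L * c₁          ≡⟨ *-assoc (suc (suc j)) L c₁ ⟩
    suc (suc j) * (L * c₁)        ≤⟨ *-monoʳ-≤ (suc (suc j)) Lc₁≤qP ⟩
    suc (suc j) * (q * p)         ≡⟨ x*yz≡y*xz (suc (suc j)) q p ⟩
    q * (suc (suc j) * p)         ≤⟨ *-monoʳ-≤ q (sP≤ (suc j) U) ⟩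
    q * (# U * c₁ + suc j * c₂)   ≡⟨ e₄ q (# U) c₁ (suc j) c₂ ⟩
    q * # U * c₁ + suc j * (q * c₂) ≤⟨ +-monoˡ-≤ _ (*-monoˡ-≤ c₁ q#≤H) ⟩
    H * c₁ + suc j * (q * c₂)     ∎))
    where
    open ≤-Reasoning
    c₀ = c (suc j) U
    c₁ = c (suc (suc j)) U
    c₂ = c (suc (suc (suc j))) U
    p = P (suc j) U
    e₃ : ∀ H j L c → H * c + j * (L * c) ≡ (H + j * L) * c
    e₃ = solve-∀
    e₄ : ∀ q h c j d → q * (h * c + j * d) ≡ q * h * c + j * (q * d)
    e₄ = solve-∀
    e₅ : ∀ q L c → q * (L * c) + L * (q * c) ≡ 2 * (q * L) * c
    e₅ = solve-∀
    e₆ : ∀ q p → q * q * p ≡ q * (q * p)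
    e₆ = solve-∀
    Lc₁≤qP : L * c₁ ≤ q * p
    Lc₁≤qP = *-cancelˡ-≤ q (+-cancelʳ-≤ (L * (q * c₁)) _ _ (begin
      q * (L * c₁) + L * (q * c₁)   ≡⟨ e₅ q L c₁ ⟩
      2 * (q * L) * c₁              ≤⟨ 2qLc≤ q L (suc j) U ⟩
      q * q * p + L * L * c₀        ≡⟨ cong₂ _+_ (e₆ q p) (*-assoc L L c₀) ⟩
      q * (q * p) + L * (L * c₀)    ≤⟨ +-monoʳ-≤ (q * (q * p)) (*-monoʳ-≤ L hyp) ⟩
      q * (q * p) + L * (q * c₁)    ∎))

  -- With f t = q|U| − tE this is an approximate Zykov theorem: few (k+1)-cliques force few
  -- σ-cliques.
  module _ (q : ℕ) .{{_ : NonZero q}} (k : ℕ) (f : ℕ → ℕ) (U : Sub n)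
    (rec : ∀ j → j < k → suc j * f j ≡ f 0 + j * f (suc j)) (q#≤ : q * # U ≤ f 0) where

    -- The first half is a ratio of consecutive clique counts, which `moon-moser` passes on to the
    -- next level; the second half is the product of such ratios. Together they propagate up to any
    -- level allowed by `k`.
    Dense : ℕ → Set
    Dense j = f (suc j) * c (suc j) U ≤ q * c (suc (suc j)) U ×
              Π (suc (suc j)) f ≤ q ^ suc (suc j) * c (suc (suc j)) U

    private
      shuffle : ∀ q qm c → qm * (q * c) ≡ q * qm * c
      shuffle = solve-∀

    Dense-suc : ∀ j → suc j < k → Dense j → Dense (suc j)
    Dense-suc j j<k (A , B) = A′ , (begin
      Π m f * f m                  ≤⟨ *-monoˡ-≤ (f m) B ⟩
      q ^ m * c m U * f m          ≡⟨ trans (*-assoc (q ^ m) _ _) (cong (q ^ m *_) (*-comm (c m U) (f m))) ⟩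
      q ^ m * (f m * c m U)        ≤⟨ *-monoʳ-≤ (q ^ m) A′ ⟩
      q ^ m * (q * c (suc m) U)    ≡⟨ shuffle q (q ^ m) _ ⟩
      q ^ suc m * c (suc m) U      ∎)
      where
      open ≤-Reasoning
      m = suc (suc j)
      A′ = moon-moser {L = f (suc j)} j U q#≤ (rec (suc j) j<k) A

    -- If the product bound holds at one level and fails at the next, the ratio between the two
    -- levels must be large, which is the missing half of `Dense`. From then on density persists.
    sparse-or-dense : ∀ j → j < k →
      q ^ suc (suc j) * c (suc (suc j)) U ≤ Π (suc (suc j)) f ⊎ Dense j
    sparse-or-dense j j<k = go j j<k
      where
      open ≤-Reasoning
      sparse-suc : ∀ j → q ^ suc j * c (suc j) U ≤ Π (suc j) f →
        q ^ suc (suc j) * c (suc (suc j)) U ≤ Π (suc (suc j)) f ⊎ Dense j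
      sparse-suc j B with ≤-total (f (suc j) * c (suc j) U) (q * c (suc (suc j)) U)
                       | ≤-total (q ^ suc (suc j) * c (suc (suc j)) U) (Π (suc (suc j)) f)
      ... | _ | inj₁ s = inj₁ s
      ... | inj₁ A | inj₂ d = inj₂ (A , d)
      ... | inj₂ A | inj₂ _ = inj₁ (begin
        q ^ suc m * c (suc m) U      ≡⟨ shuffle q (q ^ m) _ ⟨
        q ^ m * (q * c (suc m) U)    ≤⟨ *-monoʳ-≤ (q ^ m) A ⟩
        q ^ m * (f m * c m U)        ≡⟨ trans (cong (q ^ m *_) (*-comm (f m) (c m U))) (sym (*-assoc (q ^ m) _ _)) ⟩
        q ^ m * c m U * f m          ≤⟨ *-monoˡ-≤ (f m) B ⟩
        Π m f * f m                  ∎)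
        where m = suc j
      go : ∀ j → j < k → q ^ suc (suc j) * c (suc (suc j)) U ≤ Π (suc (suc j)) f ⊎ Dense j
      go zero _ = sparse-suc 0 (begin
        q * 1 * # U  ≡⟨ cong (_* # U) (*-identityʳ q) ⟩
        q * # U      ≤⟨ q#≤ ⟩
        f 0          ≡⟨ *-identityˡ (f 0) ⟨
        1 * f 0      ∎)
      go (suc j) j<k with go j (<-trans (n<1+n j) j<k)
      ... | inj₁ s = sparse-suc (suc j) s
      ... | inj₂ d = inj₂ (Dense-suc j j<k d)

    Dense-mono : ∀ d j → suc j + d ≤ k → Dense j → Dense (j + d)
    Dense-mono zero j _ D = subst Dense (sym (+-identityʳ j)) D
    Dense-mono (suc d) j le D = subst Dense (sym (+-suc j d))
      (Dense-mono d (suc j) (subst (_≤ k) (cong suc (+-suc j d)) le)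
        (Dense-suc j (≤-trans (s≤s (≤-trans (m≤m+n (suc j) d) (≤-reflexive (sym (+-suc j d))))) le) D))

    approximate-zykov : ∀ σ → σ ≤ k →
      q ^ suc σ * c (suc σ) U ≤ Π (suc σ) f ⊎ Π (suc k) f ≤ q ^ suc k * c (suc k) U
    approximate-zykov zero _ = inj₁ (subst₂ _≤_ (cong (_* # U) (sym (*-identityʳ q))) (sym (*-identityˡ (f 0))) q#≤)
    approximate-zykov (suc j) j<k with sparse-or-dense j j<k
    ... | inj₁ s = inj₁ s
    ... | inj₂ D with d , refl ← m≤n⇒∃[o]m+o≡n j<k = inj₂ (proj₂ (Dense-mono d j ≤-refl D))

  -- Choosing a vertex costs at most `α` candidates, since it misses at most `α` vertices of `U`,
  -- itself included. After `i` choices at least `g i` candidates remain.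
  greedy : ∀ α {U : Sub n} → (∀ v → v ∈ U → # (U ∩ (not ∘ N v)) ≤ α) →
    ∀ j {W} g → W ⊆ U → (∀ i → i < j → g i + i * α ≤ # W) → Π j g ≤ c j W
  greedy α nd zero g W⊆U h = ≤-refl
  greedy α {U} nd (suc j) {W} g W⊆U h = begin
    Π (suc j) g              ≡⟨ Π-cons j g ⟩
    g 0 * Π j (g ∘ suc)      ≤⟨ *-monoˡ-≤ _ (subst (_≤ # W) (+-identityʳ (g 0)) (h 0 (s≤s z≤n))) ⟩
    # W * Π j (g ∘ suc)      ≤⟨ #*≤∑∈ W _ _ (λ v v∈ → greedy α nd j (g ∘ suc) (λ x p → W⊆U x (∧-trueˡ p)) (λ i i<j →
      +-cancelʳ-≤ α _ _ (begin
        g (suc i) + i * α + α                   ≡⟨ lin (g (suc i)) i α ⟩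
        g (suc i) + suc i * α                   ≤⟨ h (suc i) (s≤s i<j) ⟩
        # W                                     ≡⟨ #-split W (N v) ⟩
        # (W ∩ N v) + # (W ∩ (not ∘ N v))       ≤⟨ +-monoʳ-≤ (# (W ∩ N v)) (≤-trans
          (#-mono {U = W ∩ (not ∘ N v)} λ x p → ∧-true (W⊆U x (∧-trueˡ p)) (∧-trueʳ {W x} p)) (nd v (W⊆U v v∈))) ⟩
        # (W ∩ N v) + α                         ∎))) ⟩
    c (suc j) W              ∎
    where
    open ≤-Reasoning
    lin : ∀ a i α → a + i * α + α ≡ a + suc i * α
    lin = solve-∀

-- Ordered cliques versus the clique counts of Defs

count : List (Subset n) → (Subset n → Bool) → ℕ
count xs p = length (filter (λ S → p S ≟ true) xs)

count-++ : ∀ xs ys (p : Subset n → Bool) → count (xs ++ ys) p ≡ count xs p + count ys p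
count-++ xs ys p = trans (cong length (filter-++ (λ S → p S ≟ true) xs ys)) (length-++ (filter (λ S → p S ≟ true) xs))

count-∷ : ∀ x xs (p : Subset n → Bool) → count (x ∷ xs) p ≡ ⟦ p x ⟧ + count xs p
count-∷ x xs p with p x
... | true = refl
... | false = refl

count-map : ∀ b xs (p : Subset (suc n) → Bool) → count (map (b ∷_) xs) p ≡ count xs (p ∘ (b ∷_))
count-map b [] p = refl
count-map b (x ∷ xs) p = trans (count-∷ (b ∷ x) (map (b ∷_) xs) p)
  (trans (cong (⟦ p (b ∷ x) ⟧ +_) (count-map b xs p)) (sym (count-∷ x xs (p ∘ (b ∷_)))))

count-cong : ∀ xs {p q : Subset n → Bool} → (∀ S → p S ≡ q S) → count xs p ≡ count xs q
count-cong [] h = refl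
count-cong (x ∷ xs) {p} {q} h = trans (count-∷ x xs p)
  (trans (cong₂ _+_ (cong ⟦_⟧ (h x)) (count-cong xs h)) (sym (count-∷ x xs q)))

count-split : ∀ xs (p q : Subset n → Bool) →
  count xs p ≡ count xs (λ S → p S ∧ q S) + count xs (λ S → p S ∧ not (q S))
count-split [] p q = refl
count-split (x ∷ xs) p q = begin
  count (x ∷ xs) p               ≡⟨ count-∷ x xs p ⟩
  ⟦ p x ⟧ + count xs p           ≡⟨ cong₂ _+_ (pt (p x) (q x)) (count-split xs p q) ⟩
  ⟦ p x ∧ q x ⟧ + ⟦ p x ∧ not (q x) ⟧ + (count xs pq + count xs pq̄)
    ≡⟨ lin ⟦ p x ∧ q x ⟧ ⟦ p x ∧ not (q x) ⟧ (count xs pq) (count xs pq̄) ⟩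
  (⟦ p x ∧ q x ⟧ + count xs pq) + (⟦ p x ∧ not (q x) ⟧ + count xs pq̄)
    ≡⟨ cong₂ _+_ (count-∷ x xs pq) (count-∷ x xs pq̄) ⟨
  count (x ∷ xs) pq + count (x ∷ xs) pq̄ ∎
  where
  open ≡-Reasoning
  pq pq̄ : Subset _ → Bool
  pq S = p S ∧ q S
  pq̄ S = p S ∧ not (q S)
  pt : ∀ a b → ⟦ a ⟧ ≡ ⟦ a ∧ b ⟧ + ⟦ a ∧ not b ⟧
  pt true true = refl
  pt true false = refl
  pt false _ = refl
  lin : ∀ a b x y → a + b + (x + y) ≡ (a + x) + (b + y)
  lin = solve-∀

count-filter : ∀ xs (p q : Subset n → Bool) →
  count (filter (λ S → p S ≟ true) xs) q ≡ count xs (λ S → p S ∧ q S)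
count-filter [] p q = refl
count-filter {n} (x ∷ xs) p q = trans head (trans (cong (⟦ p x ∧ q x ⟧ +_) (count-filter xs p q))
  (sym (count-∷ x xs (λ S → p S ∧ q S))))
  where
  head : count (filter (λ S → p S ≟ true) (x ∷ xs)) q ≡ ⟦ p x ∧ q x ⟧ + count (filter (λ S → p S ≟ true) xs) q
  head with p x
  ... | false = refl
  ... | true = count-∷ x (filter (λ S → p S ≟ true) xs) q

count-none : ∀ xs {p : Subset n → Bool} → (∀ S → p S ≡ false) → count xs p ≡ 0
count-none [] h = refl
count-none (x ∷ xs) {p} h = trans (count-∷ x xs p) (cong₂ _+_ (cong ⟦_⟧ (h x)) (count-none xs h))

count-suc : ∀ (p : Subset (suc n) → Bool) →
  count (allSubsets (suc n)) p ≡ count (allSubsets n) (p ∘ (true ∷_)) + count (allSubsets n) (p ∘ (false ∷_))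
count-suc {n} p = trans (count-++ (map (true ∷_) (allSubsets n)) _ p)
  (cong₂ _+_ (count-map true (allSubsets n) p) (count-map false (allSubsets n) p))

-- The ambient set `U` is what allows an induction on the vertices: putting a vertex into the clique
-- replaces `U` by a neighbourhood.
record CliqueIn (G : Graph n) (t : ℕ) (U : Sub n) (S : Subset n) : Set where
  constructor cliqueIn
  field
    size : ∣ S ∣ ≡ t
    clique : ∀ u v → mem S u ≡ true → mem S v ≡ true → u ≢ v → adj G u v ≡ true
    within : ∀ u → mem S u ≡ true → u ∈ U

allV-elim : {P : Fin n → Bool} → allV P ≡ true → ∀ u → P u ≡ true
allV-elim {n} {P} h u = go (allFin n) h (∈-allFin u)
  where
  go : ∀ xs → foldr _∧_ true (map P xs) ≡ true → u ∈ᴸ xs → P u ≡ true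
  go (x ∷ xs) e (here refl) = ∧-trueˡ e
  go (x ∷ xs) e (there m) = go xs (∧-trueʳ {P x} e) m

allV-false : {P : Fin n → Bool} → allV P ≡ false → ∃ λ u → P u ≡ false
allV-false {n} {P} = go (allFin n)
  where
  go : ∀ xs → foldr _∧_ true (map P xs) ≡ false → ∃ λ u → P u ≡ false
  go (x ∷ xs) e with P x in eq
  ... | true = go xs e
  ... | false = x , eq

isClique-elim : (G : Graph n) (S : Subset n) → isClique G S ≡ true →
  ∀ u v → mem S u ≡ true → mem S v ≡ true → u ≢ v → adj G u v ≡ true
isClique-elim G S h u v mu mv ne with allV-elim (allV-elim h u) v
... | e rewrite mu | mv with toℕ u ≟ℕ toℕ v
... | yes p = contradiction (toℕ-injective p) ne
... | no _ = e

isClique-intro : (G : Graph n) (S : Subset n) →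
  (∀ u v → mem S u ≡ true → mem S v ≡ true → u ≢ v → adj G u v ≡ true) → isClique G S ≡ true
isClique-intro G S h with isClique G S in eq
... | true = refl
... | false with u , eᵤ ← allV-false eq with v , e ← allV-false eᵤ
  with mem S u in mu | mem S v in mv | toℕ u ≟ℕ toℕ v | e
... | true | true | no ne | e = trans (sym e) (h u v mu mv (ne ∘ cong toℕ))

isTClique : ℕ → Graph n → Subset n → Bool
isTClique t G S = ⌊ ∣ S ∣ ≟ℕ t ⌋ ∧ isClique G S

isTClique-elim : ∀ t (G : Graph n) S → isTClique t G S ≡ true → CliqueIn G t full S
isTClique-elim t G S h with ∣ S ∣ ≟ℕ t
... | yes p = cliqueIn p (isClique-elim G S h) (λ _ _ → refl)

isTClique-intro : ∀ t (G : Graph n) U S → CliqueIn G t U S → isTClique t G S ≡ true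
isTClique-intro t G U S C with ∣ S ∣ ≟ℕ t
... | yes p = isClique-intro G S (CliqueIn.clique C)
... | no ne = contradiction (CliqueIn.size C) ne

tailGraph : Graph (suc n) → Graph n
tailGraph G = record
  { adj = λ u v → adj G (suc u) (suc v)
  ; adj-sym = λ u v → adj-sym G (suc u) (suc v)
  ; adj-irrefl = λ u → adj-irrefl G (suc u) }

c-tail : ∀ (G : Graph (suc n)) t W → W zero ≡ false → c G t W ≡ c (tailGraph G) t (W ∘ suc)
c-tail G zero W h = refl
c-tail G (suc t) W h rewrite h =
  sum-cong-≗ λ v → cong (⟦ W (suc v) ⟧ *_) (c-tail G t (W ∩ N G (suc v)) (cong (_∧ N G (suc v) zero) h))

CliqueIn-tail : {G : Graph (suc n)} {t : ℕ} {U : Sub (suc n)} {S : Subset n} →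
  CliqueIn G t U (false ∷ S) → CliqueIn (tailGraph G) t (U ∘ suc) S
CliqueIn-tail (cliqueIn size clique within) = cliqueIn size
  (λ u v mu mv ne → clique (suc u) (suc v) mu mv (ne ∘ suc-injective)) (λ u → within (suc u))

CliqueIn-false : {G : Graph (suc n)} {t : ℕ} {U : Sub (suc n)} {S : Subset n} →
  CliqueIn (tailGraph G) t (U ∘ suc) S → CliqueIn G t U (false ∷ S)
CliqueIn-false (cliqueIn size clique within) = cliqueIn size
  (λ { zero _ () ; (suc u) zero _ () ; (suc u) (suc v) mu mv ne → clique u v mu mv (ne ∘ cong suc) })
  (λ { (suc u) → within u })

-- Induction on the vertex set avoids any bijection between orderings and subsets: subsets split by
-- whether they contain `zero`, ordered cliques split in the same way by `c-remove`. The test `p` is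
-- arbitrary, so that combined filters are covered too.
c≡t!*count : ∀ (G : Graph n) t U p →
  (∀ S → p S ≡ true → CliqueIn G t U S) → (∀ S → CliqueIn G t U S → p S ≡ true) →
  c G t U ≡ t ! * count (allSubsets n) p
c≡t!*count {zero} G zero U p f g =
  sym (trans (*-identityˡ (count ([] ∷ []) p)) (trans (count-∷ [] [] p)
    (cong (λ b → ⟦ b ⟧ + 0) (g [] (cliqueIn refl (λ ()) (λ ()))))))
c≡t!*count {zero} G (suc t) U p f g = sym (trans (cong (suc t ! *_)
  (count-none (allSubsets 0) {p} (λ { [] → ¬-not λ e → contradiction (CliqueIn.size (f [] e)) λ () }))) (*-zeroʳ (suc t !)))
c≡t!*count {suc n} G zero U p f g = begin
  1                                              ≡⟨ c≡t!*count (tailGraph G) 0 (U ∘ suc) (p ∘ (false ∷_)) f₀ g₀ ⟩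
  0 ! * count (allSubsets n) (p ∘ (false ∷_))    ≡⟨ cong (λ x → 0 ! * (x + count (allSubsets n) (p ∘ (false ∷_)))) (count-none (allSubsets n) (λ S → ¬-not λ e → contradiction (CliqueIn.size (f (true ∷ S) e)) λ ())) ⟨
  0 ! * (count (allSubsets n) (p ∘ (true ∷_)) + count (allSubsets n) (p ∘ (false ∷_))) ≡⟨ cong (0 ! *_) (count-suc p) ⟨
  0 ! * count (allSubsets (suc n)) p             ∎
  where
  open ≡-Reasoning
  f₀ : ∀ S → p (false ∷ S) ≡ true → CliqueIn (tailGraph G) 0 (U ∘ suc) S
  f₀ S e = CliqueIn-tail (f (false ∷ S) e)
  g₀ : ∀ S → CliqueIn (tailGraph G) 0 (U ∘ suc) S → p (false ∷ S) ≡ true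
  g₀ S C = g (false ∷ S) (CliqueIn-false C)
c≡t!*count {suc n} G (suc t) U p f g = begin
  c G (suc t) U                                        ≡⟨ split (U zero) refl ⟩
  c G′ (suc t) U′ + suc t * (t ! * #₁)                 ≡⟨ cong (_+ suc t * (t ! * #₁)) (c≡t!*count G′ (suc t) U′ (p ∘ (false ∷_)) f₀ g₀) ⟩
  suc t ! * #₀ + suc t * (t ! * #₁)                    ≡⟨ lin (suc t) (t !) #₀ #₁ ⟩
  suc t ! * (#₁ + #₀)                                  ≡⟨ cong (suc t ! *_) (count-suc p) ⟨
  suc t ! * count (allSubsets (suc n)) p               ∎
  where
  open ≡-Reasoning
  G′ = tailGraph G
  U′ = U ∘ suc
  #₀ = count (allSubsets n) (p ∘ (false ∷_))
  #₁ = count (allSubsets n) (p ∘ (true ∷_))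
  lin : ∀ s f x y → s * f * x + s * (f * y) ≡ s * f * (y + x)
  lin = solve-∀
  f₀ : ∀ S → p (false ∷ S) ≡ true → CliqueIn G′ (suc t) U′ S
  f₀ S e = CliqueIn-tail (f (false ∷ S) e)
  g₀ : ∀ S → CliqueIn G′ (suc t) U′ S → p (false ∷ S) ≡ true
  g₀ S C = g (false ∷ S) (CliqueIn-false C)
  f₁ : ∀ S → p (true ∷ S) ≡ true → CliqueIn G′ t (U′ ∩ (N G zero ∘ suc)) S
  f₁ S e = let C = f (true ∷ S) e in
    cliqueIn (cong pred (CliqueIn.size C)) (λ u v mu mv ne → CliqueIn.clique C (suc u) (suc v) mu mv (ne ∘ suc-injective))
      (λ u mu → ∧-true (CliqueIn.within C (suc u) mu) (CliqueIn.clique C zero (suc u) refl mu λ ()))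
  g₁ : zero ∈ U → ∀ S → CliqueIn G′ t (U′ ∩ (N G zero ∘ suc)) S → p (true ∷ S) ≡ true
  g₁ 0∈ S C = g (true ∷ S) (cliqueIn (cong suc (CliqueIn.size C)) adjacent
    (λ { zero _ → 0∈ ; (suc u) mu → ∧-trueˡ (CliqueIn.within C u mu) }))
    where
    adjacent : ∀ u v → mem (true ∷ S) u ≡ true → mem (true ∷ S) v ≡ true → u ≢ v → adj G u v ≡ true
    adjacent zero zero _ _ ne = contradiction refl ne
    adjacent zero (suc v) _ mv _ = ∧-trueʳ {U′ v} (CliqueIn.within C v mv)
    adjacent (suc u) zero mu _ _ = trans (adj-sym G (suc u) zero) (∧-trueʳ {U′ u} (CliqueIn.within C u mu))
    adjacent (suc u) (suc v) mu mv ne = CliqueIn.clique C u v mu mv (ne ∘ cong suc)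
  split : ∀ b → U zero ≡ b → c G (suc t) U ≡ c G′ (suc t) U′ + suc t * (t ! * #₁)
  split true 0∈ = begin
    c G (suc t) U
      ≡⟨ c-remove G t U zero 0∈ ⟩
    c G (suc t) (U - zero) + suc t * c G t (U ∩ N G zero)
      ≡⟨ cong₂ (λ a b → a + suc t * b)
        (trans (c-tail G (suc t) (U - zero) (∧-zeroʳ (U zero))) (c-cong G′ (suc t) (λ x → ∧-identityʳ (U′ x))))
        (trans (c-tail G t (U ∩ N G zero) (trans (cong (U zero ∧_) (adj-irrefl G zero)) (∧-zeroʳ (U zero))))
          (c≡t!*count G′ t (U′ ∩ (N G zero ∘ suc)) (p ∘ (true ∷_)) f₁ (g₁ 0∈))) ⟩
    c G′ (suc t) U′ + suc t * (t ! * #₁) ∎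
  split false 0∉ = begin
    c G (suc t) U                   ≡⟨ c-tail G (suc t) U 0∉ ⟩
    c G′ (suc t) U′                 ≡⟨ +-identityʳ _ ⟨
    c G′ (suc t) U′ + 0             ≡⟨ cong (c G′ (suc t) U′ +_) (trans (cong (suc t *_) (*-zeroʳ (t !))) (*-zeroʳ (suc t))) ⟨
    c G′ (suc t) U′ + suc t * (t ! * 0)
      ≡⟨ cong (λ x → c G′ (suc t) U′ + suc t * (t ! * x)) (count-none (allSubsets n)
           (λ S → ¬-not λ e → true≢false (CliqueIn.within (f (true ∷ S) e) zero refl) 0∉)) ⟨
    c G′ (suc t) U′ + suc t * (t ! * #₁) ∎

c≡t!*k : ∀ (G : Graph n) t → c G t full ≡ t ! * k t G
c≡t!*k G t = c≡t!*count G t full (isTClique t G) (isTClique-elim t G) (isTClique-intro t G full)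

-- Subsets through both ends are obtained by inclusion-exclusion from counts of subsets avoiding `u`
-- or `v`. Those are clique counts of vertex-deleted sets, where `c-remove` gives the ordered
-- version; the prefactor is the number of ways to place `u` and `v`.
c≡j!*cliquesThrough : ∀ (G : Graph n) j {u v} → adj G u v ≡ true →
  c G j (full ∩ N G u ∩ N G v) ≡ j ! * cliquesThrough (suc (suc j)) G u v
c≡j!*cliquesThrough {n} G j {u} {v} uv = *-cancelˡ-≡ _ _ (suc (suc j) * suc j) (begin
  suc (suc j) * suc j * c G j (full ∩ N G u ∩ N G v) ≡⟨ inclusion-exclusion ⟩
  t ! * #uv                                ≡⟨ cong (t ! *_) (count-filter (allSubsets n) p (λ S → mem S u ∧ mem S v)) ⟨
  t ! * cliquesThrough t G u v             ≡⟨ lin (suc (suc j)) (suc j) (j !) _ ⟩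
  suc (suc j) * suc j * (j ! * cliquesThrough t G u v) ∎)
  where
  open ≡-Reasoning
  t = suc (suc j)
  p = isTClique t G
  κ : (Subset n → Bool) → ℕ
  κ = count (allSubsets n)
  mu mv : Subset n → Bool
  mu S = mem S u
  mv S = mem S v
  #uv = κ (λ S → p S ∧ (mu S ∧ mv S))
  #uv̄ = κ (λ S → (p S ∧ not (mv S)) ∧ mu S)
  lin : ∀ a b f x → a * (b * f) * x ≡ a * b * (f * x)
  lin = solve-∀

  avoiding : ∀ (U : Sub n) w (q : Subset n → Bool) → (∀ S → q S ≡ true → CliqueIn G t U S) → (∀ S → CliqueIn G t U S → q S ≡ true) →
    c G t (U - w) ≡ t ! * κ (λ S → q S ∧ not (mem S w))
  avoiding U w q f g = c≡t!*count G t (U - w) (λ S → q S ∧ not (mem S w))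
    (λ S e → let C = f S (∧-trueˡ e) in cliqueIn (CliqueIn.size C) (CliqueIn.clique C)
      (λ x mx → ∈-remove U (CliqueIn.within C x mx) (λ { refl → true≢false (∧-trueʳ {q S} e) (cong not mx) })))
    (λ S C → ∧-true (g S (cliqueIn (CliqueIn.size C) (CliqueIn.clique C) (λ x mx → remove-⊆ U w x (CliqueIn.within C x mx))))
      (cong not (¬-not λ mw → ∈-remove-≢ U (CliqueIn.within C w mw) refl)))

  f-full : ∀ S → p S ≡ true → CliqueIn G t full S
  f-full = isTClique-elim t G
  g-full : ∀ S → CliqueIn G t full S → p S ≡ true
  g-full = isTClique-intro t G full

  cₑ = c G t full
  cᵤ = c G t (full - u)
  cᵥ = c G t (full - v)
  cᵥᵤ = c G t ((full - v) - u)

  e₁ : cₑ ≡ t ! * #uv + t ! * #uv̄ + cᵤ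
  e₁ = begin
    cₑ                                     ≡⟨ c≡t!*count G t full p f-full g-full ⟩
    t ! * κ p                              ≡⟨ cong (t ! *_) (count-split (allSubsets n) p mu) ⟩
    t ! * (κ (λ S → p S ∧ mu S) + κ (λ S → p S ∧ not (mu S)))
      ≡⟨ cong (λ x → t ! * (x + κ (λ S → p S ∧ not (mu S)))) (trans (count-split (allSubsets n) (λ S → p S ∧ mu S) mv)
          (cong₂ _+_ (count-cong (allSubsets n) (λ S → ∧-assoc (p S) (mu S) (mv S)))
                     (count-cong (allSubsets n) (λ S → bool-swap (p S) (mu S) (not (mv S)))))) ⟩
    t ! * (#uv + #uv̄ + κ (λ S → p S ∧ not (mu S)))  ≡⟨ dist (t !) #uv #uv̄ _ ⟩
    t ! * #uv + t ! * #uv̄ + t ! * κ (λ S → p S ∧ not (mu S))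
      ≡⟨ cong (t ! * #uv + t ! * #uv̄ +_) (avoiding full u p f-full g-full) ⟨
    t ! * #uv + t ! * #uv̄ + cᵤ ∎
    where
    dist : ∀ a x y z → a * (x + y + z) ≡ a * x + a * y + a * z
    dist = solve-∀
    bool-swap : ∀ a b c → (a ∧ b) ∧ c ≡ (a ∧ c) ∧ b
    bool-swap a b c = trans (∧-assoc a b c) (trans (cong (a ∧_) (∧-comm b c)) (sym (∧-assoc a c b)))

  f-v : ∀ S → (p S ∧ not (mv S)) ≡ true → CliqueIn G t (full - v) S
  f-v S e = let C = f-full S (∧-trueˡ e) in cliqueIn (CliqueIn.size C) (CliqueIn.clique C)
    (λ x mx → ∈-remove full refl (λ { refl → true≢false (∧-trueʳ {p S} e) (cong not mx) }))
  g-v : ∀ S → CliqueIn G t (full - v) S → (p S ∧ not (mv S)) ≡ true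
  g-v S C = ∧-true (g-full S (cliqueIn (CliqueIn.size C) (CliqueIn.clique C) (λ _ _ → refl)))
    (cong not (¬-not λ m → ∈-remove-≢ full (CliqueIn.within C v m) refl))

  e₂ : cᵥ ≡ t ! * #uv̄ + cᵥᵤ
  e₂ = begin
    cᵥ ≡⟨ c≡t!*count G t (full - v) (λ S → p S ∧ not (mv S)) f-v g-v ⟩
    t ! * κ (λ S → p S ∧ not (mv S)) ≡⟨ cong (t ! *_) (count-split (allSubsets n) (λ S → p S ∧ not (mv S)) mu) ⟩
    t ! * (#uv̄ + κ (λ S → (p S ∧ not (mv S)) ∧ not (mu S))) ≡⟨ *-distribˡ-+ (t !) #uv̄ _ ⟩
    t ! * #uv̄ + t ! * κ (λ S → (p S ∧ not (mv S)) ∧ not (mu S)) ≡⟨ cong (t ! * #uv̄ +_) (avoiding (full - v) u (λ S → p S ∧ not (mv S)) f-v g-v) ⟨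
    t ! * #uv̄ + cᵥᵤ ∎

  u≢v : u ≢ v
  u≢v refl = true≢false uv (adj-irrefl G u)

  inclusion-exclusion : suc (suc j) * suc j * c G j (full ∩ N G u ∩ N G v) ≡ t ! * #uv
  inclusion-exclusion = +-cancelʳ-≡ (t * c G (suc j) ((full - v) ∩ N G u)) _ _ (begin
    t * suc j * x + t * y                     ≡⟨ lin′ t (suc j) x y ⟩
    t * (y + suc j * x)                       ≡⟨ cong (t *_) (trans (c-remove G j (full ∩ N G u) v uv)
                                                  (cong (_+ suc j * x) (c-cong G (suc j) (remove-∩ full v (N G u))))) ⟨
    t * c G (suc j) (full ∩ N G u)            ≡⟨ +-cancelʳ-≡ cᵤ _ _ (trans (+-comm _ cᵤ) (trans (sym (c-remove G (suc j) full u refl)) e₁)) ⟩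
    t ! * #uv + t ! * #uv̄                     ≡⟨ cong (t ! * #uv +_) (+-cancelʳ-≡ cᵥᵤ _ _ (trans (sym e₂)
                                                  (trans (c-remove G (suc j) (full - v) u (∈-remove full refl u≢v)) (+-comm cᵥᵤ _)))) ⟩
    t ! * #uv + t * y                         ∎)
    where
    x = c G j (full ∩ N G u ∩ N G v)
    y = c G (suc j) ((full - v) ∩ N G u)
    lin′ : ∀ t s x y → t * s * x + t * y ≡ t * (y + s * x)
    lin′ = solve-∀

cliquesThrough≤js : ∀ t (G : Graph n) {u v} → adj G u v ≡ true → cliquesThrough t G u v ≤ js t G
cliquesThrough≤js {n} t G {u} {v} uv = bound _ (∈-concatMap⁺ row (lose (∈-allFin u) (subst (_∈ᴸ row u) eq (∈-map⁺ (entry u) (∈-allFin v)))))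
  where
  entry : Fin n → Fin n → ℕ
  entry u v = if adj G u v then cliquesThrough t G u v else 0
  row : Fin n → List ℕ
  row u = map (entry u) (allFin n)
  eq : entry u v ≡ cliquesThrough t G u v
  eq rewrite uv = refl
  bound : ∀ {x} xs → x ∈ᴸ xs → x ≤ foldr _⊔_ 0 xs
  bound (y ∷ ys) (here refl) = m≤m⊔n y _
  bound (y ∷ ys) (there m) = ≤-trans (bound ys m) (m≤n⊔m y _)

-- Zykov's theorem with uniqueness

search : (U : Sub n) {Q : Fin n → Set} → (∀ v → Dec (Q v)) →
  (∃ λ v → v ∈ U × Q v) ⊎ (∀ v → v ∈ U → ¬ Q v)
search U Q? with any? (λ v → (U v ≟ true) ×-dec Q? v)
... | yes p = inj₁ p
... | no ¬p = inj₂ λ v v∈ q → ¬p (v , v∈ , q)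

⊆∧#≤⇒⊇ : {A B : Sub n} → A ⊆ B → # B ≤ # A → B ⊆ A
⊆∧#≤⇒⊇ {A = A} {B} h le v v∈B with A v in eq
... | true = refl
... | false = contradiction (≤-trans (≤-reflexive (sym (#-remove B v v∈B))) (≤-trans le (#-mono {U = A} λ x x∈ →
      ∈-remove B (h x x∈) λ { refl → true≢false x∈ eq }))) 1+n≰n

#≤1 : (A : Sub n) → (∀ x y → x ∈ A → y ∈ A → x ≡ y) → # A ≤ 1
#≤1 A h with search A {λ _ → 0 ≡ 0} (λ _ → yes refl)
... | inj₂ none = ≤-trans (≮⇒≥ λ p → let v , v∈ , _ = ∑∈-positive A _ p in none v v∈ refl) z≤n
... | inj₁ (v , v∈ , _) = subst (_≤ 1) (sym (#-remove A v v∈)) (s≤s (≮⇒≥ λ p →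
      let x , x∈ , _ = ∑∈-positive (A - v) _ p in ∈-remove-≢ A x∈ (h x v (remove-⊆ A v x x∈) v∈)))

module _ (G : Graph n) where

  c-neighbours≤ : ∀ t {U} v → v ∈ U → c G t (U ∩ N G v) ≤ c G (suc t) U
  c-neighbours≤ t {U} v v∈ = subst (c G t (U ∩ N G v) ≤_) (sym (∑∈-remove U v (λ u → c G t (U ∩ N G u)) v∈)) (m≤n+m _ _)

  neighbours⊆remove : ∀ (U : Sub n) v → U ∩ N G v ⊆ U - v
  neighbours⊆remove U v x p = ∈-remove U (∧-trueˡ p) λ { refl → true≢false (∧-trueʳ {U x} p) (adj-irrefl G x) }

  c-positive⇒≤# : ∀ t U → 0 < c G t U → t ≤ # U
  c-positive⇒≤# zero U p = z≤n
  c-positive⇒≤# (suc t) U p with v , v∈ , q ← ∑∈-positive U _ p =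
    subst (suc t ≤_) (sym (#-remove U v v∈)) (s≤s (≤-trans (c-positive⇒≤# t (U ∩ N G v) q)
      (#-mono {U = U ∩ N G v} (neighbours⊆remove U v))))

  c-mono-0 : ∀ t {U W} → U ⊆ W → c G t W ≡ 0 → c G t U ≡ 0
  c-mono-0 t {U} h e = n≤0⇒n≡0 (subst (c G t U ≤_) e (c-mono G t h))

  c-neighbours-0 : ∀ t U v → v ∈ U → c G (suc t) U ≡ 0 → c G t (U ∩ N G v) ≡ 0
  c-neighbours-0 t U v v∈ e = n≤0⇒n≡0 (subst (c G t (U ∩ N G v) ≤_) e (c-neighbours≤ t {U} v v∈))

  -- Otherwise every vertex misses at most `b` vertices, and the greedy choice with one candidate
  -- kept at each step finds an (r+1)-clique.
  low-degree-vertex : ∀ r b U → c G (suc r) U ≡ 0 → r * b < # U →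
    ∃ λ v → v ∈ U × # (U ∩ N G v) + b < # U
  low-degree-vertex r b U free r*b< with search U (λ v → # (U ∩ N G v) + b <? # U)
  ... | inj₁ p = p
  ... | inj₂ none = contradiction (subst (0 <_) free (≤-trans
        (Π-positive (suc r) {λ _ → 1} (λ _ _ → s≤s z≤n))
        (greedy G b nonneighbours (suc r) (λ _ → 1) (λ _ p → p) λ { i (s≤s i≤r) →
          ≤-trans (s≤s (*-monoˡ-≤ b i≤r)) r*b< }))) λ ()
    where
    nonneighbours : ∀ v → v ∈ U → # (U ∩ (not ∘ N G v)) ≤ b
    nonneighbours v v∈ = +-cancelˡ-≤ (# (U ∩ N G v)) _ _
      (subst (_≤ # (U ∩ N G v) + b) (#-split U (N G v)) (≮⇒≥ (none v v∈)))

-- What the extremal argument uses of the complete balanced r-partite graphs: removing a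
-- vertex w of a largest class (of size 1 + b) and passing to the neighbourhood of w
-- both stay within the family.
data TuránLike {m} (T : Graph m) : ℕ → Sub m → Set where
  empty : ∀ {r W} → # W ≡ 0 → TuránLike T r W
  step : ∀ {r W} w b → w ∈ W → # W ≡ suc b + # (W ∩ N T w) → suc r * b < # W →
    TuránLike T (suc r) (W - w) → TuránLike T r (W ∩ N T w) → TuránLike T (suc r) W

module _ {m} (T : Graph m) (G : Graph n) where

  -- The two graphs are dismantled in parallel. A low-degree `v` of `U` is matched with `w`: by
  -- `c-remove` the s-cliques avoiding them are compared through `t₁`, and those through them, via
  -- neighbourhoods of comparable size, through `t₂`. If `U` is strictly smaller, only `w` goes.
  zykov : ∀ {r W} → TuránLike T r W → ∀ U → c G (suc r) U ≡ 0 → # U ≤ # W → ∀ s → c G s U ≤ c T s W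
  zykov _ U free le zero = ≤-refl
  zykov (empty e) U free le (suc s) =
    ≤-trans (≮⇒≥ λ p → let v , v∈ , _ = ∑∈-positive U _ p in
      contradiction (≤-trans (∈⇒#-positive U v∈) (subst (# U ≤_) e le)) λ ()) z≤n
  zykov {suc r} {W} (step w b w∈ e lt t₁ t₂) U free le (suc s) with m≤n⇒m<n∨m≡n le
  ... | inj₁ lt′ = ≤-trans
        (zykov t₁ U free (s≤s⁻¹ (subst (# U <_) (#-remove W w w∈) lt′)) (suc s))
        (c-mono T (suc s) (remove-⊆ W w))
  ... | inj₂ eq with v , v∈ , d ← low-degree-vertex G (suc r) b U free (subst (suc r * b <_) (sym eq) lt) =
    subst₂ _≤_ (sym (c-remove G s U v v∈)) (sym (c-remove T s W w w∈)) (+-mono-≤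
      (zykov t₁ (U - v) (c-mono-0 G (suc (suc r)) (remove-⊆ U v) free)
        (≤-reflexive (suc-injectiveℕ (trans (sym (#-remove U v v∈)) (trans eq (#-remove W w w∈))))) (suc s))
      (*-monoʳ-≤ (suc s) (zykov t₂ (U ∩ N G v) (c-neighbours-0 G (suc r) U v v∈ free)
        (+-cancelʳ-≤ b _ _ (s≤s⁻¹ (subst (# (U ∩ N G v) + b <_)
          (trans eq (trans e (cong suc (+-comm b _)))) d))) s)))

module _ {m} (T : Graph m) where

  -- This guarantees that the neighbourhood of `w` is large enough to contain a clique of the size
  -- that the induction asks for. When `b` is positive, each of the other `r` classes accounts for
  -- at least one vertex.
  degree-of-top : ∀ {r b d W} t → t ≤ r → suc t ≤ W → W ≡ suc b + d → suc r * b < W → t ≤ d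
  degree-of-top {b = zero} t _ le refl _ = s≤s⁻¹ le
  degree-of-top {r} {suc b} {d} t t≤r _ refl lt = +-cancelˡ-≤ (suc b) _ _ (begin
    suc b + t                 ≡⟨ cong (suc b +_) (*-identityʳ t) ⟨
    suc b + t * 1             ≤⟨ +-monoʳ-≤ (suc b) (*-monoʳ-≤ t (s≤s (z≤n {b}))) ⟩
    suc t * suc b             ≤⟨ *-monoˡ-≤ (suc b) (s≤s t≤r) ⟩
    suc r * suc b             ≤⟨ s≤s⁻¹ lt ⟩
    suc b + d                 ∎)
    where open ≤-Reasoning

  TuránLike-positive : ∀ {r W} → TuránLike T r W → ∀ t → t ≤ r → t ≤ # W → 0 < c T t W
  TuránLike-positive _ zero _ _ = s≤s z≤n
  TuránLike-positive (empty e) (suc t) _ le = contradiction (subst (suc t ≤_) e le) λ ()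
  TuránLike-positive {W = W} (step w b w∈ e lt t₁ t₂) (suc t) (s≤s t≤r) le =
    ≤-trans (TuránLike-positive t₂ t t≤r (degree-of-top t t≤r le e lt)) (c-neighbours≤ T t {W} w w∈)

  -- The spare vertex `w` of `W` lies in at least one clique of the required size, while `W - w`
  -- already has as many cliques as `U`.
  zykov-strict : ∀ (G : Graph n) {r W} → TuránLike T r W → ∀ t → suc t ≤ r → suc t ≤ # W →
    ∀ U → c G (suc r) U ≡ 0 → # U < # W → c G (suc t) U < c T (suc t) W
  zykov-strict G (empty e) t _ le = contradiction (subst (suc t ≤_) e le) λ ()
  zykov-strict G {W = W} (step w b w∈ e lt t₁ t₂) t (s≤s t≤r) le U free U<W =
    ≤-trans (s≤s (zykov T G t₁ U free (s≤s⁻¹ (subst (# U <_) (#-remove W w w∈) U<W)) (suc t)))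
      (subst₂ _≤_ (+-comm _ 1) (sym (c-remove T t W w w∈)) (+-monoʳ-≤ (c T (suc t) (W - w))
        (*-mono-≤ (s≤s (z≤n {t})) (TuránLike-positive t₂ t t≤r (degree-of-top t t≤r le e lt)))))

-- Classes may be empty, so a clique on fewer than `r` vertices also qualifies; this is where the
-- uniqueness induction starts.
record Balanced (G : Graph n) (r : ℕ) (U : Sub n) : Set where
  field
    colour : Fin n → Fin r
    multipartite : ∀ x y → x ∈ U → y ∈ U → adj G x y ≡ not ⌊ colour x ≟F colour y ⌋
  class : Fin r → Sub n
  class i x = ⌊ colour x ≟F i ⌋
  field
    balanced : ∀ i j → # (U ∩ class i) ≤ suc (# (U ∩ class j))

≟-true : {x y : Fin n} → ⌊ x ≟F y ⌋ ≡ true → x ≡ y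
≟-true {x = x} {y} e with x ≟F y
... | yes p = p

≟-false : {x y : Fin n} → x ≢ y → ⌊ x ≟F y ⌋ ≡ false
≟-false {x = x} {y} ne with x ≟F y
... | yes p = contradiction p ne
... | no _ = refl

module _ (G : Graph n) {r : ℕ} where

  -- Vertices of distinct classes are adjacent, so one representative of each colour in `C` gives a
  -- clique inside `W`. Applied to a neighbourhood, it shows that a new vertex must miss some class
  -- completely.
  rainbow-clique : (colour : Fin n → Fin r) (U : Sub n) →
    (∀ x y → x ∈ U → y ∈ U → adj G x y ≡ not ⌊ colour x ≟F colour y ⌋) →
    ∀ t (C : Sub r) → # C ≡ t → ∀ W → W ⊆ U → (∀ i → i ∈ C → ∃ λ x → x ∈ W × colour x ≡ i) → 0 < c G t W
  rainbow-clique colour U mp zero C e W W⊆ h = s≤s z≤n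
  rainbow-clique colour U mp (suc t) C e W W⊆ h
    with i , i∈ , _ ← ∑∈-positive C (λ _ → 1) (subst (0 <_) (sym e) (s≤s z≤n))
    with x , x∈ , refl ← h i i∈ =
    ≤-trans (rainbow-clique colour U mp t (C - i) (suc-injectiveℕ (trans (sym (#-remove C i i∈)) e)) (W ∩ N G x)
      (λ y p → W⊆ y (∧-trueˡ p)) rest) (c-neighbours≤ G t {W} x x∈)
    where
    rest : ∀ j → j ∈ C - colour x → ∃ λ y → y ∈ W ∩ N G x × colour y ≡ j
    rest j j∈ with y , y∈ , refl ← h j (remove-⊆ C (colour x) j j∈) =
      y , ∧-true y∈ (trans (mp x y (W⊆ x x∈) (W⊆ y y∈)) (cong not (≟-false λ q → ∈-remove-≢ C j∈ (sym q)))) , refl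

  -- The hypotheses make `U` a clique. Keeping the colours below `t` leaves colour `t` free for the
  -- next vertex.
  clique-colouring : ∀ t (t≤r : t ≤ suc r) U → # U ≡ t → 0 < c G t U →
    Σ (Fin n → Fin (suc r)) λ g → (∀ x → x ∈ U → toℕ (g x) < t) ×
      (∀ x y → x ∈ U → y ∈ U → x ≢ y → g x ≢ g y × adj G x y ≡ true)
  clique-colouring zero _ U e _ = (λ _ → zero) , (λ x x∈ → contradiction x∈ (λ p → true≢false p (#≡0⇒∉ U e x))) ,
    (λ x y x∈ → contradiction x∈ (λ p → true≢false p (#≡0⇒∉ U e x)))
  clique-colouring (suc t) t<r U e p
    with v , v∈ , q ← ∑∈-positive U _ p
    with g , small , inj ← clique-colouring t (<⇒≤ t<r) (U - v) (suc-injectiveℕ (trans (sym (#-remove U v v∈)) e))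
           (≤-trans q (c-mono G t (neighbours⊆remove G U v))) = g′ , small′ , inj′
    where
    g′ : Fin n → Fin (suc r)
    g′ x with x ≟F v
    ... | yes _ = fromℕ< t<r
    ... | no _ = g x
    small′ : ∀ x → x ∈ U → toℕ (g′ x) < suc t
    small′ x x∈ with x ≟F v
    ... | yes _ = s≤s (≤-reflexive (toℕ-fromℕ< t<r))
    ... | no ne = m<n⇒m<1+n (small x (∈-remove U x∈ ne))
    -- The neighbourhood holds a `t`-clique, hence at least `t` vertices, and only `t` vertices
    -- other than `v` exist.
    U-v⊆ : U - v ⊆ U ∩ N G v
    U-v⊆ = ⊆∧#≤⇒⊇ (neighbours⊆remove G U v) (≤-trans
      (≤-reflexive (suc-injectiveℕ (trans (sym (#-remove U v v∈)) e))) (c-positive⇒≤# G t (U ∩ N G v) q))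
    fresh : ∀ y → y ∈ U → y ≢ v → fromℕ< t<r ≢ g y
    fresh y y∈ ne eq = <-irrefl (sym (trans (sym (toℕ-fromℕ< t<r)) (cong toℕ eq))) (small y (∈-remove U y∈ ne))
    inj′ : ∀ x y → x ∈ U → y ∈ U → x ≢ y → g′ x ≢ g′ y × adj G x y ≡ true
    inj′ x y x∈ y∈ ne with x ≟F v | y ≟F v
    ... | yes refl | yes refl = contradiction refl ne
    ... | yes refl | no y≢ = fresh y y∈ y≢ , ∧-trueʳ {U y} (U-v⊆ y (∈-remove U y∈ y≢))
    ... | no x≢ | yes refl = (λ q → fresh x x∈ x≢ (sym q)) ,
          trans (adj-sym G x y) (∧-trueʳ {U x} (U-v⊆ x (∈-remove U x∈ x≢)))
    ... | no x≢ | no y≢ = inj x y (∈-remove U x∈ x≢) (∈-remove U y∈ y≢) ne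

  clique⇒Balanced : ∀ t → t ≤ suc r → ∀ U → # U ≡ t → 0 < c G t U → Balanced G (suc r) U
  clique⇒Balanced t t≤r U e p with g , _ , inj ← clique-colouring t t≤r U e p = record
    { colour = g
    ; multipartite = mp
    ; balanced = λ i j → ≤-trans (#≤1 _ (single i)) (s≤s z≤n) }
    where
    mp : ∀ x y → x ∈ U → y ∈ U → adj G x y ≡ not ⌊ g x ≟F g y ⌋
    mp x y x∈ y∈ with x ≟F y
    ... | yes refl = trans (adj-irrefl G x) (cong not (sym (≟-refl (g x))))
    ... | no ne = let gne , a = inj x y x∈ y∈ ne in trans a (cong not (sym (≟-false gne)))
    single : ∀ i x y → x ∈ U ∩ (λ z → ⌊ g z ≟F i ⌋) → y ∈ U ∩ (λ z → ⌊ g z ≟F i ⌋) → x ≡ y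
    single i x y x∈ y∈ = decidable-stable (x ≟F y) λ ne →
      proj₁ (inj x y (∧-trueˡ x∈) (∧-trueˡ y∈) ne) (trans (≟-true (∧-trueʳ {U x} x∈)) (sym (≟-true (∧-trueʳ {U y} y∈))))

≟-sym : (x y : Fin n) → ⌊ x ≟F y ⌋ ≡ ⌊ y ≟F x ⌋
≟-sym x y = bool-ext (λ e → subst (λ z → ⌊ z ≟F x ⌋ ≡ true) (≟-true e) (≟-refl x))
  (λ e → subst (λ z → ⌊ z ≟F y ⌋ ≡ true) (≟-true e) (≟-refl y))

#-single : (v : Fin n) → # (λ x → ⌊ x ≟F v ⌋) ≡ 1
#-single v = sum-at v (λ _ → 1)

∑∈-classes : ∀ {r} (U : Sub n) (g : Fin n → Fin r) (C : Sub r) →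
  ∑∈ C (λ i → # (U ∩ (λ x → ⌊ g x ≟F i ⌋))) ≡ # (U ∩ (C ∘ g))
∑∈-classes U g C = trans
  (∑∈-swap C (U ∩ (C ∘ g)) (λ i → U ∩ (λ x → ⌊ g x ≟F i ⌋)) (λ x i → ⌊ i ≟F g x ⌋) (λ _ _ → 1) pt)
  (∑∈-cong {U = U ∩ (C ∘ g)} (λ _ → refl) (λ x _ → #-single (g x)))
  where
  pt : ∀ i x → C i ∧ (U x ∧ ⌊ g x ≟F i ⌋) ≡ (U x ∧ C (g x)) ∧ ⌊ i ≟F g x ⌋
  pt i x rewrite ≟-sym i (g x) with g x ≟F i
  ... | yes refl rewrite ∧-identityʳ (U x) | ∧-identityʳ (U x ∧ C (g x)) = ∧-comm (C (g x)) (U x)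
  ... | no _ rewrite ∧-zeroʳ (U x) | ∧-zeroʳ (U x ∧ C (g x)) = ∧-zeroʳ (C i)

module _ (G : Graph n) {r : ℕ} where

  -- Besides itself, `v` misses exactly `b` vertices of `U`. It misses a whole class `i₀`, and every
  -- class has at least `b` vertices, so the missed vertices are precisely that class, which `v`
  -- then joins.
  Balanced-extend : ∀ {U} v b → v ∈ U → Balanced G (suc r) (U - v) → c G (suc (suc r)) U ≡ 0 →
    # U ≡ suc b + # (U ∩ N G v) → suc r * b < # U → Balanced G (suc r) U
  Balanced-extend {U} v b v∈ B free deg r*b< = record
    { colour = colour′ ; multipartite = multipartite′ ; balanced = balanced′ }
    where
    open Balanced B
    open ≤-Reasoning
    U′ = U - v
    size : Fin (suc r) → ℕ
    size i = # (U′ ∩ class i)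

    missing : ∃ λ i → ∀ x → x ∈ U′ → colour x ≡ i → adj G v x ≡ false
    missing with any? (λ i → all? (λ x → ¬? ((U′ x ∧ N G v x ≟ true) ×-dec (colour x ≟F i))))
    ... | yes (i , h) = i , λ x x∈ e → ¬-not λ a → h x (∧-true x∈ a , e)
    ... | no ¬h = contradiction (rainbow-clique G colour U′ multipartite (suc r) full (#-full {suc r}) (U′ ∩ N G v)
            (λ x → ∧-trueˡ) reps) (subst (λ k → ¬ 0 < k) (sym zero-nbrs) (λ ()))
      where
      zero-nbrs : c G (suc r) (U′ ∩ N G v) ≡ 0
      zero-nbrs = c-mono-0 G (suc r) (∩-mono G v (remove-⊆ U v)) (c-neighbours-0 G (suc r) U v v∈ free)
      reps : ∀ i → i ∈ full → ∃ λ x → x ∈ U′ ∩ N G v × colour x ≡ i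
      reps i _ with search (U′ ∩ N G v) (λ x → colour x ≟F i)
      ... | inj₁ p = p
      ... | inj₂ none = contradiction (i , λ { x (x∈ , e) → none x x∈ e }) ¬h

    i₀ = proj₁ missing

    -- If one class had fewer than `b` vertices, balance would cap the others at `b`, leaving at
    -- most `suc r * b` vertices even with `v` counted.
    b≤size : ∀ j → b ≤ size j
    b≤size j = ≮⇒≥ λ size<b → <⇒≱ r*b< (begin
      # U                                      ≡⟨ #-remove U v v∈ ⟩
      suc (# U′)                               ≡⟨ cong suc (trans (∑∈-classes U′ colour full) (#-cong λ x → ∧-identityʳ (U′ x))) ⟨
      suc (∑∈ full size)                       ≡⟨ cong suc (∑∈-remove full j size refl) ⟩
      suc (∑∈ (full - j) size + size j)        ≡⟨ +-suc _ (size j) ⟨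
      ∑∈ (full - j) size + suc (size j)        ≤⟨ +-mono-≤ (∑∈≤#* (full - j) size b (λ i _ → ≤-trans (balanced i j) size<b)) size<b ⟩
      # (full - j) * b + b                     ≡⟨ +-comm _ b ⟩
      suc (# (full - j)) * b                   ≡⟨ cong (_* b) (trans (sym (#-remove full j refl)) (#-full {suc r})) ⟩
      suc r * b                                ∎)

    V̄ : Sub n
    V̄ = U ∩ (not ∘ N G v)

    v∈V̄ : v ∈ V̄
    v∈V̄ = ∧-true v∈ (cong not (adj-irrefl G v))

    #V̄ : # (V̄ - v) ≡ b
    #V̄ = suc-injectiveℕ (trans (sym (#-remove V̄ v v∈V̄)) (+-cancelˡ-≡ (# (U ∩ N G v)) _ _
      (trans (sym (#-split U (N G v))) (trans deg (+-comm (suc b) _)))))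

    class⊆V̄ : U′ ∩ class i₀ ⊆ V̄ - v
    class⊆V̄ x x∈ = let x∈U′ = ∧-trueˡ x∈ in ∈-remove V̄
      (∧-true (remove-⊆ U v x x∈U′) (cong not (proj₂ missing x x∈U′ (≟-true (∧-trueʳ {U′ x} x∈)))))
      (∈-remove-≢ U x∈U′)

    size-i₀ : size i₀ ≡ b
    size-i₀ = ≤-antisym (≤-trans (#-mono {U = U′ ∩ class i₀} class⊆V̄) (≤-reflexive #V̄)) (b≤size i₀)

    V̄⊆class : V̄ - v ⊆ U′ ∩ class i₀
    V̄⊆class = ⊆∧#≤⇒⊇ class⊆V̄ (≤-reflexive (trans #V̄ (sym size-i₀)))

    adj-v : ∀ x → x ∈ U → x ≢ v → adj G v x ≡ not ⌊ i₀ ≟F colour x ⌋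
    adj-v x x∈ ne with i₀ ≟F colour x
    ... | yes e = proj₂ missing x (∈-remove U x∈ ne) (sym e)
    ... | no ne′ with adj G v x in a
    ...   | true = refl
    ...   | false = contradiction (sym (≟-true (∧-trueʳ {U′ x} (V̄⊆class x (∈-remove V̄ (∧-true x∈ (cong not a)) ne))))) ne′

    colour′ : Fin n → Fin (suc r)
    colour′ x with x ≟F v
    ... | yes _ = i₀
    ... | no _ = colour x

    multipartite′ : ∀ x y → x ∈ U → y ∈ U → adj G x y ≡ not ⌊ colour′ x ≟F colour′ y ⌋
    multipartite′ x y x∈ y∈ with x ≟F v | y ≟F v
    ... | yes refl | yes refl = trans (adj-irrefl G v) (cong not (sym (≟-refl i₀)))
    ... | yes refl | no y≢ = adj-v y y∈ y≢
    ... | no x≢ | yes refl = trans (adj-sym G x y) (trans (adj-v x x∈ x≢)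
            (cong not (≟-sym i₀ (colour x))))
    ... | no x≢ | no y≢ = multipartite x y (∈-remove U x∈ x≢) (∈-remove U y∈ y≢)

    class′ : Fin (suc r) → Sub n
    class′ i x = ⌊ colour′ x ≟F i ⌋

    colour′-v : colour′ v ≡ i₀
    colour′-v with v ≟F v
    ... | yes _ = refl
    ... | no ne = contradiction refl ne

    remove-class′ : ∀ i → (U ∩ class′ i) - v ≐ U′ ∩ class i
    remove-class′ i x with x ≟F v
    ... | yes refl rewrite ∧-zeroʳ (U x ∧ ⌊ i₀ ≟F i ⌋) | ∧-zeroʳ (U x) = refl
    ... | no _ rewrite ∧-identityʳ (U x ∧ ⌊ colour x ≟F i ⌋) | ∧-identityʳ (U x) = refl

    size′ : ∀ i → (i ≡ i₀ × # (U ∩ class′ i) ≡ suc b) ⊎ (# (U ∩ class′ i) ≡ size i)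
    size′ i with i₀ ≟F i
    ... | yes refl = inj₁ (refl , trans (#-remove (U ∩ class′ i₀) v (∧-true v∈ (trans (cong (λ z → ⌊ z ≟F i₀ ⌋) colour′-v) (≟-refl i₀))))
            (cong suc (trans (#-cong (remove-class′ i₀)) size-i₀)))
    ... | no ne = inj₂ (trans (#-cong (∉-remove (U ∩ class′ i) v (trans (cong (λ z → U v ∧ ⌊ z ≟F i ⌋) colour′-v)
            (trans (cong (U v ∧_) (≟-false ne)) (∧-zeroʳ (U v)))))) (#-cong (remove-class′ i)))

    balanced′ : ∀ i j → # (U ∩ class′ i) ≤ suc (# (U ∩ class′ j))
    balanced′ i j with size′ i | size′ j
    ... | inj₁ (_ , e) | inj₁ (_ , e′) rewrite e | e′ = n≤1+n _
    ... | inj₁ (_ , e) | inj₂ e′ rewrite e | e′ = s≤s (b≤size j)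
    ... | inj₂ e | inj₁ (refl , e′) rewrite e | e′ = ≤-trans (balanced i j) (s≤s (≤-trans (≤-reflexive size-i₀) (n≤1+n b)))
    ... | inj₂ e | inj₂ e′ rewrite e | e′ = balanced i j

-- Equality forces equality at every stage of the parallel dismantling: `U - v` is extremal again,
-- and `v` has the degree of `w`. With `2 ≤ s` the neighbourhoods are compared through cliques on at
-- least one vertex, where `zykov-strict` detects a degree that is too small.
zykov-unique : ∀ {m} (T : Graph m) (G : Graph n) {r W} → TuránLike T r W → ∀ s → 2 ≤ s → s ≤ r → s ≤ # W →
  ∀ U → # U ≡ # W → c G (suc r) U ≡ 0 → c T s W ≤ c G s U → Balanced G r U
zykov-unique T G (empty e) s 2≤s _ s≤W = contradiction (≤-trans 2≤s (subst (s ≤_) e s≤W)) λ ()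
zykov-unique T G (step _ _ _ _ _ _ _) (suc zero) (s≤s ())
zykov-unique T G {suc r} {W} (step w b w∈ e lt t₁ t₂) (suc (suc s)) 2≤s (s≤s s≤r) s≤W U eq free le
  with m≤n⇒m<n∨m≡n s≤W
-- With exactly `s` vertices, containing one s-clique means being a clique.
... | inj₂ s≡W = clique⇒Balanced G (suc (suc s)) (s≤s s≤r) U (trans eq (sym s≡W))
        (≤-trans (TuránLike-positive T (step w b w∈ e lt t₁ t₂) (suc (suc s)) (s≤s s≤r) s≤W) le)
... | inj₁ s<W with v , v∈ , d ← low-degree-vertex G (suc r) b U free (subst (suc r * b <_) (sym eq) lt) =
  Balanced-extend G v b v∈
    (zykov-unique T G t₁ (suc (suc s)) 2≤s (s≤s s≤r) (s≤s⁻¹ (subst (suc (suc s) <_) (#-remove W w w∈) s<W))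
      (U - v) #U-v free′ (+-cancelʳ-≤ (suc (suc s) * c G (suc s) (U ∩ N G v)) _ _ (begin
        c T (suc (suc s)) (W - w) + suc (suc s) * c G (suc s) (U ∩ N G v)
          ≤⟨ +-monoʳ-≤ (c T (suc (suc s)) (W - w)) (*-monoʳ-≤ (suc (suc s)) c-nbrs≤) ⟩
        c T (suc (suc s)) (W - w) + suc (suc s) * c T (suc s) (W ∩ N T w)
          ≤⟨ le′ ⟩
        c G (suc (suc s)) (U - v) + suc (suc s) * c G (suc s) (U ∩ N G v) ∎)))
    free (trans eq (trans e (cong (suc b +_) (sym #nbrs)))) (subst (suc r * b <_) (sym eq) lt)
  where
  open ≤-Reasoning
  #U-v : # (U - v) ≡ # (W - w)
  #U-v = suc-injectiveℕ (trans (sym (#-remove U v v∈)) (trans eq (#-remove W w w∈)))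
  free′ : c G (suc (suc r)) (U - v) ≡ 0
  free′ = c-mono-0 G (suc (suc r)) (remove-⊆ U v) free
  free″ : c G (suc r) (U ∩ N G v) ≡ 0
  free″ = c-neighbours-0 G (suc r) U v v∈ free
  #nbrs≤ : # (U ∩ N G v) ≤ # (W ∩ N T w)
  #nbrs≤ = +-cancelʳ-≤ b _ _ (s≤s⁻¹ (subst (# (U ∩ N G v) + b <_) (trans eq (trans e (cong suc (+-comm b _)))) d))
  c-nbrs≤ : c G (suc s) (U ∩ N G v) ≤ c T (suc s) (W ∩ N T w)
  c-nbrs≤ = zykov T G t₂ (U ∩ N G v) free″ #nbrs≤ (suc s)
  le′ : c T (suc (suc s)) (W - w) + suc (suc s) * c T (suc s) (W ∩ N T w) ≤
        c G (suc (suc s)) (U - v) + suc (suc s) * c G (suc s) (U ∩ N G v)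
  le′ = subst₂ _≤_ (c-remove T (suc s) W w w∈) (c-remove G (suc s) U v v∈) le
  c-nbrs≥ : c T (suc s) (W ∩ N T w) ≤ c G (suc s) (U ∩ N G v)
  c-nbrs≥ = *-cancelˡ-≤ (suc (suc s)) (+-cancelˡ-≤ (c T (suc (suc s)) (W - w)) _ _ (≤-trans le′
    (+-monoˡ-≤ (suc (suc s) * c G (suc s) (U ∩ N G v)) (zykov T G t₁ (U - v) free′ (≤-reflexive #U-v) (suc (suc s))))))
  #nbrs : # (U ∩ N G v) ≡ # (W ∩ N T w)
  #nbrs with m≤n⇒m<n∨m≡n #nbrs≤
  ... | inj₂ q = q
  ... | inj₁ q = contradiction c-nbrs≥ (<⇒≱ (zykov-strict T G t₂ s s≤r (degree-of-top T (suc s) s≤r s≤W e lt) (U ∩ N G v) free″ q))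

-- Isomorphism of balanced complete multipartite graphs

∑∈-strict : (U : Sub n) (f : Fin n → ℕ) (b : ℕ) (j : Fin n) → j ∈ U → (∀ i → f i ≤ b) → f j < b → ∑∈ U f < # U * b
∑∈-strict U f b j j∈ f≤b fj<b = begin-strict
  ∑∈ U f                 ≡⟨ ∑∈-remove U j f j∈ ⟩
  ∑∈ (U - j) f + f j     <⟨ +-mono-≤-< (∑∈≤#* (U - j) f b (λ i _ → f≤b i)) fj<b ⟩
  # (U - j) * b + b      ≡⟨ +-comm _ b ⟩
  suc (# (U - j)) * b    ≡⟨ cong (_* b) (#-remove U j j∈) ⟨
  # U * b                ∎
  where open ≤-Reasoning

strict-∑∈ : (U : Sub n) (f : Fin n → ℕ) (b : ℕ) (j : Fin n) → j ∈ U → (∀ i → b ≤ f i) → b < f j → # U * b < ∑∈ U f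
strict-∑∈ U f b j j∈ b≤f b<fj = begin-strict
  # U * b                ≡⟨ cong (_* b) (#-remove U j j∈) ⟩
  suc (# (U - j)) * b    ≡⟨ +-comm b _ ⟩
  # (U - j) * b + b      <⟨ +-mono-≤-< (#*≤∑∈ (U - j) f b (λ i _ → b≤f i)) b<fj ⟩
  ∑∈ (U - j) f + f j     ≡⟨ ∑∈-remove U j f j∈ ⟨
  ∑∈ U f                 ∎
  where open ≤-Reasoning

module _ {X : Set} (_≟X_ : DecidableEquality X) where

  fibre : (Fin n → X) → X → Sub n
  fibre f x i = ⌊ f i ≟X x ⌋

  ≟X-refl : ∀ x → ⌊ x ≟X x ⌋ ≡ true
  ≟X-refl x with x ≟X x
  ... | yes _ = refl
  ... | no ne = contradiction refl ne

  ≟X-true : ∀ {x y} → ⌊ x ≟X y ⌋ ≡ true → x ≡ y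
  ≟X-true {x} {y} e with x ≟X y
  ... | yes p = p

  -- `zero` is sent to any `j` in the matching fibre of `g`; deleting both lowers the same fibre by
  -- one on each side. It serves twice below: to match large classes with large classes, then
  -- vertices with vertices.
  equal-fibres⇒permutation : ∀ {n} (f g : Fin n → X) → (∀ x → # (fibre f x) ≡ # (fibre g x)) →
    Σ (Permutation n n) λ σ → ∀ i → g (σ ⟨$⟩ʳ i) ≡ f i
  equal-fibres⇒permutation {zero} f g h = Perm.id , λ ()
  equal-fibres⇒permutation {suc n} f g h
    with j , j∈ , _ ← ∑∈-positive (fibre g (f zero)) (λ _ → 1)
           (subst (0 <_) (h (f zero)) (∈⇒#-positive (fibre f (f zero)) {zero} (≟X-refl (f zero))))
    with σ , hσ ← equal-fibres⇒permutation (f ∘ suc) (g ∘ punchIn j) (λ x →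
           +-cancelˡ-≡ (⟦ fibre f x zero ⟧ * 1) _ _ (trans (h x) (trans (sum-remove {i = j} (λ i → ⟦ fibre g x i ⟧ * 1))
             (cong (λ y → ⟦ ⌊ y ≟X x ⌋ ⟧ * 1 + # (fibre (g ∘ punchIn j) x)) (≟X-true j∈)))))
    = insert zero j σ , λ { zero → ≟X-true j∈ ; (suc i) → trans (cong g (insert-punchIn zero j σ i)) (hσ i) }

module _ {r n : ℕ} .{{_ : NonZero r}} where

  -- A class below the rounded-down average would, by balance, hold all classes at or below it, with
  -- too small a total; dually above. Writing the size as a function of one Boolean makes it enough
  -- to match the Booleans.
  near-average : ∀ {G : Graph n} (B : Balanced G r full) → let size = λ i → # (full ∩ Balanced.class B i) in
    ∀ i → size i ≡ (n / r) + ⟦ ⌊ size i ≟ℕ suc (n / r) ⌋ ⟧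
  near-average {G} B i = go
    where
    open ≤-Reasoning
    size : Fin r → ℕ
    size i = # (full ∩ Balanced.class B i)
    total : ∑∈ (full {r}) size ≡ n
    total = trans (∑∈-classes full (Balanced.colour B) full) (#-full {n})
    [n/r]r≤n : r * (n / r) ≤ n
    [n/r]r≤n = subst₂ _≤_ (*-comm (n / r) r) (sym (m≡m%n+[m/n]*n n r)) (m≤n+m ((n / r) * r) (n % r))
    n≤r[1+n/r] : n ≤ r * suc (n / r)
    n≤r[1+n/r] = begin
      n                  ≡⟨ m≡m%n+[m/n]*n n r ⟩
      n % r + (n / r) * r      ≤⟨ +-monoˡ-≤ ((n / r) * r) (<⇒≤ (m%n<n n r)) ⟩
      r + (n / r) * r          ≡⟨ *-comm (suc (n / r)) r ⟩
      r * suc (n / r)          ∎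
    n/r≤size : (n / r) ≤ size i
    n/r≤size = ≮⇒≥ λ lt → contradiction [n/r]r≤n (<⇒≱ (begin-strict
      n                     ≡⟨ total ⟨
      ∑∈ (full {r}) size    <⟨ ∑∈-strict full size (n / r) i refl (λ j → ≤-trans (Balanced.balanced B j i) lt) lt ⟩
      # (full {r}) * (n / r)      ≡⟨ cong (_* (n / r)) (#-full {r}) ⟩
      r * (n / r)                 ∎))
    size≤1+n/r : size i ≤ suc (n / r)
    size≤1+n/r = ≮⇒≥ λ lt → contradiction n≤r[1+n/r] (<⇒≱ (begin-strict
      r * suc (n / r)             ≡⟨ cong (_* suc (n / r)) (#-full {r}) ⟨
      # (full {r}) * suc (n / r)  <⟨ strict-∑∈ full size (suc (n / r)) i refl (λ j → s≤s⁻¹ (≤-trans lt (Balanced.balanced B i j))) lt ⟩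
      ∑∈ (full {r}) size    ≡⟨ total ⟩
      n                     ∎))
    go : size i ≡ (n / r) + ⟦ ⌊ size i ≟ℕ suc (n / r) ⌋ ⟧
    go with size i ≟ℕ suc (n / r)
    ... | yes e = trans e (+-comm 1 (n / r))
    ... | no ne = trans (≤-antisym (s≤s⁻¹ (≤∧≢⇒< size≤1+n/r ne)) n/r≤size) (sym (+-identityʳ (n / r)))

  -- The number of large classes is determined by `n` and `r`. So some permutation `π` of the
  -- colours preserves class sizes, and then some permutation of the vertices realises `π`.
  Balanced⇒≅ : {G H : Graph n} → Balanced G r full → Balanced H r full → G ≅ H
  Balanced⇒≅ {G} {H} B B′ = σ , λ x y → begin
    adj G x y                                       ≡⟨ B.multipartite x y refl refl ⟩
    not ⌊ B.colour x ≟F B.colour y ⌋                 ≡⟨ cong not (π-≟ (B.colour x) (B.colour y)) ⟩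
    not ⌊ π ⟨$⟩ʳ B.colour x ≟F π ⟨$⟩ʳ B.colour y ⌋     ≡⟨ cong₂ (λ i j → not ⌊ i ≟F j ⌋) (hσ x) (hσ y) ⟨
    not ⌊ B′.colour (σ ⟨$⟩ʳ x) ≟F B′.colour (σ ⟨$⟩ʳ y) ⌋ ≡⟨ B′.multipartite (σ ⟨$⟩ʳ x) (σ ⟨$⟩ʳ y) refl refl ⟨
    adj H (σ ⟨$⟩ʳ x) (σ ⟨$⟩ʳ y) ∎
    where
    open ≡-Reasoning
    module B = Balanced B
    module B′ = Balanced B′
    size size′ : Fin r → ℕ
    size i = # (full ∩ B.class i)
    size′ i = # (full ∩ B′.class i)
    large large′ : Fin r → Bool
    large i = ⌊ size i ≟ℕ suc (n / r) ⌋
    large′ i = ⌊ size′ i ≟ℕ suc (n / r) ⌋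
    fibre-true : ∀ (h : Fin r → Bool) → # (fibre _≟_ h true) ≡ # h
    fibre-true h = #-cong λ i → pt (h i)
      where
      pt : ∀ b → ⌊ b ≟ true ⌋ ≡ b
      pt true = refl
      pt false = refl
    fibre-false : ∀ (h : Fin r → Bool) → # h + # (fibre _≟_ h false) ≡ r
    fibre-false h = begin
      # h + # (fibre _≟_ h false)     ≡⟨ cong (# h +_) (#-cong λ i → pt (h i)) ⟩
      # h + # (not ∘ h)               ≡⟨ #-split full h ⟨
      # (full {r})                    ≡⟨ #-full {r} ⟩
      r                               ∎
      where
      pt : ∀ b → ⌊ b ≟ false ⌋ ≡ not b
      pt true = refl
      pt false = refl
    #large : ∀ {K : Graph n} (C : Balanced K r full) →
      r * (n / r) + # (λ i → ⌊ # (full ∩ Balanced.class C i) ≟ℕ suc (n / r) ⌋) ≡ n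
    #large C = begin
      r * (n / r) + # (λ i → ⌊ # (full ∩ Balanced.class C i) ≟ℕ suc (n / r) ⌋)
        ≡⟨ cong₂ _+_ (trans (cong (_* (n / r)) (sym (#-full {r}))) (sym (∑∈-const (full {r}) (n / r))))
             (∑∈-∩ (full {r}) (λ i → ⌊ # (full ∩ Balanced.class C i) ≟ℕ suc (n / r) ⌋) (λ _ → 1)) ⟩
      ∑∈ (full {r}) (λ _ → (n / r)) + ∑∈ full (λ i → ⟦ ⌊ # (full ∩ Balanced.class C i) ≟ℕ suc (n / r) ⌋ ⟧ * 1)
        ≡⟨ ∑∈-+ (full {r}) (λ _ → (n / r)) (λ i → ⟦ ⌊ # (full ∩ Balanced.class C i) ≟ℕ suc (n / r) ⌋ ⟧ * 1) ⟨
      ∑∈ full (λ i → (n / r) + ⟦ ⌊ # (full ∩ Balanced.class C i) ≟ℕ suc (n / r) ⌋ ⟧ * 1)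
        ≡⟨ ∑∈-cong {U = full {r}} (λ _ → refl) (λ i _ → trans (cong ((n / r) +_) (*-identityʳ _)) (sym (near-average C i))) ⟩
      ∑∈ full (λ i → # (full ∩ Balanced.class C i))
        ≡⟨ trans (∑∈-classes full (Balanced.colour C) full) (#-full {n}) ⟩
      n ∎
    #large≡ : # large ≡ # large′
    #large≡ = +-cancelˡ-≡ (r * (n / r)) _ _ (trans (#large B) (sym (#large B′)))
    same-fibres : ∀ b → # (fibre _≟_ large b) ≡ # (fibre _≟_ large′ b)
    same-fibres true = trans (fibre-true large) (trans #large≡ (sym (fibre-true large′)))
    same-fibres false = +-cancelˡ-≡ (# large) _ _ (trans (fibre-false large)
      (trans (sym (fibre-false large′)) (cong (_+ # (fibre _≟_ large′ false)) (sym #large≡))))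
    colours = equal-fibres⇒permutation _≟_ large large′ same-fibres
    π = proj₁ colours
    size-π : ∀ i → size′ (π ⟨$⟩ʳ i) ≡ size i
    size-π i = trans (near-average B′ (π ⟨$⟩ʳ i))
      (trans (cong (λ b → (n / r) + ⟦ b ⟧) (proj₂ colours i)) (sym (near-average B i)))
    π-≟ : ∀ i j → ⌊ i ≟F j ⌋ ≡ ⌊ π ⟨$⟩ʳ i ≟F π ⟨$⟩ʳ j ⌋
    π-≟ i j = bool-ext (λ e → subst (λ k → ⌊ π ⟨$⟩ʳ i ≟F π ⟨$⟩ʳ k ⌋ ≡ true) (≟-true e) (≟-refl _))
      (λ e → subst (λ k → ⌊ i ≟F k ⌋ ≡ true)
        (trans (sym (Perm.inverseˡ π)) (trans (cong (π ⟨$⟩ˡ_) (≟-true e)) (Perm.inverseˡ π))) (≟-refl i))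
    vertices = equal-fibres⇒permutation _≟F_ (λ x → π ⟨$⟩ʳ B.colour x) B′.colour λ i → begin
      # (λ x → ⌊ π ⟨$⟩ʳ B.colour x ≟F i ⌋)
        ≡⟨ #-cong (λ x → trans (cong (λ k → ⌊ π ⟨$⟩ʳ B.colour x ≟F k ⌋) (sym (Perm.inverseʳ π)))
             (sym (π-≟ (B.colour x) (π ⟨$⟩ˡ i)))) ⟩
      size (π ⟨$⟩ˡ i)                 ≡⟨ size-π (π ⟨$⟩ˡ i) ⟨
      size′ (π ⟨$⟩ʳ (π ⟨$⟩ˡ i))        ≡⟨ cong size′ (Perm.inverseʳ π) ⟩
      size′ i                        ∎
    σ = proj₁ vertices
    hσ = proj₂ vertices

-- Turán graphs

TuránLike-cong : ∀ {m} (T : Graph m) {r W W′} → W ≐ W′ → TuránLike T r W → TuránLike T r W′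
TuránLike-cong T h (empty e) = empty (trans (sym (#-cong h)) e)
TuránLike-cong T h (step w b w∈ e lt t₁ t₂) = step w b (trans (sym (h w)) w∈)
  (trans (sym (#-cong h)) (trans e (cong (suc b +_) (#-cong λ x → cong (_∧ N T w x) (h x)))))
  (subst (_ <_) (#-cong h) lt)
  (TuránLike-cong T (λ x → cong (_∧ not ⌊ x ≟F w ⌋) (h x)) t₁)
  (TuránLike-cong T (λ x → cong (_∧ N T w x) (h x)) t₂)

module _ (r : ℕ) .{{_ : NonZero r}} (n : ℕ) where

  residue : Fin n → Fin r
  residue x = fromℕ< (m%n<n (toℕ x) r)

  toℕ-residue : ∀ x → toℕ (residue x) ≡ toℕ x % r
  toℕ-residue x = toℕ-fromℕ< (m%n<n (toℕ x) r)

  turán-multipartite : ∀ x y → adj (turán r n) x y ≡ not ⌊ residue x ≟F residue y ⌋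
  turán-multipartite x y with toℕ x % r ≟ℕ toℕ y % r | residue x ≟F residue y
  ... | yes _ | yes _ = refl
  ... | no _ | no _ = refl
  ... | yes p | no q = contradiction (toℕ-injective (trans (toℕ-residue x) (trans p (sym (toℕ-residue y))))) q
  ... | no p | yes q = contradiction (trans (sym (toℕ-residue x)) (trans (cong toℕ q) (toℕ-residue y))) p

  below : ℕ → Sub n
  below m x = ⌊ toℕ x <? m ⌋

  ∈below : ∀ m {x} → toℕ x < m → x ∈ below m
  ∈below m {x} lt with toℕ x <? m
  ... | yes _ = refl
  ... | no ¬lt = contradiction lt ¬lt

  below⇒< : ∀ m {x} → x ∈ below m → toℕ x < m
  below⇒< m {x} e with toℕ x <? m
  ... | yes lt = lt

  below-full : below n ≐ full
  below-full x = ∈below n (toℕ<n x)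

  #below-0 : # (below 0) ≡ 0
  #below-0 = n≤0⇒n≡0 (≮⇒≥ λ p → let x , x∈ , _ = ∑∈-positive (below 0) (λ _ → 1) p in contradiction (below⇒< 0 {x} x∈) λ ())

  residue-class : Fin r → Sub n
  residue-class i x = ⌊ residue x ≟F i ⌋

  size : ℕ → Fin r → ℕ
  size m i = # (below m ∩ residue-class i)

  module _ {m : ℕ} (m<n : m < n) where

    top : Fin n
    top = fromℕ< m<n

    top∈ : top ∈ below (suc m)
    top∈ = ∈below (suc m) (s≤s (≤-reflexive (toℕ-fromℕ< m<n)))

    below-top : below (suc m) - top ≐ below m
    below-top x = bool-ext
      (λ e → ∈below m (≤∧≢⇒< (s≤s⁻¹ (below⇒< (suc m) (remove-⊆ (below (suc m)) top x e)))
        λ q → ∈-remove-≢ (below (suc m)) e (toℕ-injective (trans q (sym (toℕ-fromℕ< m<n))))))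
      (λ e → ∈-remove (below (suc m)) (∈below (suc m) (m<n⇒m<1+n (below⇒< m e)))
        λ q → <-irrefl (trans (cong toℕ q) (toℕ-fromℕ< m<n)) (below⇒< m e))

    #below-suc : # (below (suc m)) ≡ suc (# (below m))
    #below-suc = trans (#-remove (below (suc m)) top top∈) (cong suc (#-cong below-top))

    size-suc : ∀ i → size (suc m) i ≡ size m i + ⟦ ⌊ residue top ≟F i ⌋ ⟧
    size-suc i with residue top ≟F i
    ... | yes refl = trans (#-remove (below (suc m) ∩ residue-class i) top (∧-true top∈ (≟-refl (residue top))))
          (trans (cong suc (#-cong same)) (+-comm 1 _))
      where
      same : (below (suc m) ∩ residue-class i) - top ≐ below m ∩ residue-class i
      same x = trans (remove-∩ (below (suc m)) top (residue-class i) x) (cong (_∧ residue-class i x) (below-top x))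
    ... | no ne = trans (#-cong same) (sym (+-identityʳ _))
      where
      same : below (suc m) ∩ residue-class i ≐ below m ∩ residue-class i
      same x = trans (∉-remove (below (suc m) ∩ residue-class i) top (trans (cong (below (suc m) top ∧_) (≟-false ne)) (∧-zeroʳ _)) x)
        (trans (remove-∩ (below (suc m)) top (residue-class i) x) (cong (_∧ residue-class i x) (below-top x)))

  #below : ∀ m → m ≤ n → # (below m) ≡ m
  #below zero _ = #below-0
  #below (suc m) m<n = trans (#below-suc m<n) (cong suc (#below m (<⇒≤ m<n)))

  <?-suc : ∀ i j → ⟦ ⌊ i <? suc j ⌋ ⟧ ≡ ⟦ ⌊ i <? j ⌋ ⟧ + ⟦ ⌊ j ≟ℕ i ⌋ ⟧
  <?-suc i j with i <? suc j | i <? j | j ≟ℕ i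
  ... | yes _ | yes lt | yes refl = contradiction lt (<-irrefl refl)
  ... | yes _ | yes _ | no _ = refl
  ... | yes _ | no _ | yes _ = refl
  ... | yes (s≤s le) | no ¬lt | no ne = contradiction (≤∧≢⇒< le (ne ∘ sym)) ¬lt
  ... | no ¬lt | yes lt | _ = contradiction (m<n⇒m<1+n lt) ¬lt
  ... | no ¬lt | no _ | yes refl = contradiction (n<1+n i) ¬lt
  ... | no _ | no _ | no _ = refl

  -- The vertices come in blocks of `r` consecutive residues. Allowing `j` to equal `r` identifies a
  -- completed block with the start of the next one.
  size≡ : ∀ q j → j ≤ r → q * r + j ≤ n → ∀ i → size (q * r + j) i ≡ q + ⟦ ⌊ toℕ i <? j ⌋ ⟧
  size≡ zero zero _ _ i = n≤0⇒n≡0 (≤-trans (#-mono {U = below 0 ∩ residue-class i} {below 0} (λ x ())) (≤-reflexive #below-0))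
  size≡ (suc q) zero _ le i = trans (cong (λ m → size m i) shift) (trans (size≡ q r ≤-refl (subst (_≤ n) shift le) i) last)
    where
    shift : suc q * r + 0 ≡ q * r + r
    shift = trans (+-identityʳ (suc q * r)) (+-comm r (q * r))
    last : q + ⟦ ⌊ toℕ i <? r ⌋ ⟧ ≡ suc q + 0
    last with toℕ i <? r
    ... | yes _ = trans (+-comm q 1) (sym (+-identityʳ (suc q)))
    ... | no ¬lt = contradiction (toℕ<n i) ¬lt
  size≡ q (suc j) j<r le i rewrite +-suc (q * r) j = begin
    size (suc (q * r + j)) i
      ≡⟨ size-suc le i ⟩
    size (q * r + j) i + ⟦ ⌊ residue (top le) ≟F i ⌋ ⟧
      ≡⟨ cong₂ _+_ (size≡ q j (<⇒≤ j<r) (<⇒≤ le) i) (cong ⟦_⟧ same) ⟩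
    q + ⟦ ⌊ toℕ i <? j ⌋ ⟧ + ⟦ ⌊ j ≟ℕ toℕ i ⌋ ⟧
      ≡⟨ trans (+-assoc q _ _) (cong (q +_) (sym (<?-suc (toℕ i) j))) ⟩
    q + ⟦ ⌊ toℕ i <? suc j ⌋ ⟧ ∎
    where
    open ≡-Reasoning
    toℕ-top : toℕ (residue (top le)) ≡ j
    toℕ-top = trans (toℕ-residue (top le)) (trans (cong (_% r) (trans (toℕ-fromℕ< le) (+-comm (q * r) j)))
      (trans ([m+kn]%n≡m%n j q r) (m<n⇒m%n≡m j<r)))
    same : ⌊ residue (top le) ≟F i ⌋ ≡ ⌊ j ≟ℕ toℕ i ⌋
    same with residue (top le) ≟F i | j ≟ℕ toℕ i
    ... | yes _ | yes _ = refl
    ... | no _ | no _ = refl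
    ... | yes refl | no ne = contradiction (sym toℕ-top) ne
    ... | no ne | yes e = contradiction (toℕ-injective (trans toℕ-top e)) ne

  size≡/ : ∀ m → m ≤ n → ∀ i → size m i ≡ m / r + ⟦ ⌊ toℕ i <? m % r ⌋ ⟧
  size≡/ m m≤n i = trans (cong (λ k → size k i) m≡)
    (size≡ (m / r) (m % r) (<⇒≤ (m%n<n m r)) (subst (_≤ n) m≡ m≤n) i)
    where
    m≡ : m ≡ m / r * r + m % r
    m≡ = trans (m≡m%n+[m/n]*n m r) (+-comm (m % r) _)

  ⟦⟧≤1 : ∀ b → ⟦ b ⟧ ≤ 1
  ⟦⟧≤1 true = ≤-refl
  ⟦⟧≤1 false = z≤n

  size-balanced : ∀ m → m ≤ n → ∀ i j → size m i ≤ suc (size m j)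
  size-balanced m m≤n i j = begin
    size m i                                  ≡⟨ size≡/ m m≤n i ⟩
    m / r + ⟦ ⌊ toℕ i <? m % r ⌋ ⟧              ≤⟨ +-monoʳ-≤ (m / r) (⟦⟧≤1 _) ⟩
    m / r + 1                                 ≡⟨ +-comm (m / r) 1 ⟩
    suc (m / r)                               ≤⟨ s≤s (m≤m+n (m / r) _) ⟩
    suc (m / r + ⟦ ⌊ toℕ j <? m % r ⌋ ⟧)        ≡⟨ cong suc (size≡/ m m≤n j) ⟨
    suc (size m j)                            ∎
    where open ≤-Reasoning

  -- The next vertex has residue `m % r`, the first residue not yet met in the current block. This
  -- yields the inequality on `b` that `TuránLike` demands.
  size-minimum : ∀ {m} (m<n : m < n) i → size m (residue (top m<n)) ≤ size m i
  size-minimum {m} m<n i = begin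
    size m (residue (top m<n))                          ≡⟨ size≡/ m (<⇒≤ m<n) _ ⟩
    m / r + ⟦ ⌊ toℕ (residue (top m<n)) <? m % r ⌋ ⟧      ≡⟨ cong (λ b → m / r + ⟦ b ⟧) none ⟩
    m / r + 0                                           ≤⟨ +-monoʳ-≤ (m / r) z≤n ⟩
    m / r + ⟦ ⌊ toℕ i <? m % r ⌋ ⟧                        ≡⟨ size≡/ m (<⇒≤ m<n) i ⟨
    size m i                                            ∎
    where
    open ≤-Reasoning
    none : ⌊ toℕ (residue (top m<n)) <? m % r ⌋ ≡ false
    none with toℕ (residue (top m<n)) <? m % r
    ... | yes lt = contradiction lt (<-irrefl (trans (toℕ-residue (top m<n)) (cong (_% r) (toℕ-fromℕ< m<n))))
    ... | no _ = refl

  turán-Balanced : Balanced (turán r n) r full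
  turán-Balanced = record
    { colour = residue
    ; multipartite = λ x y _ _ → turán-multipartite x y
    ; balanced = λ i j → subst₂ (λ a b → a ≤ suc b) (full-size i) (full-size j) (size-balanced n ≤-refl i j) }
    where
    full-size : ∀ i → size n i ≡ # (full ∩ residue-class i)
    full-size i = #-cong λ x → cong (_∧ residue-class i x) (below-full x)

  -- Initial segments restricted to a set `C` of residues form a closed family: removing the top
  -- vertex shortens the segment, passing to its neighbourhood removes its residue from `C`. A top
  -- vertex with residue outside `C` changes nothing.
  turán-TuránLike : ∀ m → m ≤ n → ∀ (C : Sub r) k → # C ≡ k → TuránLike (turán r n) k (below m ∩ (C ∘ residue))
  turán-TuránLike zero _ C k _ = empty (n≤0⇒n≡0 (≤-trans (#-mono {U = below 0 ∩ (C ∘ residue)} {below 0} (λ x ())) (≤-reflexive #below-0)))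
  turán-TuránLike (suc m) m<n C k #C = go (C i) refl k #C
    where
    w = top m<n
    i = residue w
    below-∩ : ∀ P → (below (suc m) ∩ P) - w ≐ below m ∩ P
    below-∩ P x = trans (remove-∩ (below (suc m)) w P x) (cong (_∧ P x) (below-top m<n x))
    go : ∀ b → C i ≡ b → ∀ k → # C ≡ k → TuránLike (turán r n) k (below (suc m) ∩ (C ∘ residue))
    go false i∉ k #C = TuránLike-cong (turán r n)
      (λ x → sym (trans (∉-remove (below (suc m) ∩ (C ∘ residue)) w (trans (cong (below (suc m) w ∧_) i∉) (∧-zeroʳ _)) x) (below-∩ (C ∘ residue) x)))
      (turán-TuránLike m (<⇒≤ m<n) C k #C)
    go true i∈ zero #C = contradiction (subst (0 <_) #C (∈⇒#-positive C i∈)) λ ()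
    go true i∈ (suc k) #C = step w (size m i) w∈ #W lt
      (TuránLike-cong (turán r n) (λ x → sym (below-∩ (C ∘ residue) x)) (turán-TuránLike m (<⇒≤ m<n) C (suc k) #C))
      (TuránLike-cong (turán r n) (λ x → sym (neighbours x)) (turán-TuránLike m (<⇒≤ m<n) (C - i) k
        (suc-injectiveℕ (trans (sym (#-remove C i i∈)) #C))))
      where
      W = below (suc m) ∩ (C ∘ residue)
      W′ = below m ∩ (C ∘ residue)
      w∈ : w ∈ W
      w∈ = ∧-true (top∈ m<n) i∈
      #W′ : # W ≡ suc (# W′)
      #W′ = trans (#-remove W w w∈) (cong suc (#-cong (below-∩ (C ∘ residue))))
      neighbours : W ∩ N (turán r n) w ≐ below m ∩ ((C - i) ∘ residue)
      neighbours x = begin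
        W x ∧ adj (turán r n) w x
          ≡⟨ ∉-remove (W ∩ N (turán r n) w) w (trans (cong (W w ∧_) (adj-irrefl (turán r n) w)) (∧-zeroʳ (W w))) x ⟩
        ((W ∩ N (turán r n) w) - w) x
          ≡⟨ trans (remove-∩ W w (N (turán r n) w) x) (cong (_∧ adj (turán r n) w x) (below-∩ (C ∘ residue) x)) ⟩
        (below m x ∧ C (residue x)) ∧ adj (turán r n) w x
          ≡⟨ cong ((below m x ∧ C (residue x)) ∧_) (trans (turán-multipartite w x) (cong not (≟-sym i (residue x)))) ⟩
        (below m x ∧ C (residue x)) ∧ not ⌊ residue x ≟F i ⌋
          ≡⟨ ∧-assoc (below m x) _ _ ⟩
        below m x ∧ (C (residue x) ∧ not ⌊ residue x ≟F i ⌋) ∎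
        where open ≡-Reasoning
      W′-class : W′ ∩ residue-class i ≐ below m ∩ residue-class i
      W′-class x with residue x ≟F i
      ... | yes e rewrite trans (cong C e) i∈ | ∧-identityʳ (below m x) | ∧-identityʳ (below m x) = refl
      ... | no _ = trans (∧-zeroʳ (W′ x)) (sym (∧-zeroʳ (below m x)))
      W′-rest : W′ ∩ (not ∘ residue-class i) ≐ W ∩ N (turán r n) w
      W′-rest x = trans (∧-assoc (below m x) _ _) (sym (neighbours x))
      #W : # W ≡ suc (size m i) + # (W ∩ N (turán r n) w)
      #W = trans #W′ (cong suc (trans (#-split W′ (residue-class i)) (cong₂ _+_ (#-cong W′-class) (#-cong W′-rest))))
      lt : suc k * size m i < # W
      lt = begin-strict
        suc k * size m i                     ≡⟨ cong (_* size m i) #C ⟨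
        # C * size m i                       ≤⟨ #*≤∑∈ C (size m) (size m i) (λ j _ → size-minimum m<n j) ⟩
        ∑∈ C (size m)                        ≡⟨ ∑∈-classes (below m) residue C ⟩
        # W′                                 <⟨ n<1+n _ ⟩
        suc (# W′)                           ≡⟨ #W′ ⟨
        # W                                  ∎
        where open ≤-Reasoning

  below-TuránLike : ∀ m → m ≤ n → TuránLike (turán r n) r (below m)
  below-TuránLike m m≤n = TuránLike-cong (turán r n) (λ x → ∧-identityʳ (below m x))
    (turán-TuránLike m m≤n full r (#-full {r}))

  nonneighbours≡size : ∀ m x → # (below m ∩ (not ∘ N (turán r n) x)) ≡ size m (residue x)
  nonneighbours≡size m x = #-cong λ y → cong (below m y ∧_)
    (trans (cong not (trans (turán-multipartite x y) (cong not (≟-sym (residue x) (residue y))))) (not-involutive _))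

-- Edges of a clique with many common neighbours

module _ (G : Graph n) where

  data Clique : Sub n → List (Fin n) → Set where
    [] : ∀ {U} → Clique U []
    _∷_ : ∀ {U v vs} → v ∈ U → Clique (U ∩ N G v) vs → Clique U (v ∷ vs)

  c-positive⇒Clique : ∀ t U → 0 < c G t U → ∃ λ vs → length vs ≡ t × Clique U vs
  c-positive⇒Clique zero U _ = [] , refl , []
  c-positive⇒Clique (suc t) U p
    with v , v∈ , q ← ∑∈-positive U (λ v → c G t (U ∩ N G v)) p
    with vs , e , K ← c-positive⇒Clique t (U ∩ N G v) q = v ∷ vs , cong suc e , v∈ ∷ K

  degreeTo pairsTo : List (Fin n) → Fin n → ℕ
  degreeTo [] x = 0
  degreeTo (v ∷ vs) x = ⟦ adj G v x ⟧ * 1 + degreeTo vs x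
  pairsTo [] x = 0
  pairsTo (v ∷ vs) x = ⟦ adj G v x ⟧ * degreeTo vs x + pairsTo vs x

  ∑-degreeTo : ∀ W v vs → ∑∈ W (degreeTo (v ∷ vs)) ≡ # (W ∩ N G v) + ∑∈ W (degreeTo vs)
  ∑-degreeTo W v vs = trans (∑∈-+ W (λ x → ⟦ adj G v x ⟧ * 1) (degreeTo vs))
    (cong (_+ ∑∈ W (degreeTo vs)) (sym (∑∈-∩ W (N G v) (λ _ → 1))))

  ∑-nil : ∀ (W : Sub n) → ∑∈ W (λ _ → 0) ≡ 0
  ∑-nil W = trans (∑∈-const W 0) (*-zeroʳ (# W))

  ∑-degreeTo≥ : ∀ {W b D} → (∀ v → v ∈ W → b ≤ # (W ∩ N G v) + D) →
    ∀ {U vs} → U ⊆ W → Clique U vs → length vs * b ≤ ∑∈ W (degreeTo vs) + length vs * D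
  ∑-degreeTo≥ h U⊆W [] = z≤n
  ∑-degreeTo≥ {W} {b} {D} h {vs = v ∷ vs} U⊆W (v∈ ∷ K) = begin
    b + length vs * b
      ≤⟨ +-mono-≤ (h v (U⊆W v v∈)) (∑-degreeTo≥ h (λ x p → U⊆W x (∧-trueˡ p)) K) ⟩
    # (W ∩ N G v) + D + (∑∈ W (degreeTo vs) + length vs * D)
      ≡⟨ lin (# (W ∩ N G v)) D (∑∈ W (degreeTo vs)) (length vs * D) ⟩
    # (W ∩ N G v) + ∑∈ W (degreeTo vs) + (D + length vs * D)
      ≡⟨ cong (_+ (D + length vs * D)) (∑-degreeTo W v vs) ⟨
    ∑∈ W (degreeTo (v ∷ vs)) + (D + length vs * D) ∎
    where
    open ≤-Reasoning
    lin : ∀ x d y e → x + d + (y + e) ≡ x + y + (d + e)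
    lin = solve-∀

  ∑-degreeTo≤ : ∀ {W B U vs} → (∀ v → v ∈ U → # (W ∩ N G v) ≤ B) → Clique U vs →
    ∑∈ W (degreeTo vs) ≤ length vs * B
  ∑-degreeTo≤ {W} h [] = ≤-reflexive (∑-nil W)
  ∑-degreeTo≤ {W} {vs = v ∷ vs} h (v∈ ∷ K) = subst (_≤ _) (sym (∑-degreeTo W v vs))
    (+-mono-≤ (h v v∈) (∑-degreeTo≤ {W} (λ u u∈ → h u (∧-trueˡ u∈)) K))

  triangular : ℕ → ℕ
  triangular zero = 0
  triangular (suc k) = k + triangular k

  2*triangular : ∀ k → 2 * triangular (suc k) ≡ suc k * k
  2*triangular zero = refl
  2*triangular (suc k) = trans (*-distribˡ-+ 2 (suc k) (triangular (suc k)))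
    (trans (cong (2 * suc k +_) (2*triangular k)) (lin k))
    where
    lin : ∀ k → 2 * suc k + suc k * k ≡ suc (suc k) * suc k
    lin = solve-∀

  ∑-pairsTo≤ : ∀ {W B} → (∀ u v → u ∈ W → v ∈ W → adj G u v ≡ true → # (W ∩ N G u ∩ N G v) ≤ B) →
    ∀ {U vs} → U ⊆ W → Clique U vs → ∑∈ W (pairsTo vs) ≤ triangular (length vs) * B
  ∑-pairsTo≤ {W} h U⊆W [] = ≤-reflexive (∑-nil W)
  ∑-pairsTo≤ {W} {B} h {U} {v ∷ vs} U⊆W (v∈ ∷ K) = begin
    ∑∈ W (pairsTo (v ∷ vs))
      ≡⟨ ∑∈-+ W (λ x → ⟦ adj G v x ⟧ * degreeTo vs x) (pairsTo vs) ⟩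
    ∑∈ W (λ x → ⟦ adj G v x ⟧ * degreeTo vs x) + ∑∈ W (pairsTo vs)
      ≡⟨ cong (_+ ∑∈ W (pairsTo vs)) (∑∈-∩ W (N G v) (degreeTo vs)) ⟨
    ∑∈ (W ∩ N G v) (degreeTo vs) + ∑∈ W (pairsTo vs)
      ≤⟨ +-mono-≤ (∑-degreeTo≤ {W ∩ N G v} (λ u u∈ → h v u (U⊆W v v∈) (U⊆W u (∧-trueˡ u∈)) (∧-trueʳ {U u} u∈)) K)
           (∑-pairsTo≤ h (λ x p → U⊆W x (∧-trueˡ p)) K) ⟩
    length vs * B + triangular (length vs) * B
      ≡⟨ *-distribʳ-+ B (length vs) _ ⟨
    triangular (length (v ∷ vs)) * B ∎
    where open ≤-Reasoning

  2*pairsTo : ∀ vs x → 2 * pairsTo vs x + degreeTo vs x ≡ degreeTo vs x * degreeTo vs x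
  2*pairsTo [] x = refl
  2*pairsTo (v ∷ vs) x with adj G v x
  ... | false = 2*pairsTo vs x
  ... | true = trans (lin₁ (degreeTo vs x) (pairsTo vs x)) (trans (cong (λ k → k + suc (2 * degreeTo vs x)) (2*pairsTo vs x))
        (lin₂ (degreeTo vs x)))
    where
    lin₁ : ∀ d p → 2 * (1 * d + p) + (1 + d) ≡ (2 * p + d) + suc (2 * d)
    lin₁ = solve-∀
    lin₂ : ∀ d → d * d + suc (2 * d) ≡ (1 + d) * (1 + d)
    lin₂ = solve-∀

  -- (d − p)(d − p − 1) ≥ 0 for all naturals d and p.
  convex : ∀ p d → (2 * p + 1) * d ≤ d * d + suc p * p
  convex p d with ≤-<-connex d p
  ... | inj₁ le with e , refl ← m≤n⇒∃[o]m+o≡n le = ≤-trans (m≤m+n _ (e * e + e)) (≤-reflexive (eq d e))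
    where
    eq : ∀ d e → (2 * (d + e) + 1) * d + (e * e + e) ≡ d * d + suc (d + e) * (d + e)
    eq = solve-∀
  ... | inj₂ lt with e , refl ← m≤n⇒∃[o]m+o≡n lt = ≤-trans (m≤m+n _ (e * e + e)) (≤-reflexive (eq p e))
    where
    eq : ∀ p e → (2 * p + 1) * (suc p + e) + (e * e + e) ≡ (suc p + e) * (suc p + e) + suc p * p
    eq = solve-∀

  -- Fix a clique on p+2 vertices and let d be the number of its vertices adjacent to x. The number
  -- of pairs, d(d-1)/2, lies above the chord through d = p and d = p+1; this is summed over all x
  -- in `U`. With p = r-1 the average of d in a balanced r-partite graph would be about r - 1/r,
  -- between these two points, so little is lost.
  codegree-average : ∀ p U D B → (∀ v → v ∈ U → # U ≤ # (U ∩ N G v) + D) →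
    (∀ u v → u ∈ U → v ∈ U → adj G u v ≡ true → # (U ∩ N G u ∩ N G v) ≤ B) →
    0 < c G (suc (suc p)) U →
    2 * p * (suc (suc p) * # U) ≤
      suc (suc p) * suc p * B + suc p * p * # U + 2 * p * (suc (suc p) * D)
  codegree-average p U D B deg codeg pos with vs , len , K ← c-positive⇒Clique (suc (suc p)) U pos = begin
    2 * p * (suc (suc p) * # U)
      ≤⟨ *-monoʳ-≤ (2 * p) (subst (λ k → k * # U ≤ ∑d + k * D) len (∑-degreeTo≥ deg (λ _ q → q) K)) ⟩
    2 * p * (∑d + suc (suc p) * D)
      ≡⟨ *-distribˡ-+ (2 * p) ∑d _ ⟩
    2 * p * ∑d + 2 * p * (suc (suc p) * D)
      ≤⟨ +-monoˡ-≤ _ (begin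
        2 * p * ∑d
          ≡⟨ ∑∈-*ˡ U (2 * p) (degreeTo vs) ⟨
        ∑∈ U (λ x → 2 * p * degreeTo vs x)
          ≤⟨ ∑∈-mono {U = U} (λ _ q → q) (λ x _ → pointwise x) ⟩
        ∑∈ U (λ x → 2 * pairsTo vs x + suc p * p)
          ≡⟨ ∑∈-+ U (λ x → 2 * pairsTo vs x) (λ _ → suc p * p) ⟩
        ∑∈ U (λ x → 2 * pairsTo vs x) + ∑∈ U (λ _ → suc p * p)
          ≡⟨ cong₂ _+_ (∑∈-*ˡ U 2 (pairsTo vs)) (trans (∑∈-const U (suc p * p)) (*-comm (# U) (suc p * p))) ⟩
        2 * ∑∈ U (pairsTo vs) + suc p * p * # U
          ≤⟨ +-monoˡ-≤ _ (*-monoʳ-≤ 2 (subst (λ k → ∑∈ U (pairsTo vs) ≤ triangular k * B) len (∑-pairsTo≤ codeg (λ _ q → q) K))) ⟩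
        2 * (triangular (suc (suc p)) * B) + suc p * p * # U
          ≡⟨ cong (_+ suc p * p * # U) (trans (sym (*-assoc 2 (triangular (suc (suc p))) B)) (cong (_* B) (2*triangular (suc p)))) ⟩
        suc (suc p) * suc p * B + suc p * p * # U ∎) ⟩
    suc (suc p) * suc p * B + suc p * p * # U + 2 * p * (suc (suc p) * D) ∎
    where
    open ≤-Reasoning
    ∑d = ∑∈ U (degreeTo vs)
    pointwise : ∀ x → 2 * p * degreeTo vs x ≤ 2 * pairsTo vs x + suc p * p
    pointwise x = +-cancelʳ-≤ d _ _ (begin
      2 * p * d + d                ≡⟨ lin₁ p d ⟩
      (2 * p + 1) * d              ≤⟨ convex p d ⟩
      d * d + suc p * p            ≡⟨ cong (_+ suc p * p) (2*pairsTo vs x) ⟨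
      2 * pairsTo vs x + d + suc p * p  ≡⟨ lin₂ (2 * pairsTo vs x) d (suc p * p) ⟩
      2 * pairsTo vs x + suc p * p + d  ∎)
      where
      d = degreeTo vs x
      lin₁ : ∀ p d → 2 * p * d + d ≡ (2 * p + 1) * d
      lin₁ = solve-∀
      lin₂ : ∀ a d b → a + d + b ≡ a + b + d
      lin₂ = solve-∀

-- Numerical estimates

Π-arithmetic : ∀ k E → Π k (λ i → (k ∸ i) * E) ≡ k ! * E ^ k
Π-arithmetic zero E = refl
Π-arithmetic (suc k) E = trans (Π-cons k (λ i → (suc k ∸ i) * E))
  (trans (cong (suc k * E *_) (Π-arithmetic k E)) (lin (suc k) E (k !) (E ^ k)))
  where
  lin : ∀ s e f x → s * e * (f * x) ≡ s * f * (e * x)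
  lin = solve-∀

-- Only the last factor needs the offset `y`; it is what makes the product, and so the number of
-- (k+1)-cliques in the dense alternative, positive.
Π-arithmetic≥ : ∀ k y E → k ! * E ^ k * y ≤ Π (suc k) (λ i → y + (k ∸ i) * E)
Π-arithmetic≥ k y E = *-mono-≤
  (≤-trans (≤-reflexive (sym (Π-arithmetic k E))) (Π-mono k λ i _ → m≤n+m _ y))
  (m≤m+n y _)

∸-suc : ∀ j e → suc (j + e) ∸ j ≡ suc e
∸-suc j e = trans (cong (_∸ j) (sym (+-suc j e))) (m+n∸m≡n j (suc e))

-- An arithmetic progression descending by `E` satisfies the recursion that `approximate-zykov`
-- expects.
arithmetic-rec : ∀ k y E j → j < k →
  suc j * (y + (k ∸ j) * E) ≡ (y + (k ∸ 0) * E) + j * (y + (k ∸ suc j) * E)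
arithmetic-rec k y E j j<k with e , refl ← m≤n⇒∃[o]m+o≡n j<k
  rewrite ∸-suc j e | m+n∸m≡n j e = lin j e y E
  where
  lin : ∀ j e y E → suc j * (y + suc e * E) ≡ (y + suc (j + e) * E) + j * (y + e * E)
  lin = solve-∀

2x≤y⇒x<y : ∀ {x y} → 2 * x ≤ y → 0 < y → x < y
2x≤y⇒x<y {x} {y} h 0<y = ≰⇒> λ y≤x → <⇒≱ 0<y (+-cancelˡ-≤ y y 0 (begin
  y + y  ≤⟨ +-mono-≤ y≤x y≤x ⟩
  x + x  ≡⟨ cong (x +_) (+-identityʳ x) ⟨
  2 * x  ≤⟨ h ⟩
  y      ≡⟨ +-identityʳ y ⟨
  y + 0  ∎))
  where open ≤-Reasoning

^-distribʳ-* : ∀ k x y → (x * y) ^ k ≡ x ^ k * y ^ k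
^-distribʳ-* zero x y = refl
^-distribʳ-* (suc k) x y = trans (cong (x * y *_) (^-distribʳ-* k x y)) (lin x y (x ^ k) (y ^ k))
  where
  lin : ∀ x y a b → x * y * (a * b) ≡ x * a * (y * b)
  lin = solve-∀

-- Abstract, since comparing terms by unfolding these powers is prohibitively expensive.
abstract
  pow⁴ : ℕ → ℕ
  pow⁴ r = r * r * (r * r)

  pow⁴≡ : ∀ r → pow⁴ r ≡ r * r * (r * r)
  pow⁴≡ r = refl

16≤pow⁴ : ∀ ρ → 16 ≤ pow⁴ (suc (suc ρ))
16≤pow⁴ ρ rewrite pow⁴≡ (suc (suc ρ)) = *-mono-≤ (*-mono-≤ 2≤r 2≤r) (*-mono-≤ 2≤r 2≤r)
  where
  2≤r : 2 ≤ suc (suc ρ)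
  2≤r = s≤s (s≤s z≤n)

instance
  pow⁴-nonZero : ∀ {ρ} → NonZero (pow⁴ (suc (suc ρ)))
  pow⁴-nonZero {ρ} = >-nonZero (≤-trans (s≤s z≤n) (16≤pow⁴ ρ))

pow⁵ pow⁶ : ℕ → ℕ
pow⁵ r = r * pow⁴ r
pow⁶ r = r * pow⁵ r

-- `Z` is one more than the quotient of n by 6r^5. For quotients from 2 on the lower bound is
-- automatic; for 0 and 1 it follows from n > r^8 >= 8r^5. A `Z` below r-1 would give n at most r^8.
scale : ∀ ρ n → suc (suc ρ) ^ 8 < n → ∃ λ Z →
  4 * (pow⁵ (2+ ρ) * Z) ≤ n × n < 6 * (pow⁵ (2+ ρ) * Z) × suc ρ ≤ Z
scale ρ n r⁸<n = suc z , lower , upper , ≮⇒≥ small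
  where
  open ≤-Reasoning
  instance
    nonZero : NonZero (6 * pow⁵ (2+ ρ))
    nonZero = m*n≢0 6 (pow⁵ (2+ ρ)) {{_}} {{m*n≢0 (2+ ρ) (pow⁴ (2+ ρ))}}
  z = n / (6 * pow⁵ (2+ ρ))
  n≡ : n ≡ n % (6 * pow⁵ (2+ ρ)) + z * (6 * pow⁵ (2+ ρ))
  n≡ = m≡m%n+[m/n]*n n (6 * pow⁵ (2+ ρ))
  lin₁ : ∀ R z → 6 * R + z * (6 * R) ≡ 6 * (R * suc z)
  lin₁ = solve-∀
  upper : n < 6 * (pow⁵ (2+ ρ) * suc z)
  upper = begin-strict
    n                                              ≡⟨ n≡ ⟩
    n % (6 * pow⁵ (2+ ρ)) + z * (6 * pow⁵ (2+ ρ))  <⟨ +-monoˡ-< (z * (6 * pow⁵ (2+ ρ))) (m%n<n n (6 * pow⁵ (2+ ρ))) ⟩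
    6 * pow⁵ (2+ ρ) + z * (6 * pow⁵ (2+ ρ))        ≡⟨ lin₁ (pow⁵ (2+ ρ)) z ⟩
    6 * (pow⁵ (2+ ρ) * suc z)                      ∎
  pow⁸ : ∀ x → x ^ 8 ≡ pow⁵ x * (x * x * x)
  pow⁸ x rewrite pow⁴≡ x = lin x
    where
    lin : ∀ x → x * (x * (x * (x * (x * (x * (x * (x * 1))))))) ≡ x * (x * x * (x * x)) * (x * x * x)
    lin = solve-∀
  small : ¬ (suc z < suc ρ)
  small lt = <⇒≱ r⁸<n (begin
    n                                         ≤⟨ <⇒≤ upper ⟩
    6 * (pow⁵ (2+ ρ) * suc z)                 ≡⟨ lin₂ (pow⁵ (2+ ρ)) (suc z) ⟩
    pow⁵ (2+ ρ) * (6 * suc z)                 ≤⟨ *-monoʳ-≤ (pow⁵ (2+ ρ)) (cube (<⇒≤ lt)) ⟩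
    pow⁵ (2+ ρ) * ((2+ ρ) * (2+ ρ) * (2+ ρ))  ≡⟨ pow⁸ (2+ ρ) ⟨
    (2+ ρ) ^ 8                                ∎)
    where
    lin₂ : ∀ R z → 6 * (R * z) ≡ R * (6 * z)
    lin₂ = solve-∀
    cube : suc z ≤ suc ρ → 6 * suc z ≤ (2+ ρ) * (2+ ρ) * (2+ ρ)
    cube le = ≤-trans (*-monoʳ-≤ 6 le) (≤-trans (m≤m+n _ (ρ * ρ * ρ + 6 * (ρ * ρ) + 6 * ρ + 2)) (≤-reflexive (lin₃ ρ)))
      where
      lin₃ : ∀ ρ → 6 * suc ρ + (ρ * ρ * ρ + 6 * (ρ * ρ) + 6 * ρ + 2) ≡ suc (suc ρ) * suc (suc ρ) * suc (suc ρ)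
      lin₃ = solve-∀
  base : ∀ k → k ≤ 2 → 4 * (pow⁵ (2+ ρ) * k) ≤ (2+ ρ) ^ 8
  base k k≤2 = begin
    4 * (pow⁵ (2+ ρ) * k)                     ≤⟨ *-monoʳ-≤ 4 (*-monoʳ-≤ (pow⁵ (2+ ρ)) k≤2) ⟩
    4 * (pow⁵ (2+ ρ) * 2)                     ≡⟨ lin₂ (pow⁵ (2+ ρ)) ⟩
    pow⁵ (2+ ρ) * 8                           ≤⟨ *-monoʳ-≤ (pow⁵ (2+ ρ)) (*-mono-≤ (*-mono-≤ 2≤r 2≤r) 2≤r) ⟩
    pow⁵ (2+ ρ) * ((2+ ρ) * (2+ ρ) * (2+ ρ))  ≡⟨ pow⁸ (2+ ρ) ⟨
    (2+ ρ) ^ 8                                ∎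
    where
    2≤r : 2 ≤ (2+ ρ)
    2≤r = s≤s (s≤s z≤n)
    lin₂ : ∀ R → 4 * (R * 2) ≡ R * 8
    lin₂ = solve-∀
  lower : 4 * (pow⁵ (2+ ρ) * suc z) ≤ n
  lower with z in eq
  ... | suc (suc z′) = begin
    4 * (pow⁵ (2+ ρ) * suc (suc (suc z′)))            ≤⟨ m≤m+n _ (2 * (pow⁵ (2+ ρ) * z′)) ⟩
    4 * (pow⁵ (2+ ρ) * suc (suc (suc z′))) + 2 * (pow⁵ (2+ ρ) * z′)  ≡⟨ lin₂ (pow⁵ (2+ ρ)) z′ ⟩
    suc (suc z′) * (6 * pow⁵ (2+ ρ))                  ≡⟨ cong (_* (6 * pow⁵ (2+ ρ))) eq ⟨
    z * (6 * pow⁵ (2+ ρ))                             ≤⟨ m≤n+m _ (n % (6 * pow⁵ (2+ ρ))) ⟩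
    n % (6 * pow⁵ (2+ ρ)) + z * (6 * pow⁵ (2+ ρ))          ≡⟨ n≡ ⟨
    n                                            ∎
    where
    lin₂ : ∀ R z → 4 * (R * suc (suc (suc z))) + 2 * (R * z) ≡ suc (suc z) * (6 * R)
    lin₂ = solve-∀
  ... | zero = ≤-trans (base 1 (s≤s z≤n)) (<⇒≤ r⁸<n)
  ... | suc zero = ≤-trans (base 2 ≤-refl) (<⇒≤ r⁸<n)

-- The exponent r+6 is split as (r-1)+7. Since n <= 2ra, the power (4r)^(r-1) cancels (2r)^(r-1) and
-- leaves 2^(r-1) over.
joint-bound : ∀ ρ n a J → n ≤ 2 * ((2+ ρ) * a) →
  J * (4 * (2+ ρ)) ^ ((2+ ρ) + 6) ≤ n ^ suc ρ →
  J * (2 ^ suc ρ * (4 * (2+ ρ)) ^ 7) ≤ a ^ suc ρ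
joint-bound ρ n a J n≤ h = *-cancelˡ-≤ ((2 * (2+ ρ)) ^ suc ρ) {{m^n≢0 (2 * (2+ ρ)) (suc ρ)}} (begin
  (2 * (2+ ρ)) ^ suc ρ * (J * (2 ^ suc ρ * (4 * (2+ ρ)) ^ 7))  ≡⟨ lin ((2 * (2+ ρ)) ^ suc ρ) J (2 ^ suc ρ) ((4 * (2+ ρ)) ^ 7) ⟩
  J * ((2 * (2+ ρ)) ^ suc ρ * 2 ^ suc ρ * (4 * (2+ ρ)) ^ 7)    ≡⟨ cong (λ x → J * (x * (4 * (2+ ρ)) ^ 7)) (^-distribʳ-* (suc ρ) (2 * (2+ ρ)) 2) ⟨
  J * ((2 * (2+ ρ) * 2) ^ suc ρ * (4 * (2+ ρ)) ^ 7)            ≡⟨ cong (λ x → J * (x ^ suc ρ * (4 * (2+ ρ)) ^ 7)) (lin′ (2+ ρ)) ⟩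
  J * ((4 * (2+ ρ)) ^ suc ρ * (4 * (2+ ρ)) ^ 7)                ≡⟨ cong (J *_) (^-distribˡ-+-* (4 * (2+ ρ)) (suc ρ) 7) ⟨
  J * (4 * (2+ ρ)) ^ (suc ρ + 7)                               ≡⟨ cong (λ k → J * (4 * (2+ ρ)) ^ k) (+-suc (suc ρ) 6) ⟩
  J * (4 * (2+ ρ)) ^ ((2+ ρ) + 6)                              ≤⟨ h ⟩
  n ^ suc ρ                                                    ≤⟨ ^-monoˡ-≤ (suc ρ) n≤ ⟩
  (2 * ((2+ ρ) * a)) ^ suc ρ                                   ≡⟨ cong (_^ (suc ρ)) (*-assoc 2 (2+ ρ) a) ⟨
  (2 * (2+ ρ) * a) ^ suc ρ                                     ≡⟨ ^-distribʳ-* (suc ρ) (2 * (2+ ρ)) a ⟩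
  (2 * (2+ ρ)) ^ suc ρ * a ^ suc ρ                             ∎)
  where
  open ≤-Reasoning
  lin : ∀ x j y z → x * (j * (y * z)) ≡ j * (x * y * z)
  lin = solve-∀
  lin′ : ∀ r → 2 * r * 2 ≡ 4 * r
  lin′ = solve-∀

144*pow⁶≤ : ∀ r .{{_ : NonZero r}} → 144 * pow⁶ r ≤ (4 * r) ^ 7
144*pow⁶≤ r = begin
  144 * pow⁶ r          ≤⟨ *-mono-≤ (m≤m+n 144 16240) (m≤n*m (pow⁶ r) r) ⟩
  16384 * (r * pow⁶ r)  ≡⟨ trans (cong (λ R → 16384 * (r * (r * (r * R)))) (pow⁴≡ r)) (lin r) ⟩
  (4 * r) ^ 7           ∎
  where
  open ≤-Reasoning
  lin : ∀ r → 16384 * (r * (r * (r * (r * r * (r * r))))) ≡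
    4 * r * (4 * r * (4 * r * (4 * r * (4 * r * (4 * r * (4 * r * 1))))))
  lin = solve-∀

module Arithmetic (ρ n J Z a X : ℕ) (0<Z : 0 < Z)
  (a≡ : a ≡ 3 * (pow⁴ (2+ ρ) * Z)) (X≡ : X ≡ suc (3 * ρ) * Z) where

  open ≤-Reasoning

  0<a : 0 < a
  0<a = subst (0 <_) (sym a≡) (*-mono-≤ {1} {3} (s≤s z≤n) (*-mono-≤ {1} {pow⁴ (2+ ρ)} (≤-trans (s≤s z≤n) (16≤pow⁴ ρ)) 0<Z))

  module _ (bound : J * (2 ^ suc ρ * (4 * (2+ ρ)) ^ 7) ≤ a ^ suc ρ) where

    bound′ : J * (144 * pow⁶ (2+ ρ)) ≤ a ^ suc ρ
    bound′ = begin
      J * (144 * pow⁶ (2+ ρ))             ≤⟨ *-monoʳ-≤ J (144*pow⁶≤ (2+ ρ)) ⟩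
      J * (4 * (2+ ρ)) ^ 7                ≤⟨ *-monoʳ-≤ J (m≤n*m ((4 * (2+ ρ)) ^ 7) (2 ^ suc ρ) {{m^n≢0 2 (suc ρ)}}) ⟩
      J * (2 ^ suc ρ * (4 * (2+ ρ)) ^ 7)  ≤⟨ bound ⟩
      a ^ suc ρ                           ∎

    -- For the codegree bound: a common neighbourhood that is too large would contain more
    -- (r-1)-cliques than `J` permits.
    pJ<Zaᵖ : (suc ρ) * J < Z * a ^ ρ
    pJ<Zaᵖ = 2x≤y⇒x<y (*-cancelˡ-≤ (3 * pow⁴ (2+ ρ)) {{m*n≢0 3 (pow⁴ (2+ ρ))}} (begin
      3 * pow⁴ (2+ ρ) * (2 * (suc ρ * J))   ≤⟨ *-monoʳ-≤ (3 * pow⁴ (2+ ρ)) (*-monoʳ-≤ 2 (*-monoˡ-≤ J (n≤1+n (suc ρ)))) ⟩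
      3 * pow⁴ (2+ ρ) * (2 * ((2+ ρ) * J))  ≡⟨ lin₁ (2+ ρ) J (pow⁴ (2+ ρ)) ⟩
      J * (6 * pow⁵ (2+ ρ))                 ≤⟨ *-monoʳ-≤ J (*-mono-≤ (m≤m+n 6 138) (m≤n*m (pow⁵ (2+ ρ)) (2+ ρ))) ⟩
      J * (144 * pow⁶ (2+ ρ))               ≤⟨ bound′ ⟩
      a * a ^ ρ                             ≡⟨ trans (cong (_* a ^ ρ) a≡) (lin₂ (pow⁴ (2+ ρ)) Z (a ^ ρ)) ⟩
      3 * pow⁴ (2+ ρ) * (Z * a ^ ρ)         ∎))
      (*-mono-≤ 0<Z (m^n>0 a {{>-nonZero 0<a}} ρ))
      where
      lin₁ : ∀ r J R → 3 * R * (2 * (r * J)) ≡ J * (6 * (r * R))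
      lin₁ = solve-∀
      lin₂ : ∀ R Z x → 3 * (R * Z) * x ≡ 3 * R * (Z * x)
      lin₂ = solve-∀

    -- For deletions: it excludes the dense alternative in a neighbourhood. The factor 2^(r-1) left
    -- over in `bound` pays for replacing `a` by `E`, as a <= 2E.
    local-bound : ∀ E → n ≤ 6 * (pow⁵ (2+ ρ) * Z) → 2 * (pow⁴ (2+ ρ) * Z) ≤ E → n * J < Z * E ^ suc ρ
    local-bound E n≤ le = 2x≤y⇒x<y (begin
      2 * (n * J)                      ≤⟨ *-monoʳ-≤ 2 (*-monoˡ-≤ J n≤) ⟩
      2 * (6 * (pow⁵ (2+ ρ) * Z) * J)  ≡⟨ lin₁ (pow⁵ (2+ ρ)) Z J ⟩
      Z * (J * (12 * pow⁵ (2+ ρ)))     ≤⟨ *-monoʳ-≤ Z (*-monoʳ-≤ J (*-mono-≤ (m≤m+n 12 132) (m≤n*m (pow⁵ (2+ ρ)) (2+ ρ)))) ⟩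
      Z * (J * (144 * pow⁶ (2+ ρ)))    ≤⟨ *-monoʳ-≤ Z (*-monoʳ-≤ J (144*pow⁶≤ (2+ ρ))) ⟩
      Z * (J * (4 * (2+ ρ)) ^ 7)       ≤⟨ *-monoʳ-≤ Z (*-cancelˡ-≤ (2 ^ suc ρ) {{m^n≢0 2 (suc ρ)}} (begin
        2 ^ suc ρ * (J * (4 * (2+ ρ)) ^ 7)  ≡⟨ x*yz≡y*xz (2 ^ suc ρ) J _ ⟩
        J * (2 ^ suc ρ * (4 * (2+ ρ)) ^ 7)  ≤⟨ bound ⟩
        a ^ suc ρ                           ≤⟨ ^-monoˡ-≤ (suc ρ) (begin
          a                            ≡⟨ a≡ ⟩
          3 * (pow⁴ (2+ ρ) * Z)        ≤⟨ *-monoˡ-≤ (pow⁴ (2+ ρ) * Z) (n≤1+n 3) ⟩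
          4 * (pow⁴ (2+ ρ) * Z)        ≡⟨ *-assoc 2 2 (pow⁴ (2+ ρ) * Z) ⟩
          2 * (2 * (pow⁴ (2+ ρ) * Z))  ≤⟨ *-monoʳ-≤ 2 le ⟩
          2 * E                        ∎) ⟩
        (2 * E) ^ suc ρ        ≡⟨ ^-distribʳ-* (suc ρ) 2 E ⟩
        2 ^ suc ρ * E ^ suc ρ  ∎)) ⟩
      Z * E ^ suc ρ                       ∎)
      (*-mono-≤ 0<Z (m^n>0 E {{>-nonZero 0<E}} (suc ρ)))
      where
      0<E : 0 < E
      0<E = ≤-trans (*-mono-≤ {1} {2} (s≤s z≤n) (*-mono-≤ {1} {pow⁴ (2+ ρ)} (≤-trans (s≤s z≤n) (16≤pow⁴ ρ)) 0<Z)) le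
      lin₁ : ∀ R Z J → 2 * (6 * (R * Z) * J) ≡ Z * (J * (12 * R))
      lin₁ = solve-∀

    -- For the set of size ra: it excludes the dense alternative there. The constant 144 is 2 * 18 *
    -- 4, from the strictness, from `q` and from n <= 2ra squared.
    global-bound : n ≤ 2 * ((2+ ρ) * a) → 18 * pow⁶ (2+ ρ) * (n * (n * J)) < (2+ ρ) * (2+ ρ) * (a * a * a ^ suc ρ)
    global-bound n≤ = 2x≤y⇒x<y (begin
      2 * (18 * pow⁶ (2+ ρ) * (n * (n * J)))
        ≤⟨ *-monoʳ-≤ 2 (*-monoʳ-≤ (18 * pow⁶ (2+ ρ)) (*-mono-≤ n≤ (*-monoˡ-≤ J n≤))) ⟩
      2 * (18 * pow⁶ (2+ ρ) * (2 * ((2+ ρ) * a) * (2 * ((2+ ρ) * a) * J)))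
        ≡⟨ lin₁ (2+ ρ) a J (pow⁶ (2+ ρ)) ⟩
      (2+ ρ) * (2+ ρ) * (a * a * (J * (144 * pow⁶ (2+ ρ))))
        ≤⟨ *-monoʳ-≤ ((2+ ρ) * (2+ ρ)) (*-monoʳ-≤ (a * a) bound′) ⟩
      (2+ ρ) * (2+ ρ) * (a * a * a ^ suc ρ) ∎)
      (*-mono-≤ {1} {(2+ ρ) * (2+ ρ)} (s≤s z≤n) (*-mono-≤ (*-mono-≤ 0<a 0<a) (m^n>0 a {{>-nonZero 0<a}} (suc ρ))))
      where
      lin₁ : ∀ r a J R → 2 * (18 * R * (2 * (r * a) * (2 * (r * a) * J))) ≡ r * r * (a * a * (J * (144 * R)))
      lin₁ = solve-∀

  -- Multiplied by r, the averaged inequality loses its main terms because rα is within r-1 of m,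
  -- and only 2m remains on the left. As m >= 3r^5 Z, this dominates the right side, whose leading
  -- term is 3r^5 Z.
  joint-contradiction : ∀ m α → (suc ρ) ≤ Z → (2+ ρ) * a ≤ m → (2+ ρ) * α ≤ m + suc ρ → let D = α + X in
    ¬ (2 * suc ρ * (suc (suc (suc ρ)) * m) ≤ suc (suc (suc ρ)) * suc (suc ρ) * (Z + ρ * D) + suc (suc ρ) * suc ρ * m + 2 * suc ρ * (suc (suc (suc ρ)) * D))
  joint-contradiction m α p≤Z ra≤m rα≤ h = <⇒≱ K<6r⁵ (*-cancelʳ-≤ _ _ Z {{>-nonZero 0<Z}} (begin
    6 * ((2+ ρ) * ((2+ ρ) * (2+ ρ) * ((2+ ρ) * (2+ ρ)))) * Z  ≡⟨ trans (lin₆ (2+ ρ) Z) (cong (λ x → 2 * ((2+ ρ) * x)) (sym (trans a≡ (cong (λ R → 3 * (R * Z)) (pow⁴≡ (2+ ρ)))))) ⟩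
    2 * ((2+ ρ) * a)                                          ≤⟨ *-monoʳ-≤ 2 ra≤m ⟩
    2 * m                                                     ≤⟨ 2m≤ ⟩
    (2+ ρ) * (2+ ρ) * suc (suc (suc ρ)) * Z + κ * suc ρ + κ * ((2+ ρ) * X)
      ≤⟨ +-monoˡ-≤ (κ * ((2+ ρ) * X)) (+-monoʳ-≤ ((2+ ρ) * (2+ ρ) * suc (suc (suc ρ)) * Z) (*-monoʳ-≤ κ p≤Z)) ⟩
    (2+ ρ) * (2+ ρ) * suc (suc (suc ρ)) * Z + κ * Z + κ * ((2+ ρ) * X)
      ≡⟨ trans (cong (λ x → (2+ ρ) * (2+ ρ) * suc (suc (suc ρ)) * Z + κ * Z + κ * ((2+ ρ) * x)) X≡) (lin₅ (2+ ρ) (suc (suc (suc ρ))) κ (suc (3 * ρ)) Z) ⟩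
    ((2+ ρ) * (2+ ρ) * suc (suc (suc ρ)) + κ + κ * ((2+ ρ) * suc (3 * ρ))) * Z ∎))
    where
    -- This is (r+1)(r^2-2), the coefficient of rα after multiplication by r.
    κ = (ρ + 3) * (ρ * ρ + 4 * ρ + 2)
    lin₅ : ∀ r p k x Z → r * r * p * Z + k * Z + k * (r * (x * Z)) ≡ (r * r * p + k + k * (r * x)) * Z
    lin₅ = solve-∀
    lin₆ : ∀ r Z → 6 * (r * (r * r * (r * r))) * Z ≡ 2 * (r * (3 * (r * r * (r * r) * Z)))
    lin₆ = solve-∀
    K<6r⁵ : (2+ ρ) * (2+ ρ) * suc (suc (suc ρ)) + κ + κ * ((2+ ρ) * suc (3 * ρ)) < 6 * ((2+ ρ) * ((2+ ρ) * (2+ ρ) * ((2+ ρ) * (2+ ρ))))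
    K<6r⁵ = ≤-trans (m≤m+n _ (161 + 380 * ρ + 336 * (ρ * ρ) + 145 * (ρ * ρ * ρ) + 32 * (ρ * ρ * (ρ * ρ)) + 3 * (ρ * ρ * (ρ * ρ) * ρ)))
      (≤-reflexive (lin ρ))
      where
      lin : ∀ ρ → suc (suc (suc ρ) * suc (suc ρ) * suc (suc (suc ρ)) + (ρ + 3) * (ρ * ρ + 4 * ρ + 2)
        + (ρ + 3) * (ρ * ρ + 4 * ρ + 2) * (suc (suc ρ) * suc (3 * ρ)))
        + (161 + 380 * ρ + 336 * (ρ * ρ) + 145 * (ρ * ρ * ρ) + 32 * (ρ * ρ * (ρ * ρ)) + 3 * (ρ * ρ * (ρ * ρ) * ρ))
        ≡ 6 * (suc (suc ρ) * (suc (suc ρ) * suc (suc ρ) * (suc (suc ρ) * suc (suc ρ))))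
      lin = solve-∀
    lin₁ : ∀ ρ m → suc (suc ρ) * (2 * suc ρ * (suc (suc (suc ρ)) * m)) ≡
      suc (suc ρ) * (suc (suc ρ) * suc ρ) * m + (ρ + 3) * (ρ * ρ + 4 * ρ + 2) * m + 2 * m
    lin₁ = solve-∀
    lin₂ : ∀ ρ m α Z X → suc (suc ρ) * (suc (suc (suc ρ)) * suc (suc ρ) * (Z + ρ * (α + X)) + suc (suc ρ) * suc ρ * m + 2 * suc ρ * (suc (suc (suc ρ)) * (α + X))) ≡
      suc (suc ρ) * (suc (suc ρ) * suc ρ) * m + (ρ + 3) * (ρ * ρ + 4 * ρ + 2) * (suc (suc ρ) * α)
        + (suc (suc ρ) * suc (suc ρ) * suc (suc (suc ρ)) * Z + (ρ + 3) * (ρ * ρ + 4 * ρ + 2) * (suc (suc ρ) * X))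
    lin₂ = solve-∀
    lin₃ : ∀ A κ m p B C → A + κ * (m + p) + (B + C) ≡ A + κ * m + (B + κ * p + C)
    lin₃ = solve-∀
    2m≤ : 2 * m ≤ (2+ ρ) * (2+ ρ) * suc (suc (suc ρ)) * Z + κ * suc ρ + κ * ((2+ ρ) * X)
    2m≤ = +-cancelˡ-≤ ((2+ ρ) * ((2+ ρ) * suc ρ) * m + κ * m) _ _ (begin
      (2+ ρ) * ((2+ ρ) * suc ρ) * m + κ * m + 2 * m   ≡⟨ lin₁ ρ m ⟨
      (2+ ρ) * (2 * suc ρ * (suc (suc (suc ρ)) * m))  ≤⟨ *-monoʳ-≤ (2+ ρ) h ⟩
      (2+ ρ) * (suc (suc (suc ρ)) * suc (suc ρ) * (Z + ρ * (α + X)) + suc (suc ρ) * suc ρ * m + 2 * suc ρ * (suc (suc (suc ρ)) * (α + X)))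
        ≡⟨ lin₂ ρ m α Z X ⟩
      (2+ ρ) * ((2+ ρ) * suc ρ) * m + κ * ((2+ ρ) * α) + ((2+ ρ) * (2+ ρ) * suc (suc (suc ρ)) * Z + κ * ((2+ ρ) * X))
        ≤⟨ +-monoˡ-≤ ((2+ ρ) * (2+ ρ) * suc (suc (suc ρ)) * Z + κ * ((2+ ρ) * X)) (+-monoʳ-≤ ((2+ ρ) * ((2+ ρ) * suc ρ) * m) (*-monoʳ-≤ κ rα≤)) ⟩
      (2+ ρ) * ((2+ ρ) * suc ρ) * m + κ * (m + suc ρ) + ((2+ ρ) * (2+ ρ) * suc (suc (suc ρ)) * Z + κ * ((2+ ρ) * X))
        ≡⟨ lin₃ ((2+ ρ) * ((2+ ρ) * suc ρ) * m) κ m (suc ρ) ((2+ ρ) * (2+ ρ) * suc (suc (suc ρ)) * Z) (κ * ((2+ ρ) * X)) ⟩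
      (2+ ρ) * ((2+ ρ) * suc ρ) * m + κ * m + ((2+ ρ) * (2+ ρ) * suc (suc (suc ρ)) * Z + κ * suc ρ + κ * ((2+ ρ) * X)) ∎)

-- Each factor exceeds its Turán value (r-t)a by ta/(q+1), after division by q+1. The relative
-- errors multiply to at most 1 + 2jr/(q+1); the hypothesis on `q` absorbs the cross term in the
-- induction step.
final-product : ∀ r a q j → 2 * (r * r) ≤ suc q → j ≤ r →
  suc q * Π j (λ t → r * a + (r ∸ t) * (q * a)) ≤ suc q ^ j * Π j (λ t → (r ∸ t) * a) * (suc q + 2 * (j * r))
final-product r a q zero _ _ = ≤-reflexive (lin (suc q))
  where
  lin : ∀ x → x * 1 ≡ 1 * 1 * (x + 0)
  lin = solve-∀
final-product r a q (suc j) h j<r with e , refl ← m≤n⇒∃[o]m+o≡n j<r rewrite ∸-suc j e = begin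
  Q * (Π j f * (r * a + suc e * (q * a)))                ≡⟨ lin₁ Q (Π j f) j e a q ⟩
  Q * Π j f * ((suc e * Q + j) * a)                      ≤⟨ *-monoˡ-≤ _ (final-product r a q j h (<⇒≤ j<r)) ⟩
  Q ^ j * Θ * (Q + 2 * (j * r)) * ((suc e * Q + j) * a)  ≡⟨ lin₂ (Q ^ j) Θ (Q + 2 * (j * r)) (suc e * Q + j) a ⟩
  Q ^ j * Θ * a * ((Q + 2 * (j * r)) * (suc e * Q + j))  ≤⟨ *-monoʳ-≤ (Q ^ j * Θ * a) factor ⟩
  Q ^ j * Θ * a * (Q * suc e * (Q + 2 * (suc j * r)))    ≡⟨ lin₃ (Q ^ j) Θ Q (suc e) (Q + 2 * (suc j * r)) a ⟩
  Q * Q ^ j * (Θ * (suc e * a)) * (Q + 2 * (suc j * r))  ∎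
  where
  open ≤-Reasoning
  Q = suc q
  f : ℕ → ℕ
  f t = r * a + (r ∸ t) * (q * a)
  Θ = Π j (λ t → (r ∸ t) * a)
  lin₁ : ∀ Q x j e a q → Q * (x * (suc (j + e) * a + suc e * (q * a))) ≡ Q * x * ((suc e * suc q + j) * a)
  lin₁ = solve-∀
  lin₂ : ∀ x y z w a → x * y * z * (w * a) ≡ x * y * a * (z * w)
  lin₂ = solve-∀
  lin₃ : ∀ x y q e w a → x * y * a * (q * e * w) ≡ q * x * (y * (e * a)) * w
  lin₃ = solve-∀
  lin₄ : ∀ Q e j r → (Q + 2 * (j * r)) * (suc e * Q + j) ≡ Q * suc e * (Q + 2 * (j * r)) + (j * Q + j * (2 * (j * r)))
  lin₄ = solve-∀
  lin₅ : ∀ Q e j r → Q * suc e * (Q + 2 * (j * r)) + (1 + e) * (r * Q + r * Q) ≡ Q * suc e * (Q + 2 * (suc j * r))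
  lin₅ = solve-∀
  j≤r = <⇒≤ j<r
  factor : (Q + 2 * (j * r)) * (suc e * Q + j) ≤ Q * suc e * (Q + 2 * (suc j * r))
  factor = begin
    (Q + 2 * (j * r)) * (suc e * Q + j)
      ≡⟨ lin₄ Q e j r ⟩
    Q * suc e * (Q + 2 * (j * r)) + (j * Q + j * (2 * (j * r)))
      ≤⟨ +-monoʳ-≤ (Q * suc e * (Q + 2 * (j * r))) (+-mono-≤ (*-monoˡ-≤ Q j≤r)
           (*-mono-≤ j≤r (≤-trans (*-monoʳ-≤ 2 (*-monoˡ-≤ r j≤r)) h))) ⟩
    Q * suc e * (Q + 2 * (j * r)) + (r * Q + r * Q)
      ≤⟨ +-monoʳ-≤ (Q * suc e * (Q + 2 * (j * r))) (m≤n*m (r * Q + r * Q) (1 + e)) ⟩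
    Q * suc e * (Q + 2 * (j * r)) + (1 + e) * (r * Q + r * Q)
      ≡⟨ lin₅ Q e j r ⟩
    Q * suc e * (Q + 2 * (suc j * r)) ∎

-- With ρ = r-2 this is the number of ordered σ-cliques in a complete (r-2)-partite graph with
-- classes of size `a`.
κ : ℕ → ℕ → ℕ → ℕ
κ ρ a σ = Π σ (λ t → (ρ ∸ t) * a)

κ-positive : ∀ ρ {a} → 0 < a → ∀ σ → σ ≤ ρ → 0 < κ ρ a σ
κ-positive ρ 0<a σ σ≤ρ = Π-positive σ λ i i<σ → *-mono-≤ (m<n⇒0<n∸m (≤-trans i<σ σ≤ρ)) 0<a

module Extremal (ρ n J Z a X q : ℕ) (0<Z : 0 < Z) (a≡ : a ≡ 3 * (pow⁴ (2+ ρ) * Z))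
  (X≡ : X ≡ suc (3 * ρ) * Z) (q≡ : suc q ≡ 18 * pow⁶ (2+ ρ)) where

  open Arithmetic ρ n J Z a X 0<Z a≡ X≡ using (0<a)
  open ≤-Reasoning

  2r²≤q : 2 * ((2+ ρ) * (2+ ρ)) ≤ suc q
  2r²≤q = begin
    2 * ((2+ ρ) * (2+ ρ))                 ≤⟨ *-mono-≤ (m≤m+n 2 16) (m≤m*n ((2+ ρ) * (2+ ρ)) (pow⁴ (2+ ρ))) ⟩
    18 * ((2+ ρ) * (2+ ρ) * pow⁴ (2+ ρ))  ≡⟨ cong (18 *_) (*-assoc (2+ ρ) (2+ ρ) (pow⁴ (2+ ρ))) ⟩
    18 * pow⁶ (2+ ρ)                      ≡⟨ q≡ ⟨
    suc q                                 ∎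

  -- Subtracting the Turán value Θ = ra * (r-1)a * κ from both bounds and cancelling sκ leaves Q * M
  -- * X <= 2r * ra * (r-1)a. With Q = 18r^6, M >= r^5 Z, X >= Z and a = 3r^4 Z this reads r <= r-1.
  final-contradiction : ∀ σ C M → σ ≤ ρ → pow⁵ (2+ ρ) * Z ≤ M →
    suc q ^ suc (suc σ) * C ≤ Π (suc (suc σ)) (λ t → (2+ ρ) * a + ((2+ ρ) ∸ t) * (q * a)) →
    ¬ (Π (suc (suc σ)) (λ t → ((2+ ρ) ∸ t) * a) + M * (suc (suc σ) * (X * κ ρ a σ)) ≤ C)
  final-contradiction σ C M σ≤ρ M≥ upper lower = <⇒≱ (n<1+n (suc ρ)) (*-cancelʳ-≤ (2+ ρ) (suc ρ) x {{>-nonZero 0<x}} (begin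
    (2+ ρ) * x                                ≡⟨ lin₁ (2+ ρ) (pow⁴ (2+ ρ)) Z ⟩
    18 * pow⁶ (2+ ρ) * (pow⁵ (2+ ρ) * Z * Z)  ≡⟨ cong (_* (pow⁵ (2+ ρ) * Z * Z)) q≡ ⟨
    Q * (pow⁵ (2+ ρ) * Z * Z)                 ≤⟨ *-monoʳ-≤ Q (*-mono-≤ M≥ (subst (Z ≤_) (sym X≡) (m≤n*m Z (suc (3 * ρ))))) ⟩
    Q * (M * X)                               ≤⟨ *-cancelʳ-≤ _ _ (s * κ ρ a σ) {{>-nonZero (*-mono-≤ {1} {s} (s≤s z≤n) (κ-positive ρ 0<a σ σ≤ρ))}} cancelled ⟩
    (2+ ρ) * a * (suc ρ * a) * (2 * (2+ ρ))   ≡⟨ trans (cong (λ x → (2+ ρ) * x * (suc ρ * x) * (2 * (2+ ρ))) a≡) (lin₂ (2+ ρ) (suc ρ) (pow⁴ (2+ ρ)) Z) ⟩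
    (suc ρ) * x                               ∎))
    where
    Q = suc q
    s = suc (suc σ)
    x = 18 * ((2+ ρ) * (2+ ρ) * (pow⁴ (2+ ρ) * pow⁴ (2+ ρ)) * (Z * Z))
    0<pow⁴ : 0 < pow⁴ (2+ ρ)
    0<pow⁴ = ≤-trans (s≤s z≤n) (16≤pow⁴ ρ)
    0<x : 0 < x
    0<x = *-mono-≤ {1} {18} (s≤s z≤n) (*-mono-≤ {1} {(2+ ρ) * (2+ ρ) * (pow⁴ (2+ ρ) * pow⁴ (2+ ρ))} (*-mono-≤ {1} {(2+ ρ) * (2+ ρ)} (s≤s z≤n) (*-mono-≤ 0<pow⁴ 0<pow⁴)) (*-mono-≤ 0<Z 0<Z))
    Θ = Π s (λ t → ((2+ ρ) ∸ t) * a)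
    Θ≡ : Θ ≡ (2+ ρ) * a * (suc ρ * a * κ ρ a σ)
    Θ≡ = trans (Π-cons (suc σ) (λ t → ((2+ ρ) ∸ t) * a)) (cong ((2+ ρ) * a *_) (Π-cons σ (λ t → (suc ρ ∸ t) * a)))
    lin₁ : ∀ r R Z → r * (18 * (r * r * (R * R) * (Z * Z))) ≡ 18 * (r * (r * R)) * (r * R * Z * Z)
    lin₁ = solve-∀
    lin₂ : ∀ r p R Z → r * (3 * (R * Z)) * (p * (3 * (R * Z))) * (2 * r) ≡ p * (18 * (r * r * (R * R) * (Z * Z)))
    lin₂ = solve-∀
    QC≤ : Q * C ≤ Θ * (Q + 2 * (s * (2+ ρ)))
    QC≤ = *-cancelˡ-≤ (Q ^ s) {{m^n≢0 Q s}} (begin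
      Q ^ s * (Q * C)                                      ≡⟨ x*yz≡y*xz (Q ^ s) Q C ⟩
      Q * (Q ^ s * C)                                      ≤⟨ *-monoʳ-≤ Q upper ⟩
      Q * Π s (λ t → (2+ ρ) * a + ((2+ ρ) ∸ t) * (q * a))  ≤⟨ final-product (2+ ρ) a q s 2r²≤q (s≤s (s≤s σ≤ρ)) ⟩
      Q ^ s * Θ * (Q + 2 * (s * (2+ ρ)))                   ≡⟨ *-assoc (Q ^ s) Θ _ ⟩
      Q ^ s * (Θ * (Q + 2 * (s * (2+ ρ))))                 ∎)
    lin₄ : ∀ Q M X s k → Q * (M * X) * (s * k) ≡ Q * (M * (s * (X * k)))
    lin₄ = solve-∀
    lin₅ : ∀ A B k s r → A * (B * k) * (2 * (s * r)) ≡ A * B * (2 * r) * (s * k)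
    lin₅ = solve-∀
    cancelled : Q * (M * X) * (s * κ ρ a σ) ≤ (2+ ρ) * a * (suc ρ * a) * (2 * (2+ ρ)) * (s * κ ρ a σ)
    cancelled = begin
      Q * (M * X) * (s * κ ρ a σ)    ≡⟨ lin₄ Q M X s (κ ρ a σ) ⟩
      Q * (M * (s * (X * κ ρ a σ)))  ≤⟨ +-cancelˡ-≤ (Q * Θ) _ _ (begin
        Q * Θ + Q * (M * (s * (X * κ ρ a σ)))  ≡⟨ *-distribˡ-+ Q Θ _ ⟨
        Q * (Θ + M * (s * (X * κ ρ a σ)))      ≤⟨ *-monoʳ-≤ Q lower ⟩
        Q * C                                  ≤⟨ QC≤ ⟩
        Θ * (Q + 2 * (s * (2+ ρ)))             ≡⟨ trans (*-distribˡ-+ Θ Q _) (cong (_+ Θ * (2 * (s * (2+ ρ)))) (*-comm Θ Q)) ⟩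
        Q * Θ + Θ * (2 * (s * (2+ ρ)))         ∎) ⟩
      Θ * (2 * (s * (2+ ρ)))                                   ≡⟨ cong (_* (2 * (s * (2+ ρ)))) Θ≡ ⟩
      (2+ ρ) * a * (suc ρ * a * κ ρ a σ) * (2 * (s * (2+ ρ)))  ≡⟨ lin₅ ((2+ ρ) * a) (suc ρ * a) (κ ρ a σ) s (2+ ρ) ⟩
      (2+ ρ) * a * (suc ρ * a) * (2 * (2+ ρ)) * (s * κ ρ a σ) ∎

-- Vertices are deleted until ra of them are left. If m vertices are left and the classes of
-- T_r(m) have at most α elements, then a vertex is deleted when its degree is at most
-- m − α − X; the cliques in its neighbourhood are then bounded by a product of factors
-- decreasing in steps of E = α − 3Z.
record Constants (ρ n J : ℕ) : Set where
  field
    Z a q X e : ℕ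
    p≤Z : suc ρ ≤ Z
    0<a : 0 < a
    X≡ : X ≡ suc (3 * ρ) * Z
    ra≤n : (2+ ρ) * a ≤ n
    e+3Z≤a : e + 3 * Z ≤ a
    local-bound : ∀ E → e ≤ E → n * J < Z * E ^ suc ρ
    pJ<Zaᵖ : (suc ρ) * J < Z * a ^ ρ
    global-bound : suc q * (n * (n * J)) < (2+ ρ) * (2+ ρ) * (a * a * a ^ suc ρ)
    joint-contradiction : ∀ m α → (2+ ρ) * a ≤ m → (2+ ρ) * α ≤ m + suc ρ → let D = α + X in
      ¬ (2 * suc ρ * (suc ((2+ ρ)) * m) ≤ suc ((2+ ρ)) * (2+ ρ) * (Z + ρ * D) + (2+ ρ) * suc ρ * m + 2 * suc ρ * (suc ((2+ ρ)) * D))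
    final-contradiction : ∀ σ C → σ ≤ ρ →
      suc q ^ suc (suc σ) * C ≤ Π (suc (suc σ)) (λ t → (2+ ρ) * a + ((2+ ρ) ∸ t) * (q * a)) →
      ¬ (Π (suc (suc σ)) (λ t → ((2+ ρ) ∸ t) * a) + (n ∸ (2+ ρ) * a) * (suc (suc σ) * (X * κ ρ a σ)) ≤ C)

  0<Z : 0 < Z
  0<Z = ≤-trans (s≤s z≤n) p≤Z

  module _ {m α E y : ℕ} (α≡ : α ≡ E + 3 * Z) (y≡ : y + (2+ ρ) * α ≡ m + 2 * Z) where

    factor : ℕ → ℕ
    factor t = y + (suc ρ ∸ t) * E

    -- The origin of `X`: it is the value for which the progression starts at the degree threshold m
    -- - α - X and reaches `y` after r-1 steps.
    factor₀≡ : factor 0 + (α + X) ≡ m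
    factor₀≡ rewrite α≡ | X≡ = +-cancelʳ-≡ (2 * Z) _ _ (trans (lin ρ y E Z) y≡)
      where
      lin : ∀ ρ y E Z → y + suc ρ * E + (E + 3 * Z + suc (3 * ρ) * Z) + 2 * Z ≡ y + (2+ ρ) * (E + 3 * Z)
      lin = solve-∀

    -- In T_r(m), t+1 vertices have at least m - (t+1)α common neighbours, so the upper bounds for a
    -- sparse neighbourhood are also lower bounds for the Turán graph.
    factor≤ : ∀ t → t ≤ ρ → factor t + suc t * α ≤ m
    factor≤ t t≤ρ rewrite α≡ = go t≤ρ
      where
      lin : ∀ t e y E Z → y + suc e * E + suc t * (E + 3 * Z) + (3 * e + 1) * Z + 2 * Z ≡
        y + suc (suc (t + e)) * (E + 3 * Z)
      lin = solve-∀
      go : t ≤ ρ → y + (suc ρ ∸ t) * E + suc t * (E + 3 * Z) ≤ m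
      go t≤ρ with d , t+d≡ ← m≤n⇒∃[o]m+o≡n t≤ρ =
        subst (λ k → y + k * E + suc t * (E + 3 * Z) ≤ m) (sym (trans (cong (λ k → suc k ∸ t) (sym t+d≡)) (∸-suc t d)))
          (≤-trans (m≤m+n _ ((3 * d + 1) * Z)) (≤-reflexive (+-cancelʳ-≡ (2 * Z) _ _
            (trans (lin t d y E Z) (trans (cong (λ k → y + suc (suc k) * (E + 3 * Z)) t+d≡) y≡)))))

module _ (ρ n J Z a X q : ℕ) (p≤Z : suc ρ ≤ Z) (a≡ : a ≡ 3 * (pow⁴ (2+ ρ) * Z))
  (X≡ : X ≡ suc (3 * ρ) * Z) (q≡ : suc q ≡ 18 * pow⁶ (2+ ρ))
  (lower : 4 * (pow⁵ (2+ ρ) * Z) ≤ n) (upper : n ≤ 6 * (pow⁵ (2+ ρ) * Z))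
  (bound : J * (4 * (2+ ρ)) ^ ((2+ ρ) + 6) ≤ n ^ suc ρ) where

  private
    0<Z′ : 0 < Z
    0<Z′ = ≤-trans (s≤s z≤n) p≤Z

    module A = Arithmetic ρ n J Z a X 0<Z′ a≡ X≡
    module E = Extremal ρ n J Z a X q 0<Z′ a≡ X≡ q≡

    lin₁ : ∀ r R Z → 6 * (r * R * Z) ≡ 2 * (r * (3 * (R * Z)))
    lin₁ = solve-∀
    lin₂ : ∀ r R Z → r * (3 * (R * Z)) + r * R * Z ≡ 4 * (r * R * Z)
    lin₂ = solve-∀
    lin₃ : ∀ x → 2 * x + x ≡ 3 * x
    lin₃ = solve-∀

    n≤2ra : n ≤ 2 * ((2+ ρ) * a)
    n≤2ra = ≤-trans upper (≤-reflexive (trans (lin₁ (2+ ρ) (pow⁴ (2+ ρ)) Z) (cong (λ x → 2 * ((2+ ρ) * x)) (sym a≡))))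

    ra+≤n : (2+ ρ) * a + pow⁵ (2+ ρ) * Z ≤ n
    ra+≤n = ≤-trans (≤-reflexive (trans (cong (λ x → (2+ ρ) * x + pow⁵ (2+ ρ) * Z) a≡) (lin₂ (2+ ρ) (pow⁴ (2+ ρ)) Z))) lower

    bound′ : J * (2 ^ suc ρ * (4 * (2+ ρ)) ^ 7) ≤ a ^ suc ρ
    bound′ = joint-bound ρ n a J n≤2ra bound

  constants′ : Constants ρ n J
  constants′ = record
    { Z = Z ; a = a ; q = q ; X = X ; e = 2 * (pow⁴ (2+ ρ) * Z)
    ; p≤Z = p≤Z
    ; 0<a = A.0<a
    ; X≡ = X≡
    ; ra≤n = ≤-trans (m≤m+n ((2+ ρ) * a) (pow⁵ (2+ ρ) * Z)) ra+≤n
    ; e+3Z≤a = ≤-trans (+-monoʳ-≤ (2 * (pow⁴ (2+ ρ) * Z)) (*-monoˡ-≤ Z (≤-trans (m≤m+n 3 13) (16≤pow⁴ ρ))))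
        (≤-reflexive (trans (lin₃ (pow⁴ (2+ ρ) * Z)) (sym a≡)))
    ; local-bound = λ E → A.local-bound bound′ E upper
    ; pJ<Zaᵖ = A.pJ<Zaᵖ bound′
    ; global-bound = subst (λ k → k * (n * (n * J)) < (2+ ρ) * (2+ ρ) * (a * a * a ^ suc ρ)) (sym q≡) (A.global-bound bound′ n≤2ra)
    ; joint-contradiction = λ m α → A.joint-contradiction m α p≤Z
    ; final-contradiction = λ σ C σ≤ρ → E.final-contradiction σ C (n ∸ (2+ ρ) * a) σ≤ρ
        (≤-trans (≤-reflexive (sym (m+n∸m≡n ((2+ ρ) * a) _))) (∸-monoˡ-≤ ((2+ ρ) * a) ra+≤n))
    }

constants : ∀ ρ n J → (2+ ρ) ^ 8 < n → J * (4 * (2+ ρ)) ^ ((2+ ρ) + 6) ≤ n ^ suc ρ → Constants ρ n J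
constants ρ n J r⁸<n bound = assemble (scale ρ n r⁸<n) (m≤n⇒∃[o]m+o≡n positive)
  where
  positive : 1 ≤ 18 * pow⁶ (2+ ρ)
  positive = *-mono-≤ {1} {18} (s≤s z≤n) (*-mono-≤ {1} {2+ ρ} (s≤s z≤n)
    (*-mono-≤ {1} {2+ ρ} (s≤s z≤n) (≤-trans (s≤s z≤n) (16≤pow⁴ ρ))))
  assemble : (∃ λ Z → 4 * (pow⁵ (2+ ρ) * Z) ≤ n × n < 6 * (pow⁵ (2+ ρ) * Z) × suc ρ ≤ Z) →
    (∃ λ q → suc q ≡ 18 * pow⁶ (2+ ρ)) → Constants ρ n J
  assemble (Z , lower , upper , p≤Z) (q , q≡) =
    constants′ ρ n J Z (3 * (pow⁴ (2+ ρ) * Z)) (suc (3 * ρ) * Z) q p≤Z refl refl q≡ lower (<⇒≤ upper) bound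

-- The deletion process

module Loop (ρ σ n J : ℕ) (σ≤ρ : σ ≤ ρ) (K : Constants ρ n J) (G : Graph n)
  (joint : ∀ u v → adj G u v ≡ true → c G (suc ρ) (full ∩ adj G u ∩ adj G v) ≤ suc ρ ! * J) where

  open Constants K
  open ≤-Reasoning

  s : ℕ
  s = suc (suc σ)

  B : ℕ → Sub n
  B = below (2+ ρ) n

  gain : ℕ
  gain = s * (X * κ ρ a σ)

  #≤n : (U : Sub n) → # U ≤ n
  #≤n U = subst (# U ≤_) (#-full {n}) (#-mono {U = U} {full} (λ _ _ → refl))

  few-local : ∀ (U : Sub n) v → c G (2+ ρ) (U ∩ N G v) ≤ n * ((suc ρ) ! * J)
  few-local U v = begin
    c G (2+ ρ) (U ∩ N G v)           ≤⟨ ∑∈≤#* (U ∩ N G v) (λ u → c G (suc ρ) (U ∩ N G v ∩ N G u)) ((suc ρ) ! * J) few ⟩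
    # (U ∩ N G v) * ((suc ρ) ! * J)  ≤⟨ *-monoˡ-≤ ((suc ρ) ! * J) {# (U ∩ N G v)} {n} (#≤n (U ∩ N G v)) ⟩
    n * ((suc ρ) ! * J)              ∎
    where
    few : ∀ u → u ∈ U ∩ N G v → c G (suc ρ) (U ∩ N G v ∩ N G u) ≤ suc ρ ! * J
    few u u∈ = ≤-trans (c-mono G (suc ρ) (λ x x∈ → ∧-true (∧-trueʳ {U x} (∧-trueˡ x∈)) (∧-trueʳ {U x ∧ adj G v x} x∈)))
      (joint v u (∧-trueʳ {U u} u∈))

  few-global : (U : Sub n) → c G (suc (2+ ρ)) U ≤ n * (n * ((suc ρ) ! * J))
  few-global U = begin
    c G (suc (2+ ρ)) U           ≤⟨ ∑∈≤#* U (λ v → c G (2+ ρ) (U ∩ N G v)) (n * ((suc ρ) ! * J)) (λ v _ → few-local U v) ⟩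
    # U * (n * ((suc ρ) ! * J))  ≤⟨ *-monoˡ-≤ (n * ((suc ρ) ! * J)) {# U} {n} (#≤n U) ⟩
    n * (n * ((suc ρ) ! * J))    ∎

  -- For m = n and the full set this is the hypothesis on the s-cliques of `G`; every deletion adds
  -- one `gain`.
  Rich : ℕ → Sub n → Set
  Rich m U = c (turán (2+ ρ) n) s (B m) + (n ∸ m) * gain ≤ c G s U

  class-size : ∀ m x → m ≤ (2+ ρ) * a → # (B m ∩ (not ∘ N (turán (2+ ρ) n) x)) ≤ a
  class-size m x m≤ = ≤-trans (#-mono {U = B m ∩ (not ∘ N (turán (2+ ρ) n) x)} {B ((2+ ρ) * a) ∩ (not ∘ N (turán (2+ ρ) n) x)}
      λ y y∈ → ∧-true (∈below (2+ ρ) n ((2+ ρ) * a) (≤-trans (below⇒< (2+ ρ) n m (∧-trueˡ y∈)) m≤)) (∧-trueʳ {B m y} y∈))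
    (≤-reflexive (trans (nonneighbours≡size (2+ ρ) n ((2+ ρ) * a) x)
      (trans (cong (λ k → size (2+ ρ) n k (residue (2+ ρ) n x)) ra≡ar) (trans (size≡ (2+ ρ) n a 0 z≤n (subst (_≤ n) ra≡ar ra≤n) (residue (2+ ρ) n x)) (+-identityʳ a)))))
    where
    ra≡ar : (2+ ρ) * a ≡ a * (2+ ρ) + 0
    ra≡ar = trans (*-comm (2+ ρ) a) (sym (+-identityʳ (a * (2+ ρ))))

  -- The progression is perturbed by the factor q/(q+1) so that its term at t = r is still positive.
  -- Hence the dense alternative forces more (r+1)-cliques than the joints allow, and the sparse one
  -- leaves no room for the accumulated surplus.
  not-final : (U : Sub n) → # U ≡ (2+ ρ) * a → ¬ Rich ((2+ ρ) * a) U
  not-final U #U rich with approximate-zykov G (suc q) (2+ ρ) (λ t → (2+ ρ) * a + ((2+ ρ) ∸ t) * (q * a)) U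
    (λ j j<r → arithmetic-rec (2+ ρ) ((2+ ρ) * a) (q * a) j j<r)
    (≤-reflexive (trans (cong (suc q *_) #U) (lin (2+ ρ) a q))) (suc σ) (s≤s (≤-trans σ≤ρ (n≤1+n ρ)))
    where
    lin : ∀ r a q → suc q * (r * a) ≡ r * a + r * (q * a)
    lin = solve-∀
  ... | inj₁ sparse = final-contradiction σ (c G s U) σ≤ρ sparse (begin
      Π s (λ t → ((2+ ρ) ∸ t) * a) + (n ∸ (2+ ρ) * a) * gain
        ≤⟨ +-monoˡ-≤ _ (greedy (turán (2+ ρ) n) a {B ((2+ ρ) * a)} (λ v _ → class-size ((2+ ρ) * a) v ≤-refl) s {B ((2+ ρ) * a)} (λ t → ((2+ ρ) ∸ t) * a) (λ _ x∈ → x∈)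
             λ i i<s → ≤-reflexive (trans (sym (*-distribʳ-+ a ((2+ ρ) ∸ i) i)) (trans (cong (_* a) (m∸n+n≡m (≤-trans (<⇒≤ i<s) (s≤s (s≤s σ≤ρ)))))
               (sym (#below (2+ ρ) n ((2+ ρ) * a) ra≤n))))) ⟩
      c (turán (2+ ρ) n) s (B ((2+ ρ) * a)) + (n ∸ (2+ ρ) * a) * gain
        ≤⟨ rich ⟩
      c G s U ∎)
  ... | inj₂ dense = <⇒≱ (begin-strict
      suc q ^ suc (2+ ρ) * c G (suc (2+ ρ)) U
        ≤⟨ *-monoʳ-≤ (suc q ^ suc (2+ ρ)) (few-global U) ⟩
      suc q ^ suc (2+ ρ) * (n * (n * ((suc ρ) ! * J)))
        ≡⟨ lin₁ (suc q) (suc q ^ (2+ ρ)) n ((suc ρ) !) J ⟩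
      (suc ρ) ! * suc q ^ (2+ ρ) * (suc q * (n * (n * J)))
        <⟨ *-monoʳ-< ((suc ρ) ! * suc q ^ (2+ ρ)) {{>-nonZero (*-mono-≤ (1≤n! (suc ρ)) (m^n>0 (suc q) (2+ ρ)))}}
             global-bound ⟩
      (suc ρ) ! * suc q ^ (2+ ρ) * ((2+ ρ) * (2+ ρ) * (a * a * a ^ suc ρ))
        ≡⟨ trans (lin₂ ((suc ρ) !) (suc q ^ (2+ ρ)) (2+ ρ) a (a ^ suc ρ)) (cong (λ k → (2+ ρ) ! * k * ((2+ ρ) * a)) (sym (^-distribʳ-* (2+ ρ) (suc q) a))) ⟩
      (2+ ρ) ! * (suc q * a) ^ (2+ ρ) * ((2+ ρ) * a)
        ≡⟨ cong (_* ((2+ ρ) * a)) (Π-arithmetic (2+ ρ) (suc q * a)) ⟨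
      Π (2+ ρ) (λ t → ((2+ ρ) ∸ t) * (suc q * a)) * ((2+ ρ) * a)
        ≤⟨ *-mono-≤ (Π-mono (2+ ρ) λ t _ → pointwise t) (m≤m+n ((2+ ρ) * a) _) ⟩
      Π (suc (2+ ρ)) (λ t → (2+ ρ) * a + ((2+ ρ) ∸ t) * (q * a)) ∎) dense
    where
    lin₁ : ∀ q Q n f J → q * Q * (n * (n * (f * J))) ≡ f * Q * (q * (n * (n * J)))
    lin₁ = solve-∀
    lin₂ : ∀ f Q r a A → f * Q * (r * r * (a * a * A)) ≡ r * f * (Q * (a * A)) * (r * a)
    lin₂ = solve-∀
    pointwise : ∀ t → ((2+ ρ) ∸ t) * (suc q * a) ≤ (2+ ρ) * a + ((2+ ρ) ∸ t) * (q * a)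
    pointwise t = ≤-trans (≤-reflexive (*-distribˡ-+ ((2+ ρ) ∸ t) a (q * a))) (+-monoˡ-≤ _ (*-monoˡ-≤ a (m∸n≤m (2+ ρ) t)))

  module Window (m′ : ℕ) (m′<n : m′ < n) (ra≤m : (2+ ρ) * a ≤ suc m′) where

    T : Graph n
    T = turán (2+ ρ) n
    m : ℕ
    m = suc m′
    w : Fin n
    w = top (2+ ρ) n m′<n
    -- This is m/r rounded up, the size of the largest class of T_r(m).
    α : ℕ
    α = suc (m′ / (2+ ρ))

    rα≤ : (2+ ρ) * α ≤ m + suc ρ
    rα≤ = begin
      (2+ ρ) * suc (m′ / (2+ ρ))       ≡⟨ *-suc (2+ ρ) (m′ / (2+ ρ)) ⟩
      (2+ ρ) + (2+ ρ) * (m′ / (2+ ρ))  ≤⟨ +-monoʳ-≤ (2+ ρ) (≤-trans (≤-reflexive (*-comm (2+ ρ) (m′ / (2+ ρ)))) (≤-trans (m≤n+m _ (m′ % (2+ ρ))) (≤-reflexive (sym (m≡m%n+[m/n]*n m′ (2+ ρ)))))) ⟩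
      (2+ ρ) + m′                      ≡⟨ cong suc (+-comm (suc ρ) m′) ⟩
      m + suc ρ                        ∎

    m≤rα : m ≤ (2+ ρ) * α
    m≤rα = begin
      suc m′                                    ≡⟨ cong suc (m≡m%n+[m/n]*n m′ (2+ ρ)) ⟩
      suc (m′ % (2+ ρ)) + m′ / (2+ ρ) * (2+ ρ)  ≤⟨ +-monoˡ-≤ _ (m%n<n m′ (2+ ρ)) ⟩
      α * (2+ ρ)                                ≡⟨ *-comm α (2+ ρ) ⟩
      (2+ ρ) * α                                ∎

    nonneighbours≤α : ∀ v → # (B m ∩ (not ∘ N T v)) ≤ α
    nonneighbours≤α v = begin
      # (B m ∩ (not ∘ N T v))               ≡⟨ nonneighbours≡size (2+ ρ) n m v ⟩
      size (2+ ρ) n m (residue (2+ ρ) n v)  ≡⟨ cong (λ k → size (2+ ρ) n k (residue (2+ ρ) n v)) m≡ ⟩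
      size (2+ ρ) n (m′ / (2+ ρ) * (2+ ρ) + suc (m′ % (2+ ρ))) (residue (2+ ρ) n v)
        ≡⟨ size≡ (2+ ρ) n (m′ / (2+ ρ)) (suc (m′ % (2+ ρ))) (m%n<n m′ (2+ ρ)) (subst (_≤ n) m≡ m′<n) (residue (2+ ρ) n v) ⟩
      m′ / (2+ ρ) + ⟦ ⌊ toℕ (residue (2+ ρ) n v) <? suc (m′ % (2+ ρ)) ⌋ ⟧ ≤⟨ +-monoʳ-≤ (m′ / (2+ ρ)) (⟦⟧≤1 (2+ ρ) n _) ⟩
      m′ / (2+ ρ) + 1                               ≡⟨ +-comm (m′ / (2+ ρ)) 1 ⟩
      α                                        ∎
      where
      m≡ : m ≡ m′ / (2+ ρ) * (2+ ρ) + suc (m′ % (2+ ρ))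
      m≡ = trans (cong suc (trans (m≡m%n+[m/n]*n m′ (2+ ρ)) (+-comm (m′ % (2+ ρ)) _))) (sym (+-suc (m′ / (2+ ρ) * (2+ ρ)) (m′ % (2+ ρ))))

    a≤α : a ≤ α
    a≤α = *-cancelˡ-≤ (2+ ρ) (≤-trans ra≤m m≤rα)

    e+3Z≤α : e + 3 * Z ≤ α
    e+3Z≤α = ≤-trans e+3Z≤a a≤α

    E : ℕ
    E = α ∸ 3 * Z

    α≡ : α ≡ E + 3 * Z
    α≡ = sym (m∸n+n≡m (≤-trans (m≤n+m (3 * Z) e) e+3Z≤α))

    e≤E : e ≤ E
    e≤E = +-cancelʳ-≤ (3 * Z) _ _ (subst (e + 3 * Z ≤_) α≡ e+3Z≤α)

    rα+Z≤ : Z + (2+ ρ) * α ≤ m + 2 * Z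
    rα+Z≤ = begin
      Z + (2+ ρ) * α  ≤⟨ +-monoʳ-≤ Z (≤-trans rα≤ (+-monoʳ-≤ m p≤Z)) ⟩
      Z + (m + Z)     ≡⟨ lin Z m ⟩
      m + 2 * Z       ∎
      where
      lin : ∀ z m → z + (m + z) ≡ m + 2 * z
      lin = solve-∀

    -- The rounding error rα - m lies between 0 and r-1, and r-1 is at most `Z`; hence `y` lies
    -- between Z and 2Z whatever the residue of m.
    y : ℕ
    y = m + 2 * Z ∸ (2+ ρ) * α

    y≡ : y + (2+ ρ) * α ≡ m + 2 * Z
    y≡ = m∸n+n≡m (≤-trans (m≤n+m ((2+ ρ) * α) Z) rα+Z≤)

    Z≤y : Z ≤ y
    Z≤y = +-cancelʳ-≤ ((2+ ρ) * α) _ _ (subst (Z + (2+ ρ) * α ≤_) (sym y≡) rα+Z≤)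

    g : ℕ → ℕ
    g = factor {m} {α} {E} {y} α≡ y≡

    -- The dense alternative would put at least (r-1)! E^(r-1) Z ordered r-cliques into the
    -- neighbourhood of `v`, although each edge at `v` extends to at most (r-1)! J of them.
    sparse-neighbourhood : ∀ U v → # (U ∩ N G v) + (α + X) ≤ m → c G (suc σ) (U ∩ N G v) ≤ Π (suc σ) g
    sparse-neighbourhood U v deg with approximate-zykov G 1 (suc ρ) g (U ∩ N G v)
      (λ j j<p → arithmetic-rec (suc ρ) y E j j<p)
      (≤-trans (≤-reflexive (*-identityˡ _)) (+-cancelʳ-≤ (α + X) _ _ (≤-trans deg (≤-reflexive (sym (factor₀≡ {m} {α} {E} {y} α≡ y≡))))))
      σ (≤-trans σ≤ρ (n≤1+n ρ))
    ... | inj₁ sparse = subst (_≤ Π (suc σ) g) (trans (cong (_* c G (suc σ) (U ∩ N G v)) (^-zeroˡ (suc σ))) (*-identityˡ _)) sparse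
    ... | inj₂ dense = contradiction dense (<⇒≱ (begin-strict
        1 ^ (2+ ρ) * c G (2+ ρ) (U ∩ N G v)  ≡⟨ trans (cong (_* c G (2+ ρ) (U ∩ N G v)) (^-zeroˡ (2+ ρ))) (*-identityˡ _) ⟩
        c G (2+ ρ) (U ∩ N G v)               ≤⟨ few-local U v ⟩
        n * ((suc ρ) ! * J)                  ≡⟨ x*yz≡y*xz n ((suc ρ) !) J ⟩
        (suc ρ) ! * (n * J)                  <⟨ *-monoʳ-< ((suc ρ) !) {{>-nonZero (1≤n! (suc ρ))}} (local-bound E e≤E) ⟩
        (suc ρ) ! * (Z * E ^ suc ρ)          ≡⟨ cong ((suc ρ) ! *_) (*-comm Z (E ^ suc ρ)) ⟩
        (suc ρ) ! * (E ^ suc ρ * Z)          ≡⟨ *-assoc ((suc ρ) !) (E ^ suc ρ) Z ⟨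
        (suc ρ) ! * E ^ suc ρ * Z            ≤⟨ *-monoʳ-≤ ((suc ρ) ! * E ^ suc ρ) Z≤y ⟩
        (suc ρ) ! * E ^ suc ρ * y            ≤⟨ Π-arithmetic≥ (suc ρ) y E ⟩
        Π (2+ ρ) g                           ∎))

    #neighbours≥ : ∀ α′ W v → # (W ∩ (not ∘ N T v)) ≤ α′ → # W ≤ # (W ∩ N T v) + α′
    #neighbours≥ α′ W v le = ≤-trans (≤-reflexive (#-split W (N T v))) (+-monoʳ-≤ (# (W ∩ N T v)) le)

    #neighbours²≥ : ∀ m α′ → m ≤ n → (∀ v → # (B m ∩ (not ∘ N T v)) ≤ α′) → ∀ u v →
      m ≤ # (B m ∩ N T u ∩ N T v) + 2 * α′
    #neighbours²≥ m α′ m≤n nd u v = begin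
      m                     ≡⟨ #below (2+ ρ) n m m≤n ⟨
      # (B m)               ≤⟨ #neighbours≥ α′ (B m) u (nd u) ⟩
      # (B m ∩ N T u) + α′  ≤⟨ +-monoˡ-≤ α′ (#neighbours≥ α′ (B m ∩ N T u) v (≤-trans
        (#-mono {U = B m ∩ N T u ∩ (not ∘ N T v)} {B m ∩ (not ∘ N T v)}
          λ x x∈ → ∧-true (∧-trueˡ (∧-trueˡ x∈)) (∧-trueʳ {B m x ∧ N T u x} x∈)) (nd v))) ⟩
      # (B m ∩ N T u ∩ N T v) + α′ + α′  ≡⟨ lin (# (B m ∩ N T u ∩ N T v)) α′ ⟩
      # (B m ∩ N T u ∩ N T v) + 2 * α′   ∎
      where
      lin : ∀ x y → x + y + y ≡ x + 2 * y
      lin = solve-∀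

    -- `w` has at least g 0 + X neighbours, `X` more than the degree bound for a deleted vertex.
    -- Each neighbour carries enough cliques for the product, and these `X` extra ones yield X * κ
    -- on top.
    turán-gain : Π (suc σ) g + X * κ ρ a σ ≤ c T (suc σ) (B m ∩ N T w)
    turán-gain = begin
      Π (suc σ) g + X * κ ρ a σ
        ≡⟨ cong (_+ X * κ ρ a σ) (Π-cons σ g) ⟩
      g 0 * Π σ (g ∘ suc) + X * κ ρ a σ
        ≤⟨ +-mono-≤ (*-monoʳ-≤ (g 0) (m≤m⊔n (Π σ (g ∘ suc)) (κ ρ a σ))) (*-monoʳ-≤ X (m≤n⊔m (Π σ (g ∘ suc)) (κ ρ a σ))) ⟩
      g 0 * M + X * M
        ≡⟨ *-distribʳ-+ M (g 0) X ⟨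
      (g 0 + X) * M
        ≤⟨ *-monoˡ-≤ M (+-cancelʳ-≤ α _ _ (≤-trans (≤-reflexive (trans (lin (g 0) X α) (factor₀≡ {m} {α} {E} {y} α≡ y≡)))
             (≤-trans (≤-reflexive (sym (#below (2+ ρ) n m m′<n))) (#neighbours≥ α (B m) w (nonneighbours≤α w))))) ⟩
      # (B m ∩ N T w) * M
        ≤⟨ #*≤∑∈ (B m ∩ N T w) (λ x → c T σ (B m ∩ N T w ∩ N T x)) M (λ x _ → ⊔-lub (many x) (many′ x)) ⟩
      c T (suc σ) (B m ∩ N T w) ∎
      where
      -- Taking the maximum avoids comparing the two lower bounds: the product is needed with
      -- multiplicity g 0, κ with multiplicity X.
      M : ℕ
      M = Π σ (g ∘ suc) ⊔ κ ρ a σ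
      lin : ∀ x y z → x + y + z ≡ x + (z + y)
      lin = solve-∀
      lin′ : ∀ g i α → g + i * α + 2 * α ≡ g + (2 + i) * α
      lin′ = solve-∀
      many : ∀ x → Π σ (g ∘ suc) ≤ c T σ (B m ∩ N T w ∩ N T x)
      many x = greedy T α {B m} (λ v _ → nonneighbours≤α v) σ {B m ∩ N T w ∩ N T x} (g ∘ suc) (λ z z∈ → ∧-trueˡ (∧-trueˡ z∈)) λ i i<σ →
        +-cancelʳ-≤ (2 * α) _ _ (begin
          g (suc i) + i * α + 2 * α        ≡⟨ lin′ (g (suc i)) i α ⟩
          g (suc i) + suc (suc i) * α      ≤⟨ factor≤ {m} {α} {E} {y} α≡ y≡ (suc i) (≤-trans i<σ σ≤ρ) ⟩
          m                                ≤⟨ #neighbours²≥ m α m′<n nonneighbours≤α w x ⟩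
          # (B m ∩ N T w ∩ N T x) + 2 * α  ∎)
      many′ : ∀ x → κ ρ a σ ≤ c T σ (B m ∩ N T w ∩ N T x)
      many′ x = ≤-trans
        (greedy T a {B ((2+ ρ) * a)} (λ v _ → class-size ((2+ ρ) * a) v ≤-refl) σ {B ((2+ ρ) * a) ∩ N T w ∩ N T x} (λ t → (ρ ∸ t) * a)
          (λ z z∈ → ∧-trueˡ (∧-trueˡ z∈)) λ i i<σ → +-cancelʳ-≤ (2 * a) _ _ (begin
            (ρ ∸ i) * a + i * a + 2 * a                ≡⟨ cong (_+ 2 * a) (trans (sym (*-distribʳ-+ a (ρ ∸ i) i))
                                                            (cong (_* a) (m∸n+n≡m (≤-trans (<⇒≤ i<σ) σ≤ρ)))) ⟩
            ρ * a + 2 * a                               ≡⟨ trans (+-comm (ρ * a) _) (sym (*-distribʳ-+ a 2 ρ)) ⟩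
            (2+ ρ) * a                                  ≤⟨ #neighbours²≥ ((2+ ρ) * a) a ra≤n (λ v → class-size ((2+ ρ) * a) v ≤-refl) w x ⟩
            # (B ((2+ ρ) * a) ∩ N T w ∩ N T x) + 2 * a  ∎))
        (c-mono T σ λ z z∈ → ∧-true (∧-true (∈below (2+ ρ) n m (≤-trans (below⇒< (2+ ρ) n ((2+ ρ) * a) (∧-trueˡ (∧-trueˡ z∈))) ra≤m))
          (∧-trueʳ {B ((2+ ρ) * a) z} (∧-trueˡ z∈))) (∧-trueʳ {B ((2+ ρ) * a) z ∧ N T w z} z∈))

    -- `G` loses s times the cliques at `v`, T_r(m) loses s times those at `w`, and by `turán-gain`
    -- the latter are more by at least X * κ.
    Rich-remove : ∀ U v → v ∈ U → # (U ∩ N G v) + (α + X) ≤ m → Rich m U → Rich m′ (U - v)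
    Rich-remove U v v∈ deg rich = +-cancelʳ-≤ (s * c G (suc σ) (U ∩ N G v)) _ _ (begin
      c T s (B m′) + (n ∸ m′) * gain + s * cᵥ
        ≡⟨ cong (λ k → c T s (B m′) + k * gain + s * cᵥ) n∸m′ ⟩
      c T s (B m′) + suc (n ∸ m) * gain + s * cᵥ
        ≡⟨ lin (c T s (B m′)) (n ∸ m) s (X * κ ρ a σ) cᵥ ⟩
      c T s (B m′) + s * (cᵥ + X * κ ρ a σ) + (n ∸ m) * gain
        ≤⟨ +-monoˡ-≤ ((n ∸ m) * gain) (+-monoʳ-≤ (c T s (B m′)) (*-monoʳ-≤ s
             (≤-trans (+-monoˡ-≤ (X * κ ρ a σ) (sparse-neighbourhood U v deg)) turán-gain))) ⟩
      c T s (B m′) + s * c T (suc σ) (B m ∩ N T w) + (n ∸ m) * gain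
        ≡⟨ cong (_+ (n ∸ m) * gain) (trans (c-remove T (suc σ) (B m) w (top∈ (2+ ρ) n m′<n))
             (cong (_+ s * c T (suc σ) (B m ∩ N T w)) (c-cong T s (below-top (2+ ρ) n m′<n)))) ⟨
      c T s (B m) + (n ∸ m) * gain
        ≤⟨ rich ⟩
      c G s U
        ≡⟨ c-remove G (suc σ) U v v∈ ⟩
      c G s (U - v) + s * cᵥ ∎)
      where
      cᵥ : ℕ
      cᵥ = c G (suc σ) (U ∩ N G v)
      n∸m′ : n ∸ m′ ≡ suc (n ∸ m)
      n∸m′ = +-∸-assoc 1 m′<n
      lin : ∀ t k s x c → t + suc k * (s * x) + s * c ≡ t + s * (c + x) + k * (s * x)
      lin = solve-∀

    module _ (U : Sub n) (#U : # U ≡ m) (deg : ∀ v → v ∈ U → m ≤ # (U ∩ N G v) + (α + X)) where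

      -- Otherwise greedy extension in the common neighbourhood, losing at most D = α + X per step,
      -- yields ρ! D^ρ Z ordered (r-1)-cliques, too many on one edge.
      codegree≤ : ∀ u v → u ∈ U → v ∈ U → adj G u v ≡ true → # (U ∩ N G u ∩ N G v) ≤ Z + ρ * (α + X)
      codegree≤ u v u∈ v∈ uv = ≮⇒≥ λ large → <⇒≱ (pJ<Zaᵖ) (*-cancelˡ-≤ (ρ !) {{>-nonZero (1≤n! ρ)}} (begin
        ρ ! * (Z * a ^ ρ)        ≤⟨ *-monoʳ-≤ (ρ !) (*-monoʳ-≤ Z (^-monoˡ-≤ ρ (≤-trans a≤α (m≤m+n α X)))) ⟩
        ρ ! * (Z * (α + X) ^ ρ)  ≡⟨ trans (cong (ρ ! *_) (*-comm Z _)) (sym (*-assoc (ρ !) _ Z)) ⟩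
        ρ ! * (α + X) ^ ρ * Z    ≤⟨ Π-arithmetic≥ ρ Z (α + X) ⟩
        Π (suc ρ) (λ i → Z + (ρ ∸ i) * (α + X))
          ≤⟨ greedy G (α + X) nonneighbours≤ (suc ρ) _ (λ x x∈ → ∧-trueˡ (∧-trueˡ x∈)) (λ { i (s≤s i≤ρ) →
               ≤-trans (≤-reflexive (trans (+-assoc Z _ _) (cong (Z +_) (trans (sym (*-distribʳ-+ (α + X) (ρ ∸ i) i))
                 (cong (_* (α + X)) (m∸n+n≡m i≤ρ)))))) (<⇒≤ large) }) ⟩
        c G (suc ρ) (U ∩ N G u ∩ N G v)     ≤⟨ c-mono G (suc ρ) (λ x x∈ → ∧-true (∧-trueʳ {U x} (∧-trueˡ x∈)) (∧-trueʳ {U x ∧ N G u x} x∈)) ⟩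
        c G (suc ρ) (full ∩ N G u ∩ N G v)  ≤⟨ joint u v uv ⟩
        (suc ρ) ! * J                       ≡⟨ lin (suc ρ) (ρ !) J ⟩
        ρ ! * (suc ρ * J)                   ∎))
        where
        lin : ∀ p f J → p * f * J ≡ f * (p * J)
        lin = solve-∀
        nonneighbours≤ : ∀ v → v ∈ U → # (U ∩ (not ∘ N G v)) ≤ α + X
        nonneighbours≤ v v∈ = +-cancelˡ-≤ (# (U ∩ N G v)) _ _
          (subst (_≤ # (U ∩ N G v) + (α + X)) (trans (sym #U) (#-split U (N G v))) (deg v v∈))

      clique-free : c G (suc (2+ ρ)) U ≡ 0
      clique-free = n≤0⇒n≡0 (≮⇒≥ λ pos → joint-contradiction m α ra≤m rα≤
        (subst (λ k → 2 * suc ρ * (suc (suc (suc ρ)) * k) ≤ suc (suc (suc ρ)) * suc (suc ρ) * (Z + ρ * (α + X)) + suc (suc ρ) * suc ρ * k + 2 * suc ρ * (suc (suc (suc ρ)) * (α + X))) #U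
          (codegree-average G (suc ρ) U (α + X) (Z + ρ * (α + X)) (λ v v∈ → ≤-trans (≤-reflexive #U) (deg v v∈)) codegree≤ pos)))

  gain-positive : 0 < gain
  gain-positive = *-mono-≤ {1} {s} (s≤s z≤n) (*-mono-≤ (subst (0 <_) (sym X≡) (*-mono-≤ {1} {suc (3 * ρ)} (s≤s z≤n) 0<Z)) (κ-positive ρ 0<a σ σ≤ρ))

  module _ (dense : c (turán (2+ ρ) n) s full ≤ c G s full) (G≇T : ¬ (G ≅ turán (2+ ρ) n)) where

    -- `zykov` leaves no surplus, so no vertex was deleted and `U` is everything. The uniqueness
    -- case then makes `G` balanced complete r-partite, hence isomorphic to the Turán graph.
    clique-free⇒⊥ : ∀ m → m ≤ n → (U : Sub n) → # U ≡ m → c G (suc (2+ ρ)) U ≡ 0 → ¬ Rich m U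
    clique-free⇒⊥ m m≤n U #U free rich = G≇T (Balanced⇒≅
      (zykov-unique T G (below-TuránLike (2+ ρ) n n ≤-refl) s (s≤s (s≤s z≤n)) (s≤s (s≤s σ≤ρ)) s≤#
        full (#-cong {U = full} {B n} full≐)
        (c-mono-0 G (suc (2+ ρ)) {full} {U} full⊆U free)
        (subst (_≤ c G s full) (c-cong T s {full} {B n} full≐) dense))
      (turán-Balanced (2+ ρ) n))
      where
      T : Graph n
      T = turán (2+ ρ) n
      full≐ : full ≐ B n
      full≐ x = sym (below-full (2+ ρ) n x)
      excess≤0 : (n ∸ m) * gain ≤ 0
      excess≤0 = +-cancelˡ-≤ (c T s (B m)) ((n ∸ m) * gain) 0 (begin
        c T s (B m) + (n ∸ m) * gain  ≤⟨ rich ⟩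
        c G s U                       ≤⟨ zykov T G (below-TuránLike (2+ ρ) n m m≤n) U free (≤-reflexive (trans #U (sym (#below (2+ ρ) n m m≤n)))) s ⟩
        c T s (B m)                   ≡⟨ +-identityʳ (c T s (B m)) ⟨
        c T s (B m) + 0               ∎)
      n≤m : n ≤ m
      n≤m = m∸n≡0⇒m≤n (n≤0⇒n≡0 (≤-trans (m≤m*n (n ∸ m) gain {{>-nonZero gain-positive}}) excess≤0))
      full⊆U : full ⊆ U
      full⊆U = ⊆∧#≤⇒⊇ {A = U} {full} (λ _ _ → refl) (≤-trans (≤-reflexive (#-full {n})) (≤-trans n≤m (≤-reflexive (sym #U))))
      s≤# : s ≤ # (B n)
      s≤# = begin
        s           ≤⟨ s≤s (s≤s σ≤ρ) ⟩
        (2+ ρ)      ≤⟨ m≤m*n (2+ ρ) a {{>-nonZero 0<a}} ⟩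
        (2+ ρ) * a  ≤⟨ ra≤n ⟩
        n           ≡⟨ #below (2+ ρ) n n ≤-refl ⟨
        # (B n)     ∎

    -- Induction on the number `d` of vertices above the mark ra. Either some vertex has low degree
    -- and is deleted, or the minimum degree excludes (r+1)-cliques.
    no-rich-set : ∀ d m → m ≡ d + (2+ ρ) * a → m ≤ n → (U : Sub n) → # U ≡ m → ¬ Rich m U
    no-rich-set zero m refl m≤n U #U rich = not-final U #U rich
    no-rich-set (suc d) (suc m′) e m≤n U #U rich =
      delete (search U (λ v → # (U ∩ N G v) + (suc (m′ / (2+ ρ)) + X) ≤? suc m′))
      where
      ra≤m : (2+ ρ) * a ≤ suc m′
      ra≤m = ≤-trans (m≤n+m ((2+ ρ) * a) (suc d)) (≤-reflexive (sym e))
      delete : (∃ λ v → v ∈ U × # (U ∩ N G v) + (suc (m′ / (2+ ρ)) + X) ≤ suc m′) ⊎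
             (∀ v → v ∈ U → ¬ # (U ∩ N G v) + (suc (m′ / (2+ ρ)) + X) ≤ suc m′) → ⊥
      delete (inj₁ (v , v∈ , deg)) = no-rich-set d m′ (suc-injectiveℕ e) (<⇒≤ m≤n) (U - v)
        (suc-injectiveℕ (trans (sym (#-remove U v v∈)) #U)) (Window.Rich-remove m′ m≤n ra≤m U v v∈ deg rich)
      delete (inj₂ none) = clique-free⇒⊥ (suc m′) m≤n U #U
        (Window.clique-free m′ m≤n ra≤m U #U (λ v v∈ → ≰⇒≥ (none v v∈))) rich

    extremal-contradiction : ⊥
    extremal-contradiction = no-rich-set (n ∸ (2+ ρ) * a) n (sym (m∸n+n≡m ra≤n)) ≤-refl full (#-full {n})
      (subst₂ _≤_ (sym (trans (cong (λ k → c (turán (2+ ρ) n) s (B n) + k * gain) (n∸n≡0 n))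
        (trans (+-identityʳ _) (c-cong (turán (2+ ρ) n) s {B n} {full} (below-full (2+ ρ) n))))) refl dense)

-- From ordered cliques back to the clique counts and joints of the statement

theorem1 : (r s n : ℕ) → 2 ≤ s → s ≤ r → r ^ 8 < n →
    (G : Graph n) →
    ⦃ nz : NonZero r ⦄ →
    k s (turán r n) ≤ k s G →
    ¬ (G ≅ turán r n) →
    n ^ (r ∸ 1) < js (r + 1) G * (4 * r) ^ (r + 6)
theorem1 r (suc zero) n (s≤s ())
theorem1 (suc zero) (suc (suc σ)) n _ (s≤s ())
-- By contradiction: the negated conclusion is exactly the upper bound on the joint size `J` from
-- which the constants are built. Throughout, ρ = r-2 and σ = s-2.
theorem1 (suc (suc ρ)) (suc (suc σ)) n 2≤s (s≤s (s≤s σ≤ρ)) r⁸<n G k≤ G≇T = ≰⇒> λ bound →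
  Loop.extremal-contradiction ρ σ n (js (r + 1) G) σ≤ρ (constants ρ n (js (r + 1) G) r⁸<n bound) G joint dense G≇T
  where
  r p : ℕ
  r = suc (suc ρ)
  p = suc ρ
  dense : c (turán r n) (suc (suc σ)) full ≤ c G (suc (suc σ)) full
  dense = subst₂ _≤_ (sym (c≡t!*k (turán r n) (suc (suc σ)))) (sym (c≡t!*k G (suc (suc σ)))) (*-monoʳ-≤ (suc (suc σ) !) k≤)
  joint : ∀ u v → adj G u v ≡ true → c G p (full ∩ N G u ∩ N G v) ≤ p ! * js (r + 1) G
  joint u v uv = ≤-trans (≤-reflexive (c≡j!*cliquesThrough G p uv))
    (*-monoʳ-≤ (p !) (subst (λ t → cliquesThrough (suc r) G u v ≤ js t G) (+-comm 1 r) (cliquesThrough≤js (suc r) G uv)))
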